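{- Let $n\ge 3$ be odd and let $l$ be the smallest prime divisor of $n$. If \[ (l-1)(l+2)\le \frac{n+1}{2}, \] then $\mathcal K_n=\{3,4,\dots,n-3\}$.
   Context: The multiplicative inverse function $f_{\mathrm{inv}}$ of $\mathbb F_{2^n}$ is defined by $f_{\mathrm{inv}}(x)=x^{ -1}$ for $x\ne 0$ and $f_{\mathrm{inv}}(0)=0$. A function $f:\mathbb F_{2^n}\to\mathbb F_{2^n}$ is $k$th order sum-free if $\sum_{x\in A}f(x)\ne 0$ for every $k$-dimensional $\mathbb F_2$-affine subspace $A$ of $\mathbb F_{2^n}$. For $n\ge 2$, $\mathcal K_n=\{1\le k\le n-1: f_{\mathrm{inv}}\text{ is not $k$th order sum-free on }\mathbb F_{2^n}\}$. -}

module Defs where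

open import Data.Nat using (ℕ; zero; suc; _^_; _≤_; _∸_)
open import Data.Fin using (Fin)
open import Data.Bool using (Bool; true; false)
open import Data.Vec using (Vec; []; _∷_)
open import Data.Product using (Σ; ∃; _×_)
open import Relation.Binary.PropositionalEquality using (_≡_; _≢_)
open import Relation.Binary.Definitions using (DecidableEquality)
open import Algebra.Structures using (IsCommutativeRing)
open import Function.Bundles using (_↔_)
open import Level using (0ℓ)

-- A finite field with exactly 2^n elements (a model of F_{2^n}).
-- Equality is propositional and decidable; _⁻¹ is a total operation that
-- is the multiplicative inverse on nonzero elements and sends 0 to 0,
-- i.e. it is exactly the function f_inv of the paper.
record GF2^ (n : ℕ) : Set₁ where
  infixl 6 _+_
  infixl 7 _*_
  field
    Carrier : Set
    _+_ _*_ : Carrier → Carrier → Carrier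
    -_      : Carrier → Carrier
    0# 1#   : Carrier
    isCommutativeRing : IsCommutativeRing _≡_ _+_ _*_ -_ 0# 1#
    0≢1     : 0# ≢ 1#
    _⁻¹     : Carrier → Carrier
    ⁻¹-inverse : ∀ x → x ≢ 0# → x * (x ⁻¹) ≡ 1#
    ⁻¹-zero : 0# ⁻¹ ≡ 0#
    _≟_     : DecidableEquality Carrier
    card    : Carrier ↔ Fin (2 ^ n)

module _ {n : ℕ} (F : GF2^ n) where
  open GF2^ F

  finv : Carrier → Carrier
  finv x = x ⁻¹

  lincomb : ∀ {k} → Vec Bool k → Vec Carrier k → Carrier
  lincomb [] [] = 0#
  lincomb (true ∷ c) (v ∷ vs) = v + lincomb c vs
  lincomb (false ∷ c) (v ∷ vs) = lincomb c vs

  LinIndep : ∀ {k} → Vec Carrier k → Set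
  LinIndep {k} vs = ∀ (c : Vec Bool k) → lincomb c vs ≡ 0# → c ≡ Data.Vec.replicate k false

  sumBool : (k : ℕ) → (Vec Bool k → Carrier) → Carrier
  sumBool zero g = g []
  sumBool (suc k) g = sumBool k (λ c → g (false ∷ c)) + sumBool k (λ c → g (true ∷ c))

  affineSum : ∀ {k} → (Carrier → Carrier) → Carrier → Vec Carrier k → Carrier
  affineSum {k} f a vs = sumBool k (λ c → f (a + lincomb c vs))

  -- f is k-th order sum-free: for every k-dimensional affine subspace
  -- A = a + span(v_1..v_k) (v_i linearly independent), Σ_{x∈A} f(x) ≠ 0
  SumFree : ℕ → (Carrier → Carrier) → Set
  SumFree k f = ∀ (a : Carrier) (vs : Vec Carrier k) → LinIndep vs → affineSum f a vs ≢ 0#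

  InK : ℕ → Set
  InK k = (1 ≤ k) × (k ≤ n ∸ 1) × (SumFree k finv → Data.Empty.⊥)
    where import Data.Empty

module Submission where

-- For an F₂-subspace E let L_E = ∏ (X + u) over u in E and P_E = L_E′. Then Σ 1/(a + u) = P_E / L_E(a), which
-- is nonzero for a outside E, so only linear subspaces matter; write S(E) for the sum of inverses over E.
-- From S(E ⊕ V) = S(E) + P_E S(L_E(V)) and S(F) = 0 one gets the duality k ↔ n − k. Dimensions 1 and 2 are
-- impossible for odd n, hence so are n − 1 and n − 2.
--
-- Conversely, if S(E) = 0 then any subspace of im L_E with vanishing S lifts to enlarge E. Since im L_E has
-- codimension dim E, it contains a multiple yE′ of a given E′ as soon as dim E · dim E′ < n (so dimensions
-- add), and F_{2^l}-subspaces of F_{2^l}-dimension up to n / l − dim E. Starting from dimensions 3 to l + 2 this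
-- reaches every k ≤ n / 2, by the size hypothesis on l, and duality gives the rest.
--
-- Dimensions 3, 4, 5 are 2 + b with b = 1, 2, 3: one needs a point of the conic x² + x y + y² = 1 with both
-- coordinates orthogonal to a given b-dimensional space for the trace form. Such a point exists when n ≥ 8b + 2,
-- because the character sums K over the conic are small: a sum of two points of the conic determines the pair,
-- which bounds Σ K⁴, and K is constant on the orbits of the norm-one group of F(ω). This leaves b = 3, n = 21,
-- where the plane and the space are taken in the subfields F₈ and F₁₂₈.

open import Algebra.Bundles using (CommutativeMonoid; CommutativeRing; RawRing)
import Algebra.Properties.Monoid.Mult
import Algebra.Properties.Semiring.Exp
import Algebra.Solver.Ring
open import Algebra.Solver.Ring.AlmostCommutativeRing using (fromCommutativeRing; _-Raw-AlmostCommutative⟶_)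
open import Data.Bool as Bool using (Bool; true; false; _xor_; _∧_)
open import Data.Fin as Fin using (Fin; zero; suc; punchIn; punchOut; combine; remQuot)
import Data.Fin.Properties as Fin
open import Data.Integer as ℤ using (ℤ; 0ℤ; 1ℤ; -1ℤ; +≤+; ∣_∣)
import Data.Integer.Properties as ℤ
import Data.Integer.Tactic.RingSolver as ℤS
open import Data.Maybe using (Maybe; just; nothing)
open import Data.Nat as ℕ using (ℕ; zero; suc; z≤n; s≤s)
import Data.Nat.DivMod as ℕ
open import Data.Nat.Divisibility using (divides)
open import Data.Nat.Primality using (¬prime[0]; ¬prime[1])
import Data.Nat.Properties as ℕ
import Data.Nat.Tactic.RingSolver as ℕS
open import Data.Product using (Σ; ∃; ∃₂; _×_; _,_; proj₁; proj₂)
open import Data.Product.Function.NonDependent.Propositional using (_×-↔_)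
import Data.Product.Properties as Product
open import Data.Sum using (_⊎_; inj₁; inj₂)
open import Data.Unit using (⊤; tt)
open import Data.Vec using (Vec; []; _∷_; _++_; _∷ʳ_; initLast; map; replicate)
import Data.Vec.Properties as Vec
open import Data.Vec.Relation.Unary.All as All using (All; []; _∷_; all?)
import Data.Vec.Relation.Unary.All.Properties as All
open import Function using (_∘_)
open import Function.Bundles using (_↔_; Inverse; mk⇔)
open import Function.Construct.Composition using (_↔-∘_)
open import Function.Properties.Inverse using (↔-sym)
open import Level using (0ℓ)
open import Relation.Binary.Definitions using (DecidableEquality; tri<; tri≈; tri>)
open import Relation.Binary.PropositionalEquality
open import Relation.Nullary using (Dec; yes; no; ¬_; contradiction)
open import Relation.Nullary.Decidable using (_×-dec_; ¬?; from-no)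
open import Relation.Unary using (Decidable)
open import Defs

-- Adding dimensions needs spaces to start from, and dimensions 1 and 2 offer none. So 3, 4 and 5
-- are produced directly; adding 3 again and again then completes a residue system modulo l, and
-- shifts by multiples of l do the rest.
--
-- A plane spanned by a, b with a² + a b + b² = 1 has S = 1 / P, which is what a space with S = 1,
-- scaled and lifted, can cancel: this is the role of the conic.
--
-- With W ≥ 2ⁿ points on the conic, its character sums obey K⁴ ≤ 3 · 4ⁿ · W, so |K| is at most of
-- order 2^(3n/4). This is weaker than a square-root bound but elementary. Both trace conditions
-- together involve 4^b characters, so every nontrivial K should be at most W / 4^b in size; 3 ·
-- 2^(8b) < 2ⁿ ensures this, whence n ≥ 8b + 2.
--
-- Dimension counts are pigeonhole arguments. A coset of im L_E is recorded by dim E bits, so asking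
-- that y u lie in im L_E for all u in a basis of E′ costs dim E · dim E′ bits; when there are more
-- scalars than codes, two scalars share a code and their sum is the y wanted.

Inj : {A B : Set} → (A → B) → Set
Inj f = ∀ {x y} → f x ≡ f y → x ≡ y

-- Injections between finite sets

module _ {a b} (e : Fin (suc a) → Fin (suc b)) (inj : Inj e) where

  e0≢ : ∀ i → e zero ≢ e (suc i)
  e0≢ i eq = contradiction (inj eq) λ()

  -- Removes `zero` from the domain and its image from the codomain, so that sums over injections
  -- can be handled by induction.
  deflate : Fin a → Fin b
  deflate i = punchOut (e0≢ i)

  deflate-injective : Inj deflate
  deflate-injective {i} {j} eq =
    Fin.suc-injective (inj (Fin.punchOut-injective (e0≢ i) (e0≢ j) eq))

  punchIn-deflate : ∀ i → punchIn (e zero) (deflate i) ≡ e (suc i)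
  punchIn-deflate i = Fin.punchIn-punchOut (e0≢ i)

-- Bit vectors as a finite set

bit : Fin 2 → Bool
bit zero    = false
bit (suc _) = true

unbit : Bool → Fin 2
unbit false = zero
unbit true  = suc zero

bit-unbit : ∀ b → bit (unbit b) ≡ b
bit-unbit false = refl
bit-unbit true  = refl

unbit-bit : ∀ i → unbit (bit i) ≡ i
unbit-bit zero       = refl
unbit-bit (suc zero) = refl

enc : ∀ {k} → Vec Bool k → Fin (2 ℕ.^ k)
enc []      = zero
enc (b ∷ c) = combine (unbit b) (enc c)

dec : ∀ k → Fin (2 ℕ.^ k) → Vec Bool k
dec zero    i = []
dec (suc k) i = bit (proj₁ (remQuot {2} (2 ℕ.^ k) i)) ∷ dec k (proj₂ (remQuot {2} (2 ℕ.^ k) i))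

dec-enc : ∀ {k} (c : Vec Bool k) → dec k (enc c) ≡ c
dec-enc [] = refl
dec-enc {suc k} (b ∷ c) = trans
  (cong (λ p → bit (proj₁ p) ∷ dec k (proj₂ p)) (Fin.remQuot-combine {2} {2 ℕ.^ k} (unbit b) (enc c)))
  (cong₂ _∷_ (bit-unbit b) (dec-enc c))

enc-dec : ∀ k (i : Fin (2 ℕ.^ k)) → enc (dec k i) ≡ i
enc-dec zero zero = refl
enc-dec (suc k) i =
  trans (cong₂ combine (unbit-bit (proj₁ p)) (enc-dec k (proj₂ p))) (Fin.combine-remQuot {2} (2 ℕ.^ k) i)
  where
  p : Fin 2 × Fin (2 ℕ.^ k)
  p = remQuot (2 ℕ.^ k) i

enc-injective : ∀ {k} → Inj (enc {k})
enc-injective {k} {c} {d} eq = trans (sym (dec-enc c)) (trans (cong (dec k) eq) (dec-enc d))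

dec-injective : ∀ k → Inj (dec k)
dec-injective k {i} {j} eq = trans (sym (enc-dec k i)) (trans (cong enc eq) (enc-dec k j))

2^-cancel-≤ : ∀ {m n} → 2 ℕ.^ m ℕ.≤ 2 ℕ.^ n → m ℕ.≤ n
2^-cancel-≤ {m} {n} le with m ℕ.≤? n
... | yes p = p
... | no ¬p = contradiction (ℕ.^-monoʳ-< 2 (s≤s (s≤s z≤n)) (ℕ.≰⇒> ¬p)) (ℕ.≤⇒≯ le)

-- Search and summation over a finite set

module Finite {A : Set} {N : ℕ} (iso : A ↔ Fin N) where

  index : A → Fin N
  index = Inverse.to iso

  element : Fin N → A
  element = Inverse.from iso

  index-element : ∀ i → index (element i) ≡ i
  index-element i = Inverse.inverseˡ iso refl

  element-index : ∀ x → element (index x) ≡ x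
  element-index x = Inverse.inverseʳ iso refl

  index-injective : Inj index
  index-injective {x} {y} eq = trans (sym (element-index x)) (trans (cong element eq) (element-index y))

  element-injective : Inj element
  element-injective {x} {y} eq = trans (sym (index-element x)) (trans (cong index eq) (index-element y))

  abstract
    search : {P : A → Set} → Decidable P → Dec (∃ P)
    search {P} P? with Fin.any? (P? ∘ element)
    ... | yes (i , p) = yes (element i , p)
    ... | no ¬p = no λ (x , p) → ¬p (index x , subst P (sym (element-index x)) p)

    -- Pigeonhole: a missed `y` together with the values of `f` would inject N + 1 points into N.
    surjective : ∀ {f : A → A} → Inj f → ∀ y → ∃ λ x → f x ≡ y
    surjective {f} inj y with Fin.any? (λ i → index (f (element i)) Fin.≟ index y)
    ... | yes (i , eq) = element i , index-injective eq
    ... | no ¬p = contradiction (Fin.injective⇒≤ {f = g} g-injective) ℕ.1+n≰n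
      where
      g : Fin (suc N) → Fin N
      g zero    = index y
      g (suc i) = index (f (element i))
      g-injective : Inj g
      g-injective {zero}  {zero}  eq = refl
      g-injective {zero}  {suc j} eq = contradiction (j , sym eq) ¬p
      g-injective {suc i} {zero}  eq = contradiction (i , eq) ¬p
      g-injective {suc i} {suc j} eq = cong suc (element-injective (inj (index-injective eq)))

module SumInjective (M : CommutativeMonoid 0ℓ 0ℓ) where
  open CommutativeMonoid M renaming (refl to ≈-refl; sym to ≈-sym; trans to ≈-trans; reflexive to ≈-reflexive)
  open import Algebra.Properties.CommutativeMonoid.Sum M

  -- An injective self-map of `Fin a` is a permutation. The term at `e zero` is split off on the
  -- right, and `deflate` handles the others.
  sum-injective : ∀ {a} (e : Fin a → Fin a) → Inj e → (g : Fin a → Carrier) → sum (g ∘ e) ≈ sum g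
  sum-injective {zero}  e inj g = ≈-refl
  sum-injective {suc a} e inj g = ≈-trans
    (∙-congˡ (≈-trans
      (≈-reflexive (sum-cong-≗ (λ i → cong g (sym (punchIn-deflate e inj i)))))
      (sum-injective (deflate e inj) (deflate-injective e inj) (g ∘ punchIn (e zero)))))
    (≈-sym (sum-remove {i = e zero} g))

  sum-zero : ∀ {a} {g : Fin a → Carrier} → (∀ i → g i ≈ ε) → sum g ≈ ε
  sum-zero {a} z = ≈-trans (sum-cong-≋ z) (sum-replicate-zero a)

module Sum (M : CommutativeMonoid 0ℓ 0ℓ) {A : Set} {N : ℕ} (iso : A ↔ Fin N) where
  open CommutativeMonoid M renaming (refl to ≈-refl; sym to ≈-sym; trans to ≈-trans; reflexive to ≈-reflexive)
  open Finite iso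
  private module FS = SumInjective M
  open import Algebra.Properties.CommutativeMonoid.Sum M

  ∑ : (A → Carrier) → Carrier
  ∑ g = sum (g ∘ element)

  ∑-cong : ∀ {f g} → (∀ x → f x ≈ g x) → ∑ f ≈ ∑ g
  ∑-cong eq = sum-cong-≋ (λ i → eq (element i))

  ∑-∙ : ∀ f g → ∑ (λ x → f x ∙ g x) ≈ ∑ f ∙ ∑ g
  ∑-∙ f g = ∑-distrib-+ (f ∘ element) (g ∘ element)

  ∑-ε : ∀ {f} → (∀ x → f x ≈ ε) → ∑ f ≈ ε
  ∑-ε z = FS.sum-zero (λ i → z (element i))

  ∑-reindex : ∀ {e : A → A} → Inj e → ∀ g → ∑ (g ∘ e) ≈ ∑ g
  ∑-reindex {e} inj g = ≈-trans
    (∑-cong (λ x → ≈-reflexive (cong g (sym (element-index (e x))))))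
    (FS.sum-injective (index ∘ e ∘ element) (λ eq → element-injective (inj (index-injective eq))) (g ∘ element))

  ∑-single : ∀ y g → (∀ x → x ≢ y → g x ≈ ε) → ∑ g ≈ g y
  ∑-single y g z = single element-injective (index y) (element-index y)
    where
    single : ∀ {n} {el : Fin n → A} → Inj el → (i : Fin n) → el i ≡ y → sum (g ∘ el) ≈ g y
    single {suc n} {el} inj i refl = ≈-trans (sum-remove {i = i} (g ∘ el))
      (≈-trans
        (∙-congˡ (FS.sum-zero (λ j → z _ (λ eq → Fin.punchInᵢ≢i i j (inj eq)))))
        (identityʳ _))

-- Inequalities between integer sums

module IntegerSums where

  open import Data.Integer using (+_; -[1+_]; _+_; _*_; _≤_)
  open import Data.Integer.Tactic.RingSolver using (solve-∀)
  open import Algebra.Properties.CommutativeMonoid.Sum ℤ.+-0-commutativeMonoid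

  sum-mono : ∀ {a} {f g : Fin a → ℤ} → (∀ i → f i ≤ g i) → sum f ≤ sum g
  sum-mono {zero}  le = ℤ.≤-refl
  sum-mono {suc a} le = ℤ.+-mono-≤ (le zero) (sum-mono (le ∘ suc))

  sum-≥0 : ∀ {a} {f : Fin a → ℤ} → (∀ i → 0ℤ ≤ f i) → 0ℤ ≤ sum f
  sum-≥0 {zero}  pos = ℤ.≤-refl
  sum-≥0 {suc a} pos = ℤ.+-mono-≤ (pos zero) (sum-≥0 (pos ∘ suc))

  sum-* : ∀ {a} c (f : Fin a → ℤ) → sum (λ i → c * f i) ≡ c * sum f
  sum-* {zero}  c f = sym (ℤ.*-zeroʳ c)
  sum-* {suc a} c f =
    trans (cong (_+_ (c * f zero)) (sum-* c (f ∘ suc))) (sym (ℤ.*-distribˡ-+ c (f zero) (sum (f ∘ suc))))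

  sum-ones : ∀ a → sum {a} (λ _ → 1ℤ) ≡ + a
  sum-ones zero    = refl
  sum-ones (suc a) = cong (_+_ 1ℤ) (sum-ones a)

  sum-injective-≤ : ∀ {a b} (e : Fin a → Fin b) → Inj e → (g : Fin b → ℤ) → (∀ i → 0ℤ ≤ g i) → sum (g ∘ e) ≤ sum g
  sum-injective-≤ {zero}          e inj g pos = sum-≥0 pos
  sum-injective-≤ {suc a} {zero}  e inj g pos = contradiction (e zero) λ()
  sum-injective-≤ {suc a} {suc b} e inj g pos = begin
    g (e zero) + sum (g ∘ e ∘ suc)
      ≡⟨ cong (_+_ (g (e zero))) (sum-cong-≗ (λ i → cong g (sym (punchIn-deflate e inj i)))) ⟩
    g (e zero) + sum (g ∘ punchIn (e zero) ∘ deflate e inj)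
      ≤⟨ ℤ.+-monoʳ-≤ (g (e zero))
           (sum-injective-≤ (deflate e inj) (deflate-injective e inj) (g ∘ punchIn (e zero)) (pos ∘ punchIn (e zero))) ⟩
    g (e zero) + sum (g ∘ punchIn (e zero))
      ≡⟨ sum-remove {i = e zero} g ⟨
    sum g ∎
    where open ℤ.≤-Reasoning

  0≤i*i : ∀ i → 0ℤ ≤ i * i
  0≤i*i (+ n)    = subst (_≤_ 0ℤ) (ℤ.pos-* n n) (+≤+ z≤n)
  0≤i*i -[1+ n ] = +≤+ z≤n

  0≤* : ∀ {i j} → 0ℤ ≤ i → 0ℤ ≤ j → 0ℤ ≤ i * j
  0≤* {+ m} {+ n} _ _ = subst (_≤_ 0ℤ) (ℤ.pos-* m n) (+≤+ z≤n)

  *-monoˡ : ∀ {c i j} → 0ℤ ≤ c → i ≤ j → c * i ≤ c * j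
  *-monoˡ {+ c} _ le = ℤ.*-monoˡ-≤-nonNeg (+ c) le

  module ℤSum {A : Set} {N : ℕ} (iso : A ↔ Fin N) where
    open Finite iso
    open Sum ℤ.+-0-commutativeMonoid iso public

    ∑-mono : ∀ {f g} → (∀ x → f x ≤ g x) → ∑ f ≤ ∑ g
    ∑-mono le = sum-mono (λ i → le (element i))

    ∑-≥0 : ∀ {f} → (∀ x → 0ℤ ≤ f x) → 0ℤ ≤ ∑ f
    ∑-≥0 pos = sum-≥0 (λ i → pos (element i))

    ∑-* : ∀ c f → ∑ (λ x → c * f x) ≡ c * ∑ f
    ∑-* c f = sum-* c (f ∘ element)

    ∑-ones : ∑ (λ _ → 1ℤ) ≡ + N
    ∑-ones = sum-ones N

    ∑-swap : ∀ (f : A → A → ℤ) → ∑ (λ x → ∑ (f x)) ≡ ∑ (λ y → ∑ (λ x → f x y))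
    ∑-swap f = ∑-comm {N} {N} (λ i j → f (element i) (element j))

    ∑-product : ∀ f g → ∑ f * ∑ g ≡ ∑ (λ x → ∑ (λ y → f x * g y))
    ∑-product f g = begin
      ∑ f * ∑ g                       ≡⟨ ℤ.*-comm (∑ f) (∑ g) ⟩
      ∑ g * ∑ f                       ≡⟨ ∑-* (∑ g) f ⟨
      ∑ (λ x → ∑ g * f x)             ≡⟨ ∑-cong (λ x → trans (ℤ.*-comm (∑ g) (f x)) (sym (∑-* (f x) g))) ⟩
      ∑ (λ x → ∑ (λ y → f x * g y))   ∎
      where open ≡-Reasoning

  -- Fourier analysis and the fourth moment

  -- A finite elementary abelian 2-group V with a perfect ±1-valued pairing, and a group Ω ⊂ V of
  -- self-adjoint operators acting freely, such that every nonzero element is a sum of at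
  -- most one pair of elements of Ω.
  module FourthMoment
    {V : Set} {M : ℕ} (iso : V ↔ Fin M) (_≟_ : DecidableEquality V)
    (𝟘 : V) (_⊕_ : V → V → V) (_⊙_ : V → V → V) (⟨_,_⟩ : V → V → ℤ) (Ω : V → Set) (Ω? : ∀ v → Dec (Ω v))
    (⊕-𝟘 : ∀ v → v ⊕ 𝟘 ≡ v) (⊕-cancel : ∀ u v → u ⊕ (u ⊕ v) ≡ v)
    (pairing-⊕ : ∀ θ u v → ⟨ θ , u ⊕ v ⟩ ≡ ⟨ θ , u ⟩ * ⟨ θ , v ⟩)
    (pairing-² : ∀ θ v → ⟨ θ , v ⟩ * ⟨ θ , v ⟩ ≡ 1ℤ)
    (orthogonal : ∀ {v} → v ≢ 𝟘 → ℤSum.∑ iso (λ θ → ⟨ θ , v ⟩) ≡ 0ℤ)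
    (adjoint : ∀ ρ θ v → ⟨ ρ ⊙ θ , v ⟩ ≡ ⟨ θ , ρ ⊙ v ⟩)
    (Ω-closed : ∀ {ρ} → Ω ρ → ∀ {v} → Ω v → Ω (ρ ⊙ v)) (Ω-closed⁻ : ∀ {ρ} → Ω ρ → ∀ {v} → Ω (ρ ⊙ v) → Ω v)
    (Ω-injective : ∀ {ρ} → Ω ρ → Inj (ρ ⊙_)) (free : ∀ {θ} → θ ≢ 𝟘 → Inj (_⊙ θ))
    (sum-of-two : ∀ {v a b} → v ≢ 𝟘 → Ω a → Ω (a ⊕ v) → Ω b → Ω (b ⊕ v) → b ≡ a ⊎ b ≡ a ⊕ v)
    where

    open Finite iso
    open ℤSum iso

    1[_] : ∀ {P : Set} → Dec P → ℤ
    1[ yes _ ] = 1ℤ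
    1[ no _ ]  = 0ℤ

    1[]-≥0 : ∀ {P : Set} (d : Dec P) → 0ℤ ≤ 1[ d ]
    1[]-≥0 (yes _) = +≤+ z≤n
    1[]-≥0 (no _)  = +≤+ z≤n

    1[]-yes : ∀ {P : Set} (d : Dec P) → P → 1[ d ] ≡ 1ℤ
    1[]-yes (yes _) p = refl
    1[]-yes (no ¬p) p = contradiction p ¬p

    1[]-no : ∀ {P : Set} (d : Dec P) → ¬ P → 1[ d ] ≡ 0ℤ
    1[]-no (yes p) ¬p = contradiction p ¬p
    1[]-no (no _)  ¬p = refl

    ∑-indicator : ∀ u → ∑ (λ v → 1[ v ≟ u ]) ≡ 1ℤ
    ∑-indicator u = trans (∑-single u (λ v → 1[ v ≟ u ]) (λ v → 1[]-no (v ≟ u))) (1[]-yes (u ≟ u) refl)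

    ind : V → ℤ
    ind v = 1[ Ω? v ]

    W : ℤ
    W = ∑ ind

    -- The unnormalised Fourier transform.
    transform : (V → ℤ) → V → ℤ
    transform f θ = ∑ (λ v → f v * ⟨ θ , v ⟩)

    K : V → ℤ
    K = transform ind

    ⊕-injective : ∀ u → Inj (u ⊕_)
    ⊕-injective u {v} {w} eq = trans (sym (⊕-cancel u v)) (trans (cong (u ⊕_) eq) (⊕-cancel u w))

    ⊕-≢𝟘 : ∀ {u v} → v ≢ u → u ⊕ v ≢ 𝟘
    ⊕-≢𝟘 {u} {v} v≢u eq = v≢u (trans (sym (⊕-cancel u v)) (trans (cong (u ⊕_) eq) (⊕-𝟘 u)))

    -- Expanding the square gives the pairings ⟨θ, v ⊕ w⟩ summed over θ; orthogonality leaves only w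
    -- = v, where each of the M terms is 1.
    parseval : ∀ f → ∑ (λ θ → transform f θ * transform f θ) ≡ + M * ∑ (λ v → f v * f v)
    parseval f = begin
      ∑ (λ θ → transform f θ * transform f θ)
        ≡⟨ ∑-cong (λ θ → ∑-product (λ v → f v * ⟨ θ , v ⟩) (λ w → f w * ⟨ θ , w ⟩)) ⟩
      ∑ (λ θ → ∑ (λ v → ∑ (λ w → f v * ⟨ θ , v ⟩ * (f w * ⟨ θ , w ⟩))))
        ≡⟨ ∑-swap (λ θ v → ∑ (λ w → f v * ⟨ θ , v ⟩ * (f w * ⟨ θ , w ⟩))) ⟩
      ∑ (λ v → ∑ (λ θ → ∑ (λ w → f v * ⟨ θ , v ⟩ * (f w * ⟨ θ , w ⟩))))
        ≡⟨ ∑-cong (λ v → ∑-swap (λ θ w → f v * ⟨ θ , v ⟩ * (f w * ⟨ θ , w ⟩))) ⟩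
      ∑ (λ v → ∑ (λ w → ∑ (λ θ → f v * ⟨ θ , v ⟩ * (f w * ⟨ θ , w ⟩))))
        ≡⟨ ∑-cong (λ v → ∑-cong (λ w → collect v w)) ⟩
      ∑ (λ v → ∑ (λ w → f v * f w * ∑ (λ θ → ⟨ θ , v ⊕ w ⟩)))
        ≡⟨ ∑-cong (λ v → ∑-single v (λ w → f v * f w * ∑ (λ θ → ⟨ θ , v ⊕ w ⟩)) (λ w w≢v →
             trans (cong (f v * f w *_) (orthogonal (⊕-≢𝟘 w≢v))) (ℤ.*-zeroʳ (f v * f w)))) ⟩
      ∑ (λ v → f v * f v * ∑ (λ θ → ⟨ θ , v ⊕ v ⟩))
        ≡⟨ ∑-cong (λ v → trans (cong (f v * f v *_) (diagonal v)) (ℤ.*-comm (f v * f v) (+ M))) ⟩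
      ∑ (λ v → + M * (f v * f v))
        ≡⟨ ∑-* (+ M) (λ v → f v * f v) ⟩
      + M * ∑ (λ v → f v * f v) ∎
      where
      open ≡-Reasoning
      regroup : ∀ a b c d → a * b * (c * d) ≡ a * c * (b * d)
      regroup = solve-∀
      collect : ∀ v w → ∑ (λ θ → f v * ⟨ θ , v ⟩ * (f w * ⟨ θ , w ⟩)) ≡ f v * f w * ∑ (λ θ → ⟨ θ , v ⊕ w ⟩)
      collect v w = trans (∑-cong (λ θ → trans (regroup (f v) ⟨ θ , v ⟩ (f w) ⟨ θ , w ⟩)
        (cong (f v * f w *_) (sym (pairing-⊕ θ v w))))) (∑-* (f v * f w) (λ θ → ⟨ θ , v ⊕ w ⟩))
      diagonal : ∀ v → ∑ (λ θ → ⟨ θ , v ⊕ v ⟩) ≡ + M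
      diagonal v = trans (∑-cong (λ θ → trans (pairing-⊕ θ v v) (pairing-² θ v))) ∑-ones

    -- The autocorrelation of Ω: the number of ways to write v as an ordered sum of two elements of
    -- Ω.
    R : V → ℤ
    R v = ∑ (λ a → ind a * ind (a ⊕ v))

    -- The convolution theorem: ordered pairs of elements of Ω are sorted by their sum v.
    K² : ∀ θ → K θ * K θ ≡ transform R θ
    K² θ = begin
      K θ * K θ
        ≡⟨ ∑-product (λ a → ind a * ⟨ θ , a ⟩) (λ b → ind b * ⟨ θ , b ⟩) ⟩
      ∑ (λ a → ∑ (λ b → ind a * ⟨ θ , a ⟩ * (ind b * ⟨ θ , b ⟩)))
        ≡⟨ ∑-cong (λ a → sym (∑-reindex (⊕-injective a) (λ b → ind a * ⟨ θ , a ⟩ * (ind b * ⟨ θ , b ⟩)))) ⟩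
      ∑ (λ a → ∑ (λ v → ind a * ⟨ θ , a ⟩ * (ind (a ⊕ v) * ⟨ θ , a ⊕ v ⟩)))
        ≡⟨ ∑-cong (λ a → ∑-cong (λ v → collect a v)) ⟩
      ∑ (λ a → ∑ (λ v → ⟨ θ , v ⟩ * (ind a * ind (a ⊕ v))))
        ≡⟨ ∑-swap (λ a v → ⟨ θ , v ⟩ * (ind a * ind (a ⊕ v))) ⟩
      ∑ (λ v → ∑ (λ a → ⟨ θ , v ⟩ * (ind a * ind (a ⊕ v))))
        ≡⟨ ∑-cong (λ v → trans (∑-* ⟨ θ , v ⟩ (λ a → ind a * ind (a ⊕ v))) (ℤ.*-comm ⟨ θ , v ⟩ (R v))) ⟩
      transform R θ ∎
      where
      open ≡-Reasoning
      regroup : ∀ i p j q → i * p * (j * (p * q)) ≡ (p * p) * (q * (i * j))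
      regroup = solve-∀
      collect : ∀ a v → ind a * ⟨ θ , a ⟩ * (ind (a ⊕ v) * ⟨ θ , a ⊕ v ⟩) ≡ ⟨ θ , v ⟩ * (ind a * ind (a ⊕ v))
      collect a v = trans (cong (λ z → ind a * ⟨ θ , a ⟩ * (ind (a ⊕ v) * z)) (pairing-⊕ θ a v))
        (trans (regroup (ind a) ⟨ θ , a ⟩ (ind (a ⊕ v)) ⟨ θ , v ⟩)
          (trans (cong (_* (⟨ θ , v ⟩ * (ind a * ind (a ⊕ v)))) (pairing-² θ a)) (ℤ.*-identityˡ _)))

    R-≥0 : ∀ v → 0ℤ ≤ R v
    R-≥0 v = ∑-≥0 (λ a → 0≤* (1[]-≥0 (Ω? a)) (1[]-≥0 (Ω? (a ⊕ v))))

    ∑R : ∑ R ≡ W * W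
    ∑R = begin
      ∑ (λ v → ∑ (λ a → ind a * ind (a ⊕ v)))   ≡⟨ ∑-swap (λ v a → ind a * ind (a ⊕ v)) ⟩
      ∑ (λ a → ∑ (λ v → ind a * ind (a ⊕ v)))
        ≡⟨ ∑-cong (λ a → ∑-reindex (⊕-injective a) (λ v → ind a * ind v)) ⟩
      ∑ (λ a → ∑ (λ v → ind a * ind v))         ≡⟨ ∑-product ind ind ⟨
      W * W                                     ∎
      where open ≡-Reasoning

    R-𝟘 : R 𝟘 ≡ W
    R-𝟘 = ∑-cong (λ a → trans (cong (λ b → ind a * ind b) (⊕-𝟘 a)) (idempotent (Ω? a)))
      where
      idempotent : ∀ {P : Set} (d : Dec P) → 1[ d ] * 1[ d ] ≡ 1[ d ]
      idempotent (yes _) = refl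
      idempotent (no _)  = refl

    R-≤2 : ∀ {v} → v ≢ 𝟘 → R v ≤ + 2
    R-≤2 {v} v≢𝟘 with search (λ a → Ω? a ×-dec Ω? (a ⊕ v))
    ... | no none = subst (_≤ + 2) (sym (∑-ε (λ a → vanish (Ω? a) (Ω? (a ⊕ v)) (λ p q → none (a , p , q))))) (+≤+ z≤n)
      where
      vanish : ∀ {P Q : Set} (d : Dec P) (e : Dec Q) → (P → ¬ Q) → 1[ d ] * 1[ e ] ≡ 0ℤ
      vanish (yes p) (yes q) h = contradiction q (h p)
      vanish (yes p) (no _)  h = refl
      vanish (no _)  _       h = refl
    ... | yes (a , p , q) = subst (R v ≤_)
        (trans (∑-∙ (λ b → 1[ b ≟ a ]) (λ b → 1[ b ≟ (a ⊕ v) ]))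
          (cong₂ _+_ (∑-indicator a) (∑-indicator (a ⊕ v)))) (∑-mono bound)
      where
      bound : ∀ b → ind b * ind (b ⊕ v) ≤ 1[ b ≟ a ] + 1[ b ≟ (a ⊕ v) ]
      bound b with Ω? b | Ω? (b ⊕ v)
      ... | no _   | _      = ℤ.+-mono-≤ (1[]-≥0 (b ≟ a)) (1[]-≥0 (b ≟ (a ⊕ v)))
      ... | yes _  | no _   = ℤ.+-mono-≤ (1[]-≥0 (b ≟ a)) (1[]-≥0 (b ≟ (a ⊕ v)))
      ... | yes p′ | yes q′ with sum-of-two v≢𝟘 p q p′ q′
      ...   | inj₁ e = ℤ.+-mono-≤ (ℤ.≤-reflexive (sym (1[]-yes (b ≟ a) e))) (1[]-≥0 (b ≟ (a ⊕ v)))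
      ...   | inj₂ e = ℤ.+-mono-≤ (1[]-≥0 (b ≟ a)) (ℤ.≤-reflexive (sym (1[]-yes (b ≟ (a ⊕ v)) e)))

    -- The value at 0 contributes W². Elsewhere R ≤ 2, so R² ≤ 2 R, and the sum of all R is W².
    ∑R²≤3W² : ∑ (λ v → R v * R v) ≤ + 3 * (W * W)
    ∑R²≤3W² = begin
      ∑ (λ v → R v * R v)
        ≤⟨ ∑-mono bound ⟩
      ∑ (λ v → W * W * 1[ v ≟ 𝟘 ] + + 2 * R v)
        ≡⟨ ∑-∙ (λ v → W * W * 1[ v ≟ 𝟘 ]) (λ v → + 2 * R v) ⟩
      ∑ (λ v → W * W * 1[ v ≟ 𝟘 ]) + ∑ (λ v → + 2 * R v)
        ≡⟨ cong₂ _+_ (trans (∑-* (W * W) (λ v → 1[ v ≟ 𝟘 ])) (cong (W * W *_) (∑-indicator 𝟘)))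
             (trans (∑-* (+ 2) R) (cong (+ 2 *_) ∑R)) ⟩
      W * W * 1ℤ + + 2 * (W * W)
        ≡⟨ three (W * W) ⟩
      + 3 * (W * W) ∎
      where
      open ℤ.≤-Reasoning
      three : ∀ x → x * 1ℤ + + 2 * x ≡ + 3 * x
      three = solve-∀
      bound : ∀ v → R v * R v ≤ W * W * 1[ v ≟ 𝟘 ] + + 2 * R v
      bound v with v ≟ 𝟘
      ... | yes refl = subst₂ _≤_ (trans (ℤ.+-identityʳ _) (trans (ℤ.*-identityʳ _) (sym (cong₂ _*_ R-𝟘 R-𝟘)))) refl
                         (ℤ.+-monoʳ-≤ (W * W * 1ℤ) (0≤* {+ 2} (+≤+ z≤n) (R-≥0 𝟘)))
      ... | no v≢𝟘 =
        subst₂ _≤_ refl (trans (ℤ.*-comm (R v) (+ 2)) (sym (trans (cong (_+ + 2 * R v) (ℤ.*-zeroʳ (W * W))) (ℤ.+-identityˡ _))))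
                         (*-monoˡ (R-≥0 v) (R-≤2 v≢𝟘))

    -- Moving ρ across the pairing replaces v by ρ ⊙ v, and this only permutes Ω.
    K-rotate : ∀ {ρ} → Ω ρ → ∀ θ → K (ρ ⊙ θ) ≡ K θ
    K-rotate {ρ} p θ = trans (∑-cong move) (∑-reindex (Ω-injective p) (λ v → ind v * ⟨ θ , v ⟩))
      where
      same : ∀ v → ind v ≡ ind (ρ ⊙ v)
      same v with Ω? v
      ... | yes q = sym (1[]-yes (Ω? (ρ ⊙ v)) (Ω-closed p q))
      ... | no ¬q = sym (1[]-no (Ω? (ρ ⊙ v)) (λ q → ¬q (Ω-closed⁻ p q)))
      move : ∀ v → ind v * ⟨ ρ ⊙ θ , v ⟩ ≡ ind (ρ ⊙ v) * ⟨ θ , ρ ⊙ v ⟩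
      move v = cong₂ _*_ (same v) (adjoint ρ θ v)

    -- The orbit of θ under Ω has W distinct points, all with the same K. Hence W copies of K⁴ fit
    -- into the full sum of K⁴, which is Parseval applied to R because K² is the transform of R.
    fourth-moment : ∀ {θ} → θ ≢ 𝟘 → W * (K θ * K θ * (K θ * K θ)) ≤ + M * (+ 3 * (W * W))
    fourth-moment {θ} θ≢𝟘 = begin
      W * K⁴ θ                                    ≡⟨ ℤ.*-comm W (K⁴ θ) ⟩
      K⁴ θ * W                                    ≡⟨ ∑-* (K⁴ θ) ind ⟨
      ∑ (λ ρ → K⁴ θ * ind ρ)                      ≤⟨ ∑-mono bound ⟩
      ∑ (λ ρ → K⁴ (ρ ⊙ θ))                        ≡⟨ ∑-reindex (free θ≢𝟘) K⁴ ⟩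
      ∑ K⁴                                        ≡⟨ ∑-cong (λ θ → cong₂ _*_ (K² θ) (K² θ)) ⟩
      ∑ (λ θ → transform R θ * transform R θ)     ≡⟨ parseval R ⟩
      + M * ∑ (λ v → R v * R v)                   ≤⟨ ℤ.*-monoˡ-≤-nonNeg (+ M) ∑R²≤3W² ⟩
      + M * (+ 3 * (W * W))                       ∎
      where
      open ℤ.≤-Reasoning
      K⁴ : V → ℤ
      K⁴ θ = K θ * K θ * (K θ * K θ)
      bound : ∀ ρ → K⁴ θ * ind ρ ≤ K⁴ (ρ ⊙ θ)
      bound ρ with Ω? ρ
      ... | yes p = ℤ.≤-reflexive (trans (ℤ.*-identityʳ (K⁴ θ)) (cong (λ k → k * k * (k * k)) (sym (K-rotate p θ))))
      ... | no _  = subst (_≤ K⁴ (ρ ⊙ θ)) (sym (ℤ.*-zeroʳ (K⁴ θ))) (0≤i*i (K (ρ ⊙ θ) * K (ρ ⊙ θ)))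

-- Arithmetic in a field of characteristic 2

module Field {n : ℕ} (F : GF2^ n) where

  open GF2^ F renaming (Carrier to C)

  commutativeRing : CommutativeRing 0ℓ 0ℓ
  commutativeRing = record { isCommutativeRing = isCommutativeRing }

  open CommutativeRing commutativeRing public
    using (+-assoc; +-comm; +-identityˡ; +-identityʳ; *-assoc; *-comm; *-identityˡ; *-identityʳ;
           distribˡ; distribʳ; zeroˡ; zeroʳ; -‿inverseˡ; -‿inverseʳ)

  open Finite card public
  module Σ+ = Sum (CommutativeRing.+-commutativeMonoid commutativeRing) card
  module Σ* = Sum (CommutativeRing.*-commutativeMonoid commutativeRing) card
  open Algebra.Properties.Monoid.Mult (CommutativeRing.+-monoid commutativeRing)
    renaming (_×_ to _·_) using (×-homo-+)

  ⁻¹-inverseˡ : ∀ {x} → x ≢ 0# → x ⁻¹ * x ≡ 1#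
  ⁻¹-inverseˡ {x} x≢0 = trans (*-comm _ _) (⁻¹-inverse x x≢0)

  ⁻¹-*-cancel : ∀ {x} y → x ≢ 0# → x ⁻¹ * (x * y) ≡ y
  ⁻¹-*-cancel y x≢0 = trans (sym (*-assoc _ _ y)) (trans (cong (_* y) (⁻¹-inverseˡ x≢0)) (*-identityˡ y))

  *-cancelˡ : ∀ {x y z} → x ≢ 0# → x * y ≡ x * z → y ≡ z
  *-cancelˡ {x} {y} {z} x≢0 eq =
    trans (sym (⁻¹-*-cancel y x≢0)) (trans (cong (x ⁻¹ *_) eq) (⁻¹-*-cancel z x≢0))

  +-cancelˡ : ∀ x {y z} → x + y ≡ x + z → y ≡ z
  +-cancelˡ x {y} {z} eq = trans (sym (undo y)) (trans (cong (- x +_) eq) (undo z))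
    where
    undo : ∀ y → - x + (x + y) ≡ y
    undo y = trans (sym (+-assoc _ _ y)) (trans (cong (_+ y) (-‿inverseˡ x)) (+-identityˡ y))

  zero-product : ∀ {x y} → x * y ≡ 0# → x ≡ 0# ⊎ y ≡ 0#
  zero-product {x} {y} eq with x ≟ 0#
  ... | yes x≡0 = inj₁ x≡0
  ... | no  x≢0 = inj₂ (*-cancelˡ x≢0 (trans eq (sym (zeroʳ x))))

  *-≢0 : ∀ {x y} → x ≢ 0# → y ≢ 0# → x * y ≢ 0#
  *-≢0 x≢0 y≢0 eq with zero-product eq
  ... | inj₁ x≡0 = x≢0 x≡0
  ... | inj₂ y≡0 = y≢0 y≡0

  ⁻¹-≢0 : ∀ {x} → x ≢ 0# → x ⁻¹ ≢ 0#
  ⁻¹-≢0 {x} x≢0 eq = 0≢1 (trans (sym (zeroʳ x)) (trans (cong (x *_) (sym eq)) (⁻¹-inverse x x≢0)))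

  ⁻¹-unique : ∀ {x y} → x * y ≡ 1# → x ⁻¹ ≡ y
  ⁻¹-unique {x} {y} eq = *-cancelˡ x≢0 (trans (⁻¹-inverse x x≢0) (sym eq))
    where
    x≢0 : x ≢ 0#
    x≢0 x≡0 = 0≢1 (trans (sym (zeroˡ y)) (trans (cong (_* y) (sym x≡0)) eq))

  double-power : ∀ k x → (2 ℕ.^ suc k) · x ≡ (1# + 1#) * ((2 ℕ.^ k) · x)
  double-power k x = trans (×-homo-+ x (2 ℕ.^ k) _) (trans
    (cong ((2 ℕ.^ k) · x +_) (trans (×-homo-+ x (2 ℕ.^ k) 0) (+-identityʳ _)))
    (sym (trans (distribʳ _ _ _) (cong₂ _+_ (*-identityˡ _) (*-identityˡ _)))))

  ∑-replicate : ∀ x → Σ+.∑ (λ _ → x) ≡ (2 ℕ.^ n) · x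
  ∑-replicate x = sum-replicate (2 ℕ.^ n)
    where open import Algebra.Properties.CommutativeMonoid.Sum (CommutativeRing.+-commutativeMonoid commutativeRing)

  -- Translating the sum of all elements by 1 shows 2ⁿ · 1 = 0.
  1+1≡0 : 1# + 1# ≡ 0#
  1+1≡0 = descend n (sym (+-cancelˡ (Σ+.∑ (λ x → x)) (begin
    Σ+.∑ (λ x → x) + 0#                 ≡⟨ +-identityʳ _ ⟩
    Σ+.∑ (λ x → x)                      ≡⟨ Σ+.∑-reindex {_+ 1#} shift-injective (λ x → x) ⟨
    Σ+.∑ (λ x → x + 1#)                 ≡⟨ Σ+.∑-∙ (λ x → x) (λ _ → 1#) ⟩
    Σ+.∑ (λ x → x) + Σ+.∑ (λ _ → 1#)    ≡⟨ cong (Σ+.∑ (λ x → x) +_) (∑-replicate 1#) ⟩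
    Σ+.∑ (λ x → x) + (2 ℕ.^ n) · 1#     ∎)))
    where
    open ≡-Reasoning
    shift-injective : Inj (_+ 1#)
    shift-injective eq = +-cancelˡ 1# (trans (+-comm _ _) (trans eq (+-comm _ _)))
    descend : ∀ k → (2 ℕ.^ k) · 1# ≡ 0# → 1# + 1# ≡ 0#
    descend zero    eq = contradiction (sym (trans (sym (+-identityʳ 1#)) eq)) 0≢1
    descend (suc k) eq with zero-product (trans (sym (double-power k 1#)) eq)
    ... | inj₁ z = z
    ... | inj₂ z = descend k z

  x+x≡0 : ∀ x → x + x ≡ 0#
  x+x≡0 x = begin
    x + x             ≡⟨ cong₂ _+_ (*-identityˡ x) (*-identityˡ x) ⟨
    1# * x + 1# * x   ≡⟨ distribʳ x 1# 1# ⟨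
    (1# + 1#) * x     ≡⟨ cong (_* x) 1+1≡0 ⟩
    0# * x            ≡⟨ zeroˡ x ⟩
    0#                ∎
    where open ≡-Reasoning

  -x≡x : ∀ x → - x ≡ x
  -x≡x x = +-cancelˡ x (trans (-‿inverseʳ x) (sym (x+x≡0 x)))

  -- Coefficients for the ring solver: with exclusive or as addition, its normal forms are taken
  -- modulo 2.
  𝔽₂ : RawRing 0ℓ 0ℓ
  𝔽₂ = record { Carrier = Bool ; _≈_ = _≡_ ; _+_ = _xor_ ; _*_ = _∧_ ; -_ = λ b → b ; 0# = false ; 1# = true }

  ⟦_⟧₂ : Bool → C
  ⟦ false ⟧₂ = 0#
  ⟦ true ⟧₂  = 1#

  ⟦⟧₂-xor : ∀ a b → ⟦ a xor b ⟧₂ ≡ ⟦ a ⟧₂ + ⟦ b ⟧₂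
  ⟦⟧₂-xor false b     = sym (+-identityˡ _)
  ⟦⟧₂-xor true  false = sym (+-identityʳ _)
  ⟦⟧₂-xor true  true  = sym 1+1≡0

  𝔽₂⟶F : 𝔽₂ -Raw-AlmostCommutative⟶ fromCommutativeRing commutativeRing
  𝔽₂⟶F = record
    { ⟦_⟧    = ⟦_⟧₂
    ; +-homo = ⟦⟧₂-xor
    ; *-homo = *-homo
    ; -‿homo = λ b → sym (-x≡x ⟦ b ⟧₂)
    ; 0-homo = refl
    ; 1-homo = refl
    }
    where
    *-homo : ∀ a b → ⟦ a ∧ b ⟧₂ ≡ ⟦ a ⟧₂ * ⟦ b ⟧₂
    *-homo false b = sym (zeroˡ _)
    *-homo true  b = sym (*-identityˡ _)

  ≟₂ : (a b : Bool) → Maybe (⟦ a ⟧₂ ≡ ⟦ b ⟧₂)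
  ≟₂ false false = just refl
  ≟₂ true  true  = just refl
  ≟₂ _     _     = nothing

  module Solver = Algebra.Solver.Ring 𝔽₂ (fromCommutativeRing commutativeRing) 𝔽₂⟶F ≟₂
  open Solver using (solve; _:=_; _:+_; _:*_; con) public

  +-≡0 : ∀ {x y} → x + y ≡ 0# → x ≡ y
  +-≡0 {x} {y} eq = +-cancelˡ y (trans (+-comm y x) (trans eq (sym (x+x≡0 y))))

  ≡-+0 : ∀ {x y} → x ≡ y → x + y ≡ 0#
  ≡-+0 refl = x+x≡0 _

  +-≢0 : ∀ {x y} → x ≢ y → x + y ≢ 0#
  +-≢0 x≢y eq = x≢y (+-≡0 eq)

  ⁻¹-distrib-* : ∀ x y → (x * y) ⁻¹ ≡ x ⁻¹ * y ⁻¹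
  ⁻¹-distrib-* x y with x ≟ 0# | y ≟ 0#
  ... | yes refl | _ = trans (cong _⁻¹ (zeroˡ y)) (trans ⁻¹-zero (sym (trans (cong (_* y ⁻¹) ⁻¹-zero) (zeroˡ _))))
  ... | no _ | yes refl = trans (cong _⁻¹ (zeroʳ x)) (trans ⁻¹-zero (sym (trans (cong (x ⁻¹ *_) ⁻¹-zero) (zeroʳ _))))
  ... | no x≢0 | no y≢0 = ⁻¹-unique (trans
    (solve 4 (λ x y a b → (x :* y) :* (a :* b) := (x :* a) :* (y :* b)) refl x y (x ⁻¹) (y ⁻¹))
    (trans (cong₂ _*_ (⁻¹-inverse x x≢0) (⁻¹-inverse y y≢0)) (*-identityˡ 1#)))

  infix 9 _²
  _² : C → C
  x ² = x * x

  ²-+ : ∀ x y → (x + y) ² ≡ x ² + y ²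
  ²-+ = solve 2 (λ x y → (x :+ y) :* (x :+ y) := x :* x :+ y :* y) refl

  ²-* : ∀ x y → (x * y) ² ≡ x ² * y ²
  ²-* = solve 2 (λ x y → (x :* y) :* (x :* y) := (x :* x) :* (y :* y)) refl

  ²-≡0 : ∀ {x} → x ² ≡ 0# → x ≡ 0#
  ²-≡0 eq with zero-product eq
  ... | inj₁ z = z
  ... | inj₂ z = z

  ²-injective : Inj _²
  ²-injective {x} {y} eq = +-≡0 (²-≡0 (trans (²-+ x y) (≡-+0 eq)))

  frob : ℕ → C → C
  frob zero    x = x
  frob (suc k) x = frob k x ²

  frob-+ : ∀ k x y → frob k (x + y) ≡ frob k x + frob k y
  frob-+ zero    x y = refl
  frob-+ (suc k) x y = trans (cong _² (frob-+ k x y)) (²-+ _ _)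

  frob-* : ∀ k x y → frob k (x * y) ≡ frob k x * frob k y
  frob-* zero    x y = refl
  frob-* (suc k) x y = trans (cong _² (frob-* k x y)) (²-* _ _)

  frob-0 : ∀ k → frob k 0# ≡ 0#
  frob-0 zero    = refl
  frob-0 (suc k) = trans (cong _² (frob-0 k)) (zeroˡ 0#)

  frob-≢0 : ∀ k {x} → x ≢ 0# → frob k x ≢ 0#
  frob-≢0 zero    x≢0 = x≢0
  frob-≢0 (suc k) x≢0 = *-≢0 (frob-≢0 k x≢0) (frob-≢0 k x≢0)

  frob-∘ : ∀ j k x → frob (j ℕ.+ k) x ≡ frob j (frob k x)
  frob-∘ zero    k x = refl
  frob-∘ (suc j) k x = cong _² (frob-∘ j k x)

  frob-⁻¹ : ∀ k x → frob k (x ⁻¹) ≡ frob k x ⁻¹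
  frob-⁻¹ zero    x = refl
  frob-⁻¹ (suc k) x = trans (cong _² (frob-⁻¹ k x)) (sym (⁻¹-distrib-* _ _))

  module _ (a : C) where
    private
      module Mult = Algebra.Properties.Monoid.Mult (CommutativeRing.*-monoid commutativeRing)

      power : ∀ k → (2 ℕ.^ k) Mult.× a ≡ frob k a
      power zero    = *-identityʳ a
      power (suc k) = trans (Mult.×-homo-+ a (2 ℕ.^ k) _)
        (cong₂ _*_ (power k) (trans (Mult.×-homo-+ a (2 ℕ.^ k) 0) (trans (*-identityʳ _) (power k))))

      -- Lets products over the units be written as products over the whole field, with the factor
      -- at 0 replaced.
      ifZero : C → C → C → C
      ifZero x y z with x ≟ 0#
      ... | yes _ = y
      ... | no  _ = z

      ifZero-≢0 : ∀ {x} y z → x ≢ 0# → ifZero x y z ≡ z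
      ifZero-≢0 {x} y z x≢0 with x ≟ 0#
      ... | yes x≡0 = contradiction x≡0 x≢0
      ... | no  _   = refl

      ifZero-0 : ∀ y z → ifZero 0# y z ≡ y
      ifZero-0 y z with 0# ≟ 0#
      ... | yes _ = refl
      ... | no ¬p = contradiction refl ¬p

      units : C
      units = Σ*.∑ (λ x → ifZero x 1# x)

      units≢0 : units ≢ 0#
      units≢0 = nonzero (λ i → element i)
        where
        open import Algebra.Properties.CommutativeMonoid.Sum (CommutativeRing.*-commutativeMonoid commutativeRing)
        term≢0 : ∀ x → ifZero x 1# x ≢ 0#
        term≢0 x with x ≟ 0#
        ... | yes _ = λ eq → 0≢1 (sym eq)
        ... | no x≢0 = x≢0
        nonzero : ∀ {m} (el : Fin m → C) → sum (λ i → ifZero (el i) 1# (el i)) ≢ 0#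
        nonzero {zero}  el = λ eq → 0≢1 (sym eq)
        nonzero {suc m} el = *-≢0 (term≢0 (el zero)) (nonzero (el ∘ suc))

    -- Multiplication by a permutes the units, so the product of a over all units is 1.
    fermat : frob n a ≡ a
    fermat with a ≟ 0#
    ... | yes refl = frob-0 n
    ... | no a≢0 = begin
      frob n a                                              ≡⟨ power n ⟨
      (2 ℕ.^ n) Mult.× a                                    ≡⟨ sum-replicate (2 ℕ.^ n) ⟨
      Σ*.∑ (λ _ → a)                                        ≡⟨ Σ*.∑-cong split ⟩
      Σ*.∑ (λ x → ifZero x 1# a * ifZero x a 1#)
        ≡⟨ Σ*.∑-∙ (λ x → ifZero x 1# a) (λ x → ifZero x a 1#) ⟩
      Σ*.∑ (λ x → ifZero x 1# a) * Σ*.∑ (λ x → ifZero x a 1#)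
        ≡⟨ cong₂ _*_ over-units (Σ*.∑-single 0# _ (λ x x≢0 → ifZero-≢0 a 1# x≢0)) ⟩
      1# * ifZero 0# a 1#                                   ≡⟨ *-identityˡ _ ⟩
      ifZero 0# a 1#                                        ≡⟨ ifZero-0 a 1# ⟩
      a                                                     ∎
      where
      open ≡-Reasoning
      open import Algebra.Properties.CommutativeMonoid.Sum (CommutativeRing.*-commutativeMonoid commutativeRing)
        using (sum-replicate)
      -- Separates the factor at x = 0, so that the product of all 2ⁿ copies of `a` is the product
      -- over the units times one more `a`.
      split : ∀ x → a ≡ ifZero x 1# a * ifZero x a 1#
      split x with x ≟ 0#
      ... | yes _ = sym (*-identityˡ a)
      ... | no  _ = sym (*-identityʳ a)
      shift : ∀ x → ifZero (a * x) 1# (a * x) ≡ ifZero x 1# a * ifZero x 1# x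
      shift x with x ≟ 0#
      ... | yes refl = trans (cong (λ y → ifZero y 1# y) (zeroʳ a)) (trans (ifZero-0 1# 0#) (sym (*-identityˡ 1#)))
      ... | no x≢0 = ifZero-≢0 1# (a * x) (*-≢0 a≢0 x≢0)
      over-units : Σ*.∑ (λ x → ifZero x 1# a) ≡ 1#
      over-units = *-cancelˡ units≢0 (begin
        units * Σ*.∑ (λ x → ifZero x 1# a)              ≡⟨ *-comm _ _ ⟩
        Σ*.∑ (λ x → ifZero x 1# a) * units
          ≡⟨ Σ*.∑-∙ (λ x → ifZero x 1# a) (λ x → ifZero x 1# x) ⟨
        Σ*.∑ (λ x → ifZero x 1# a * ifZero x 1# x)      ≡⟨ Σ*.∑-cong shift ⟨
        Σ*.∑ (λ x → ifZero (a * x) 1# (a * x))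
          ≡⟨ Σ*.∑-reindex {a *_} (*-cancelˡ a≢0) (λ x → ifZero x 1# x) ⟩
        units                                           ≡⟨ *-identityʳ units ⟨
        units * 1#                                      ∎)

  -- Subspace polynomials and sums of inverses

  -- The subspace polynomial ∏ (x + u) over u in the span of vs, its coefficient P of x,
  -- and S = Σ u⁻¹ over the span.
  L : ∀ {k} → Vec C k → C → C
  L []       x = x
  L (v ∷ vs) x = L vs x * (L vs x + L vs v)

  P : ∀ {k} → Vec C k → C
  P []       = 1#
  P (v ∷ vs) = P vs * L vs v

  S : ∀ {k} → Vec C k → C
  S []       = 0#
  S (v ∷ vs) = S vs + P vs * L vs v ⁻¹

  -- Linear independence, phrased as: each vector lies outside the span of the later ones, the span
  -- being the zero set of `L`.
  Good : ∀ {k} → Vec C k → Set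
  Good []       = ⊤
  Good (v ∷ vs) = L vs v ≢ 0# × Good vs

  L-+ : ∀ {k} (vs : Vec C k) x y → L vs (x + y) ≡ L vs x + L vs y
  L-+ []       x y = refl
  L-+ (v ∷ vs) x y = trans (cong (λ z → z * (z + L vs v)) (L-+ vs x y))
    (solve 3 (λ x y c → (x :+ y) :* ((x :+ y) :+ c) := x :* (x :+ c) :+ y :* (y :+ c)) refl
      (L vs x) (L vs y) (L vs v))

  L-0 : ∀ {k} (vs : Vec C k) → L vs 0# ≡ 0#
  L-0 []       = refl
  L-0 (v ∷ vs) = trans (cong (_* (L vs 0# + L vs v)) (L-0 vs)) (zeroˡ _)

  L-head : ∀ {k} v (vs : Vec C k) → L (v ∷ vs) v ≡ 0#
  L-head v vs = trans (cong (L vs v *_) (x+x≡0 _)) (zeroʳ _)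

  L-tail : ∀ {k} v (vs : Vec C k) {x} → L vs x ≡ 0# → L (v ∷ vs) x ≡ 0#
  L-tail v vs {x} eq = trans (cong (_* (L vs x + L vs v)) eq) (zeroˡ _)

  L-split : ∀ {k} v (vs : Vec C k) {x} → L (v ∷ vs) x ≡ 0# → L vs x ≡ 0# ⊎ L vs (x + v) ≡ 0#
  L-split v vs {x} eq with zero-product eq
  ... | inj₁ z = inj₁ z
  ... | inj₂ z = inj₂ (trans (L-+ vs x v) z)

  P-≢0 : ∀ {k} {vs : Vec C k} → Good vs → P vs ≢ 0#
  P-≢0 {vs = []}     _        = λ eq → 0≢1 (sym eq)
  P-≢0 {vs = v ∷ vs} (v∉ , g) = *-≢0 (P-≢0 g) v∉

  lc : ∀ {k} → Vec Bool k → Vec C k → C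
  lc = lincomb F

  L-lincomb : ∀ {k} (c : Vec Bool k) (vs : Vec C k) → L vs (lc c vs) ≡ 0#
  L-lincomb []          []       = refl
  L-lincomb (true ∷ c)  (v ∷ vs) = trans (L-+ (v ∷ vs) v _)
    (trans (cong₂ _+_ (L-head v vs) (L-tail v vs (L-lincomb c vs))) (+-identityˡ 0#))
  L-lincomb (false ∷ c) (v ∷ vs) = L-tail v vs (L-lincomb c vs)

  coordinates : ∀ {k} (vs : Vec C k) {x} → L vs x ≡ 0# → ∃ λ c → x ≡ lc c vs
  coordinates []       eq = [] , eq
  coordinates (v ∷ vs) {x} eq with L-split v vs eq
  ... | inj₁ z = let c , e = coordinates vs z in false ∷ c , e
  ... | inj₂ z = let c , e = coordinates vs z in true ∷ c ,
    trans (solve 2 (λ x v → x := v :+ (x :+ v)) refl x v) (cong (v +_) e)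

  good⇒indep : ∀ {k} {vs : Vec C k} → Good vs → LinIndep F vs
  good⇒indep {vs = []}     _        []          eq = refl
  good⇒indep {vs = v ∷ vs} (v∉ , g) (true ∷ c)  eq =
    contradiction (trans (cong (L vs) (+-≡0 eq)) (L-lincomb c vs)) v∉
  good⇒indep {vs = v ∷ vs} (v∉ , g) (false ∷ c) eq = cong (false ∷_) (good⇒indep g c eq)

  indep⇒good : ∀ {k} {vs : Vec C k} → LinIndep F vs → Good vs
  indep⇒good {vs = []}     _  = tt
  indep⇒good {vs = v ∷ vs} li = v∉ , indep⇒good (λ c eq → Vec.∷-injectiveʳ (li (false ∷ c) eq))
    where
    v∉ : L vs v ≢ 0#
    v∉ eq with coordinates vs eq
    ... | c , e = contradiction (Vec.∷-injectiveˡ (li (true ∷ c) (≡-+0 e))) λ()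

  lc-injective : ∀ {k} {vs : Vec C k} → Good vs → ∀ {c d} → lc c vs ≡ lc d vs → c ≡ d
  lc-injective g {[]} {[]} eq = refl
  lc-injective {vs = v ∷ vs} (_ , g) {true ∷ c}  {true ∷ d}  eq = cong (true ∷_) (lc-injective g (+-cancelˡ v eq))
  lc-injective {vs = v ∷ vs} (v∉ , g) {true ∷ c}  {false ∷ d} eq = contradiction
    (trans (cong (L vs) (trans (solve 2 (λ x y → y := x :+ (y :+ x)) refl (lc c vs) v) (cong (lc c vs +_) eq)))
      (trans (L-+ vs (lc c vs) (lc d vs)) (trans (cong₂ _+_ (L-lincomb c vs) (L-lincomb d vs)) (+-identityˡ 0#)))) v∉
  lc-injective {vs = v ∷ vs} (v∉ , g) {false ∷ c} {true ∷ d}  eq = contradiction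
    (trans (cong (L vs) (trans (solve 2 (λ x y → y := x :+ (y :+ x)) refl (lc d vs) v) (cong (lc d vs +_) (sym eq))))
      (trans (L-+ vs (lc d vs) (lc c vs)) (trans (cong₂ _+_ (L-lincomb d vs) (L-lincomb c vs)) (+-identityˡ 0#)))) v∉
  lc-injective {vs = v ∷ vs} (_ , g) {false ∷ c} {false ∷ d} eq = cong (false ∷_) (lc-injective g eq)

  sumBool-cong : ∀ k {f g : Vec Bool k → C} → (∀ c → f c ≡ g c) → sumBool F k f ≡ sumBool F k g
  sumBool-cong zero    eq = eq []
  sumBool-cong (suc k) eq = cong₂ _+_ (sumBool-cong k (eq ∘ (false ∷_))) (sumBool-cong k (eq ∘ (true ∷_)))

  affineSum-∷ : ∀ {k} f a v (vs : Vec C k) →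
    affineSum F f a (v ∷ vs) ≡ affineSum F f a vs + affineSum F f (a + v) vs
  affineSum-∷ {k} f a v vs = cong (affineSum F f a vs +_)
    (sumBool-cong k (λ c → cong f (sym (+-assoc a v (lc c vs)))))

  -- A vector of the span permutes the summands. If it involves `v`, the two halves of the sum trade
  -- places.
  affineSum-translate : ∀ {k} f (vs : Vec C k) {a} b → L vs a ≡ 0# →
    affineSum F f (a + b) vs ≡ affineSum F f b vs
  affineSum-translate f []       b refl = cong (λ x → f (x + 0#)) (+-identityˡ b)
  affineSum-translate f (v ∷ vs) {a} b eq with L-split v vs eq
  ... | inj₁ z = begin
    affineSum F f (a + b) (v ∷ vs)                                  ≡⟨ affineSum-∷ f (a + b) v vs ⟩
    affineSum F f (a + b) vs + affineSum F f (a + b + v) vs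
      ≡⟨ cong₂ _+_ (affineSum-translate f vs b z)
          (trans (cong (λ x → affineSum F f x vs) (+-assoc a b v)) (affineSum-translate f vs (b + v) z)) ⟩
    affineSum F f b vs + affineSum F f (b + v) vs                   ≡⟨ affineSum-∷ f b v vs ⟨
    affineSum F f b (v ∷ vs)                                        ∎
    where open ≡-Reasoning
  ... | inj₂ z = begin
    affineSum F f (a + b) (v ∷ vs)                                  ≡⟨ affineSum-∷ f (a + b) v vs ⟩
    affineSum F f (a + b) vs + affineSum F f (a + b + v) vs
      ≡⟨ cong₂ (λ x y → affineSum F f x vs + affineSum F f y vs)
          (solve 3 (λ a b v → a :+ b := (a :+ v) :+ (b :+ v)) refl a b v)
          (solve 3 (λ a b v → (a :+ b) :+ v := (a :+ v) :+ b) refl a b v) ⟩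
    affineSum F f (a + v + (b + v)) vs + affineSum F f (a + v + b) vs
      ≡⟨ cong₂ _+_ (affineSum-translate f vs (b + v) z) (affineSum-translate f vs b z) ⟩
    affineSum F f (b + v) vs + affineSum F f b vs                   ≡⟨ +-comm _ _ ⟩
    affineSum F f b vs + affineSum F f (b + v) vs                   ≡⟨ affineSum-∷ f b v vs ⟨
    affineSum F f b (v ∷ vs)                                        ∎
    where open ≡-Reasoning

  ⁻¹-+ : ∀ {x y} → x ≢ 0# → y ≢ 0# → x ⁻¹ + y ⁻¹ ≡ (x + y) * (x * y) ⁻¹
  ⁻¹-+ {x} {y} x≢0 y≢0 = begin
    x ⁻¹ + y ⁻¹                                       ≡⟨ cong₂ _+_ (*-identityˡ _) (*-identityˡ _) ⟨
    1# * x ⁻¹ + 1# * y ⁻¹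
      ≡⟨ cong₂ (λ p q → p * x ⁻¹ + q * y ⁻¹) (⁻¹-inverse y y≢0) (⁻¹-inverse x x≢0) ⟨
    (y * y ⁻¹) * x ⁻¹ + (x * x ⁻¹) * y ⁻¹
      ≡⟨ solve 4 (λ x y a b → (y :* b) :* a :+ (x :* a) :* b := (x :+ y) :* (a :* b)) refl x y (x ⁻¹) (y ⁻¹) ⟩
    (x + y) * (x ⁻¹ * y ⁻¹)                           ≡⟨ cong ((x + y) *_) (⁻¹-distrib-* x y) ⟨
    (x + y) * (x * y) ⁻¹                              ∎
    where open ≡-Reasoning

  -- The logarithmic derivative of L vs, whose derivative is the constant P vs.
  affineSum-outside : ∀ {k} (vs : Vec C k) a → L vs a ≢ 0# →
    affineSum F (finv F) a vs ≡ P vs * L vs a ⁻¹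
  affineSum-outside []       a _ = trans (cong _⁻¹ (+-identityʳ a)) (sym (*-identityˡ _))
  affineSum-outside (v ∷ vs) a a∉ = begin
    affineSum F (finv F) a (v ∷ vs)                                       ≡⟨ affineSum-∷ (finv F) a v vs ⟩
    affineSum F (finv F) a vs + affineSum F (finv F) (a + v) vs
      ≡⟨ cong₂ _+_ (affineSum-outside vs a a∉₁)
           (trans (affineSum-outside vs (a + v) (a∉₂ ∘ trans (sym (L-+ vs a v))))
             (cong (λ x → P vs * x ⁻¹) (L-+ vs a v))) ⟩
    P vs * x ⁻¹ + P vs * (x + c) ⁻¹                                       ≡⟨ distribˡ _ _ _ ⟨
    P vs * (x ⁻¹ + (x + c) ⁻¹)                                            ≡⟨ cong (P vs *_) (⁻¹-+ a∉₁ a∉₂) ⟩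
    P vs * ((x + (x + c)) * (x * (x + c)) ⁻¹)
      ≡⟨ solve 4 (λ p x c i → p :* ((x :+ (x :+ c)) :* i) := (p :* c) :* i) refl (P vs) x c _ ⟩
    P vs * c * (x * (x + c)) ⁻¹                                           ∎
    where
    open ≡-Reasoning
    x = L vs a
    c = L vs v
    a∉₁ : x ≢ 0#
    a∉₁ eq = a∉ (L-tail v vs eq)
    a∉₂ : x + c ≢ 0#
    a∉₂ eq = a∉ (trans (cong (x *_) eq) (zeroʳ x))

  affineSum-inside : ∀ {k} {vs : Vec C k} → Good vs → ∀ {a} → L vs a ≡ 0# →
    affineSum F (finv F) a vs ≡ S vs
  affineSum-inside {vs = vs} g {a} eq = trans (cong (λ x → affineSum F (finv F) x vs) (sym (+-identityʳ a)))
    (trans (affineSum-translate (finv F) vs 0# eq) (through-0 vs g))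
    where
    through-0 : ∀ {k} (vs : Vec C k) → Good vs → affineSum F (finv F) 0# vs ≡ S vs
    through-0 []       _        = trans (cong _⁻¹ (+-identityˡ 0#)) ⁻¹-zero
    through-0 (v ∷ vs) (v∉ , g) = trans (affineSum-∷ (finv F) 0# v vs)
      (cong₂ _+_ (through-0 vs g)
        (trans (cong (λ x → affineSum F (finv F) x vs) (+-identityˡ v)) (affineSum-outside vs v v∉)))

  -- Subspace polynomials compose: first pass to the quotient by `vs` through `L vs`, then take the
  -- polynomial of the image of `us`. The formula for `P` below is the chain rule.
  L-++ : ∀ {j k} (us : Vec C j) (vs : Vec C k) x → L (us ++ vs) x ≡ L (map (L vs) us) (L vs x)
  L-++ []       vs x = refl
  L-++ (u ∷ us) vs x = cong₂ (λ y c → y * (y + c)) (L-++ us vs x) (L-++ us vs u)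

  P-++ : ∀ {j k} (us : Vec C j) (vs : Vec C k) → P (us ++ vs) ≡ P vs * P (map (L vs) us)
  P-++ []       vs = sym (*-identityʳ _)
  P-++ (u ∷ us) vs = trans (cong₂ _*_ (P-++ us vs) (L-++ us vs u)) (*-assoc _ _ _)

  S-++ : ∀ {j k} (us : Vec C j) (vs : Vec C k) → S (us ++ vs) ≡ S vs + P vs * S (map (L vs) us)
  S-++ []       vs = sym (trans (cong (S vs +_) (zeroʳ _)) (+-identityʳ _))
  S-++ (u ∷ us) vs = trans
    (cong₂ _+_ (S-++ us vs) (cong₂ (λ p l → p * l ⁻¹) (P-++ us vs) (L-++ us vs u)))
    (solve 5 (λ s p t q i → (s :+ p :* t) :+ (p :* q) :* i := s :+ p :* (t :+ q :* i)) refl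
      (S vs) (P vs) (S (map (L vs) us)) (P (map (L vs) us)) _)

  Good-++ : ∀ {j k} (us : Vec C j) {vs : Vec C k} → Good vs → Good (map (L vs) us) → Good (us ++ vs)
  Good-++ []       g _         = g
  Good-++ (u ∷ us) {vs} g (u∉ , h) = (u∉ ∘ trans (sym (L-++ us vs u))) , Good-++ us g h

  Good-++⁻ : ∀ {j k} (us : Vec C j) {vs : Vec C k} → Good (us ++ vs) → Good vs × Good (map (L vs) us)
  Good-++⁻ []       g = g , tt
  Good-++⁻ (u ∷ us) {vs} (u∉ , g) = let g₁ , g₂ = Good-++⁻ us g in g₁ , (u∉ ∘ trans (L-++ us vs u)) , g₂

  module _ {y : C} (y≢0 : y ≢ 0#) where

    -- There are 2^k linear factors, each multiplied by y, and `frob k y` is y^(2^k).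
    L-scale : ∀ {k} (vs : Vec C k) x → L (map (y *_) vs) (y * x) ≡ frob k y * L vs x
    L-scale []       x = refl
    L-scale {suc k} (v ∷ vs) x = trans (cong₂ (λ a b → a * (a + b)) (L-scale vs x) (L-scale vs v))
      (solve 3 (λ s a b → (s :* a) :* (s :* a :+ s :* b) := (s :* s) :* (a :* (a :+ b))) refl
        (frob k y) (L vs x) (L vs v))

    -- `P vs` is a product of 2^k - 1 vectors; the extra y on the left turns the exponent into 2^k.
    P-scale : ∀ {k} (vs : Vec C k) → y * P (map (y *_) vs) ≡ frob k y * P vs
    P-scale []       = refl
    P-scale {suc k} (v ∷ vs) = trans (sym (*-assoc _ _ _)) (trans (cong₂ _*_ (P-scale vs) (L-scale vs v))
      (solve 3 (λ s p l → (s :* p) :* (s :* l) := (s :* s) :* (p :* l)) refl (frob k y) (P vs) (L vs v)))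

    S-scale : ∀ {k} (vs : Vec C k) → S (map (y *_) vs) ≡ y ⁻¹ * S vs
    S-scale []       = sym (zeroʳ _)
    S-scale {suc k} (v ∷ vs) = *-cancelˡ y≢0 (begin
      y * (S ys + P ys * L ys (y * v) ⁻¹)                ≡⟨ distribˡ _ _ _ ⟩
      y * S ys + y * (P ys * L ys (y * v) ⁻¹)
        ≡⟨ cong₂ _+_ (cong (y *_) (S-scale vs)) (sym (*-assoc _ _ _)) ⟩
      y * (y ⁻¹ * S vs) + y * P ys * L ys (y * v) ⁻¹
        ≡⟨ cong (y * (y ⁻¹ * S vs) +_) (cong₂ _*_ (P-scale vs) (trans (cong _⁻¹ (L-scale vs v)) (⁻¹-distrib-* _ _))) ⟩
      y * (y ⁻¹ * S vs) + s * P vs * (s ⁻¹ * l ⁻¹)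
        ≡⟨ solve 7 (λ y i t s p j m → y :* (i :* t) :+ (s :* p) :* (j :* m) :=
             (y :* i) :* t :+ (s :* j) :* (p :* m)) refl y (y ⁻¹) (S vs) s (P vs) (s ⁻¹) (l ⁻¹) ⟩
      y * y ⁻¹ * S vs + s * s ⁻¹ * (P vs * l ⁻¹)
        ≡⟨ cong (λ z → y * y ⁻¹ * S vs + z * (P vs * l ⁻¹))
             (trans (⁻¹-inverse s (frob-≢0 k y≢0)) (sym (⁻¹-inverse y y≢0))) ⟩
      y * y ⁻¹ * S vs + y * y ⁻¹ * (P vs * l ⁻¹)
        ≡⟨ solve 4 (λ y i t u → (y :* i) :* t :+ (y :* i) :* u := y :* (i :* (t :+ u))) refl y (y ⁻¹) (S vs) _ ⟩
      y * (y ⁻¹ * (S vs + P vs * l ⁻¹))                  ∎)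
      where
      open ≡-Reasoning
      ys = map (y *_) vs
      s  = frob k y
      l  = L vs v

    Good-scale : ∀ {k} {vs : Vec C k} → Good vs → Good (map (y *_) vs)
    Good-scale {vs = []}     _        = tt
    Good-scale {suc k} {v ∷ vs} (v∉ , g) =
      (*-≢0 (frob-≢0 k y≢0) v∉ ∘ trans (sym (L-scale vs v))) , Good-scale g

  L-² : ∀ {k} (vs : Vec C k) x → L (map _² vs) (x ²) ≡ L vs x ²
  L-² []       x = refl
  L-² (v ∷ vs) x = trans (cong₂ (λ a b → a * (a + b)) (L-² vs x) (L-² vs v))
    (solve 2 (λ a b → (a :* a) :* (a :* a :+ b :* b) := (a :* (a :+ b)) :* (a :* (a :+ b))) refl (L vs x) (L vs v))

  P-² : ∀ {k} (vs : Vec C k) → P (map _² vs) ≡ P vs ²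
  P-² []       = sym (*-identityˡ 1#)
  P-² (v ∷ vs) = trans (cong₂ _*_ (P-² vs) (L-² vs v)) (sym (²-* _ _))

  S-² : ∀ {k} (vs : Vec C k) → S (map _² vs) ≡ S vs ²
  S-² []       = sym (zeroˡ 0#)
  S-² (v ∷ vs) =
    trans (cong₂ _+_ (S-² vs) (cong₂ (λ p l → p * l) (P-² vs) (trans (cong _⁻¹ (L-² vs v)) (⁻¹-distrib-* _ _))))
    (trans (cong (S vs ² +_) (sym (²-* _ _))) (sym (²-+ _ _)))

  Good-² : ∀ {k} {vs : Vec C k} → Good vs → Good (map _² vs)
  Good-² {vs = []}     _        = tt
  Good-² {vs = v ∷ vs} (v∉ , g) = (v∉ ∘ ²-≡0 ∘ trans (sym (L-² vs v))) , Good-² g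

  Good⇒≤n : ∀ {k} {vs : Vec C k} → Good vs → k ℕ.≤ n
  Good⇒≤n {k} {vs} g = 2^-cancel-≤ (Fin.injective⇒≤ {f = λ i → index (lc (dec k i) vs)}
    (λ eq → dec-injective k (lc-injective g (index-injective eq))))

  abstract
    -- Otherwise x ↦ (f x, coordinates of x + rep (f x)) would embed the field in 2^(i + j) elements.
    collide : ∀ {i j} (f : C → Vec Bool j) (ws : Vec C i) → i ℕ.+ j ℕ.< n →
      ∃₂ λ x y → f x ≡ f y × L ws (x + y) ≢ 0#
    collide {i} {j} f ws i+j<n with search (λ x → search (λ y → Vec.≡-dec Bool._≟_ (f x) (f y) ×-dec ¬? (L ws (x + y) ≟ 0#)))
    ... | yes (x , y , p) = x , y , p
    ... | no ¬p = contradiction (2^-cancel-≤ {n} {j ℕ.+ i} (Fin.injective⇒≤ {f = code} code-injective))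
                    (ℕ.<⇒≱ (subst (ℕ._< n) (ℕ.+-comm i j) i+j<n))
      where
      rep : Vec Bool j → C
      rep c with search (λ x → Vec.≡-dec Bool._≟_ (f x) c)
      ... | yes (x , _) = x
      -- Default for an empty fibre of `f`; below, `rep` is evaluated at values of `f`.
      ... | no _        = 0#
      f-rep : ∀ x → f (rep (f x)) ≡ f x
      f-rep x with search (λ y → Vec.≡-dec Bool._≟_ (f y) (f x))
      ... | yes (_ , eq) = eq
      ... | no ¬q = contradiction (x , refl) ¬q
      inside : ∀ x → L ws (x + rep (f x)) ≡ 0#
      inside x with L ws (x + rep (f x)) ≟ 0#
      ... | yes eq = eq
      ... | no ne  = contradiction (x , rep (f x) , sym (f-rep x) , ne) ¬p
      coord : C → Vec Bool i
      coord x = proj₁ (coordinates ws (inside x))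
      code : Fin (2 ℕ.^ n) → Fin (2 ℕ.^ (j ℕ.+ i))
      code a = enc (f (element a) ++ coord (element a))
      code-injective : Inj code
      code-injective {a} {b} eq = element-injective
        (let x = element a
             y = element b
             eq₁ , eq₂ = Vec.++-injective (f x) (f y) (enc-injective eq)
         in begin
           x
             ≡⟨ solve 2 (λ x r → x := (x :+ r) :+ r) refl x (rep (f x)) ⟩
           x + rep (f x) + rep (f x)
             ≡⟨ cong (_+ rep (f x)) (proj₂ (coordinates ws (inside x))) ⟩
           lc (coord x) ws + rep (f x)                  ≡⟨ cong₂ (λ c d → lc c ws + rep d) eq₂ eq₁ ⟩
           lc (coord y) ws + rep (f y)
             ≡⟨ cong (_+ rep (f y)) (proj₂ (coordinates ws (inside y))) ⟨
           y + rep (f y) + rep (f y)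
             ≡⟨ solve 2 (λ x r → x := (x :+ r) :+ r) refl y (rep (f y)) ⟨
           y                                            ∎)
        where open ≡-Reasoning

    extend : ∀ {k} (vs : Vec C k) → k ℕ.< n → ∃ λ x → L vs x ≢ 0#
    extend {k} vs k<n with collide (λ _ → []) vs (subst (ℕ._< n) (sym (ℕ.+-identityʳ k)) k<n)
    ... | x , y , _ , ne = x + y , ne

  -- Subspaces stable under a scalar

  onZero : C → C → C
  onZero y z with y ≟ 0#
  ... | yes _ = z
  ... | no  _ = 0#

  onZero-0 : ∀ {y} z → y ≡ 0# → onZero y z ≡ z
  onZero-0 {y} z eq with y ≟ 0#
  ... | yes _ = refl
  ... | no ne = contradiction eq ne

  onZero-≢0 : ∀ {y} z → y ≢ 0# → onZero y z ≡ 0#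
  onZero-≢0 {y} z ne with y ≟ 0#
  ... | yes eq = contradiction eq ne
  ... | no _   = refl

  -- As a sum over the field weighted by membership, the value visibly depends on the coset alone
  -- and not on the chosen basis.
  affineSum-∑ : ∀ {k} {vs : Vec C k} → Good vs → ∀ f a →
    affineSum F f a vs ≡ Σ+.∑ (λ x → onZero (L vs (x + a)) (f x))
  affineSum-∑ {vs = []} _ f a = trans (cong f (+-identityʳ a)) (sym (trans
    (Σ+.∑-single a _ (λ x x≢a → onZero-≢0 (f x) (+-≢0 x≢a))) (onZero-0 (f a) (x+x≡0 a))))
  affineSum-∑ {vs = v ∷ vs} (v∉ , g) f a = trans (affineSum-∷ f a v vs)
    (trans (cong₂ _+_ (affineSum-∑ g f a) (affineSum-∑ g f (a + v)))
      (trans (sym (Σ+.∑-∙ (λ x → onZero (L vs (x + a)) (f x)) (λ x → onZero (L vs (x + (a + v))) (f x))))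
        (Σ+.∑-cong merge)))
    where
    c = L vs v
    shifted : ∀ x → L vs (x + (a + v)) ≡ L vs (x + a) + c
    shifted x = trans (cong (L vs) (sym (+-assoc x a v))) (L-+ vs (x + a) v)
    merge : ∀ x → onZero (L vs (x + a)) (f x) + onZero (L vs (x + (a + v))) (f x) ≡ onZero (L (v ∷ vs) (x + a)) (f x)
    merge x with L vs (x + a) ≟ 0#
    -- The two cosets are disjoint: x in both would force `c` to be 0.
    ... | yes z = trans (cong (f x +_) (onZero-≢0 (f x) (λ eq → v∉ (trans
                    (trans (sym (+-identityˡ c)) (cong (_+ c) (sym z))) (trans (sym (shifted x)) eq)))))
                  (trans (+-identityʳ _) (sym (onZero-0 (f x) (trans (cong (_* (L vs (x + a) + c)) z) (zeroˡ _)))))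
    ... | no ne with (L vs (x + a) + c) ≟ 0#
    ...   | yes z = trans (+-identityˡ _) (trans (onZero-0 (f x) (trans (shifted x) z))
                      (sym (onZero-0 (f x) (trans (cong (L vs (x + a) *_) z) (zeroʳ _)))))
    ...   | no ne′ = trans (+-identityˡ _) (trans (onZero-≢0 (f x) (ne′ ∘ trans (sym (shifted x))))
                      (sym (onZero-≢0 (f x) (*-≢0 ne ne′))))

  S-∑ : ∀ {k} {vs : Vec C k} → Good vs → S vs ≡ Σ+.∑ (λ x → onZero (L vs x) (x ⁻¹))
  S-∑ {vs = vs} g = trans (sym (affineSum-inside g (L-0 vs))) (trans (affineSum-∑ g (finv F) 0#)
    (Σ+.∑-cong (λ x → cong (λ y → onZero (L vs y) (x ⁻¹)) (+-identityʳ x))))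

  S-unique : ∀ {j k} {us : Vec C j} {vs : Vec C k} → Good us → Good vs →
    (∀ x → L us x ≡ 0# → L vs x ≡ 0#) → (∀ x → L vs x ≡ 0# → L us x ≡ 0#) → S us ≡ S vs
  S-unique {us = us} {vs} g h u⇒v v⇒u = trans (S-∑ g) (trans (Σ+.∑-cong same) (sym (S-∑ h)))
    where
    same : ∀ x → onZero (L us x) (x ⁻¹) ≡ onZero (L vs x) (x ⁻¹)
    same x with L us x ≟ 0#
    ... | yes z = sym (onZero-0 _ (u⇒v x z))
    ... | no ne = sym (onZero-≢0 _ (ne ∘ v⇒u x))

  Stable : ∀ {k} → C → Vec C k → Set
  Stable a vs = ∀ x → L vs x ≡ 0# → L vs (a * x) ≡ 0#

  -- Scaling a subspace by a divides its sum of inverses by a.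
  stable⇒S≡0 : ∀ {k} {vs : Vec C k} {a} → Good vs → a ≢ 0# → a ≢ 1# → Stable a vs → Stable (a ⁻¹) vs → S vs ≡ 0#
  stable⇒S≡0 {k} {vs} {a} g a≢0 a≢1 st st⁻¹ with S vs ≟ 0#
  ... | yes z = z
  ... | no ne = contradiction a≡1 a≢1
    where
    undo : ∀ x → a * (a ⁻¹ * x) ≡ x
    undo x = trans (sym (*-assoc _ _ _)) (trans (cong (_* x) (⁻¹-inverse a a≢0)) (*-identityˡ x))
    L-scaled : ∀ x → L (map (a *_) vs) x ≡ frob k a * L vs (a ⁻¹ * x)
    L-scaled x = trans (cong (L (map (a *_) vs)) (sym (undo x))) (L-scale a≢0 vs (a ⁻¹ * x))
    fixed : a ⁻¹ * S vs ≡ S vs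
    fixed = trans (sym (S-scale a≢0 vs)) (S-unique (Good-scale a≢0 g) g
      (λ x eq → trans (cong (L vs) (sym (undo x))) (st (a ⁻¹ * x) (cancel x eq)))
      (λ x eq → trans (L-scaled x) (trans (cong (frob k a *_) (st⁻¹ x eq)) (zeroʳ _))))
      where
      cancel : ∀ x → L (map (a *_) vs) x ≡ 0# → L vs (a ⁻¹ * x) ≡ 0#
      cancel x eq with zero-product (trans (sym (L-scaled x)) eq)
      ... | inj₁ z = contradiction z (frob-≢0 k a≢0)
      ... | inj₂ z = z
    a≡1 : a ≡ 1#
    a≡1 = *-cancelˡ ne (trans (*-comm _ a) (trans (cong (a *_) (sym fixed)) (trans (undo (S vs)) (sym (*-identityʳ _)))))

  -- Duality of dimensions

  ZeroSum : ℕ → Set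
  ZeroSum k = Σ (Vec C k) λ vs → Good vs × S vs ≡ 0#

  zeroSum-++ : ∀ {j k} {us : Vec C j} {vs : Vec C k} → Good vs → Good (map (L vs) us) →
    S vs ≡ 0# → S (map (L vs) us) ≡ 0# → ZeroSum (j ℕ.+ k)
  zeroSum-++ {us = us} {vs} g h s t = us ++ vs , Good-++ us g h ,
    trans (S-++ us vs) (trans (cong₂ (λ x y → x + P vs * y) s t) (trans (+-identityˡ _) (zeroʳ _)))

  complement : ∀ {k} {vs : Vec C k} → Good vs → ∀ d → d ℕ.+ k ℕ.≤ n → ∃ λ (us : Vec C d) → Good (us ++ vs)
  complement g zero    _  = [] , g
  complement {vs = vs} g (suc d) le with complement g d (ℕ.<⇒≤ le)
  ... | us , h = let x , ne = extend (us ++ vs) le in x ∷ us , ne , h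

  module _ (2≤n : 2 ℕ.≤ n) where

    nontrivial : ∃ λ a → a ≢ 0# × a ≢ 1#
    nontrivial with extend (1# ∷ []) 2≤n
    ... | a , ne = a , (λ { refl → ne (L-0 (1# ∷ [])) }) , (λ { refl → ne (L-head 1# []) })

    -- The whole field is stable under every scalar, and 2 ≤ n supplies one other than 0 and 1.
    S-full : {vs : Vec C n} → Good vs → S vs ≡ 0#
    S-full {vs} g = let a , a≢0 , a≢1 = nontrivial in stable⇒S≡0 g a≢0 a≢1 (λ x _ → full (a * x)) (λ x _ → full (a ⁻¹ * x))
      where
      full : ∀ x → L vs x ≡ 0#
      full x with L vs x ≟ 0#
      ... | yes z = z
      ... | no ne = contradiction (Good⇒≤n {vs = x ∷ vs} (ne , g)) ℕ.1+n≰n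

    dual : ∀ {k} d → d ℕ.+ k ≡ n → ZeroSum k → ZeroSum d
    dual {k} d d+k≡n (vs , g , s) with complement g d (ℕ.≤-reflexive d+k≡n)
    ... | us , h = map (L vs) us , proj₂ (Good-++⁻ us h) , vanish
      where
      full : S (us ++ vs) ≡ 0#
      full = S-full-cast d+k≡n h
        where
        S-full-cast : ∀ {m} → m ≡ n → {vs : Vec C m} → Good vs → S vs ≡ 0#
        S-full-cast refl = S-full
      vanish : S (map (L vs) us) ≡ 0#
      vanish with zero-product (trans (sym (+-identityˡ _)) (trans (cong (_+ P vs * S (map (L vs) us)) (sym s))
                   (trans (sym (S-++ us vs)) full)))
      ... | inj₁ z = contradiction z (P-≢0 g)
      ... | inj₂ z = z

  ¬zeroSum-1 : ¬ ZeroSum 1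
  ¬zeroSum-1 (v ∷ [] , (v≢0 , _) , s) =
    ⁻¹-≢0 v≢0 (trans (sym (trans (+-identityˡ _) (*-identityˡ _))) s)

  -- Additive polynomials and subfields

  -- The monic additive polynomial c₀ x + c₁ x² + ⋯ + c_{d-1} x^(2^(d-1)) + x^(2^d).
  additive : ∀ {d} → Vec C d → C → C
  additive []       x = x
  additive (c ∷ cs) x = c * x + additive cs (x ²)

  -- Right division of a linearised polynomial by x (x + v); the remainder is linear. The recursion
  -- divides the part in x² by x² (x² + v²), the square of the divisor.
  divide : ∀ {d} (cs : Vec C (suc d)) v →
    ∃₂ λ (qs : Vec C d) r → ∀ x → additive cs x ≡ additive qs (x * (x + v)) + r * x
  divide (c ∷ []) v = [] , c + v , λ x →
    solve 3 (λ c v x → c :* x :+ x :* x := x :* (x :+ v) :+ (c :+ v) :* x) refl c v x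
  divide (c ∷ cs@(_ ∷ _)) v with divide cs (v ²)
  ... | qs , r , eq = r ∷ qs , c + r * v , λ x → begin
    c * x + additive cs (x ²)
      ≡⟨ cong (c * x +_) (eq (x ²)) ⟩
    c * x + (additive qs (x ² * (x ² + v ²)) + r * x ²)
      ≡⟨ cong (λ z → c * x + (additive qs z + r * x ²))
           (solve 2 (λ x v → (x :* x) :* (x :* x :+ v :* v) := (x :* (x :+ v)) :* (x :* (x :+ v))) refl x v) ⟩
    c * x + (additive qs ((x * (x + v)) ²) + r * x ²)
      ≡⟨ solve 5 (λ c x a r v → c :* x :+ (a :+ r :* (x :* x)) := (r :* (x :* (x :+ v)) :+ a) :+ (c :+ r :* v) :* x)
           refl c x (additive qs ((x * (x + v)) ²)) r v ⟩
    r * (x * (x + v)) + additive qs ((x * (x + v)) ²) + (c + r * v) * x ∎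
    where open ≡-Reasoning

  additive-0 : ∀ {d} (cs : Vec C d) → additive cs 0# ≡ 0#
  additive-0 []       = refl
  additive-0 (c ∷ cs) =
    trans (cong₂ _+_ (zeroʳ c) (trans (cong (additive cs) (zeroˡ 0#)) (additive-0 cs))) (+-identityˡ 0#)

  -- Peels off the last vector, which is the innermost factor of the composite and so matches
  -- `divide`.
  L-∷ʳ : ∀ {k} (us : Vec C k) v x → L (us ∷ʳ v) x ≡ L (map (L (v ∷ [])) us) (L (v ∷ []) x)
  L-∷ʳ []       v x = refl
  L-∷ʳ (u ∷ us) v x = cong₂ (λ y c → y * (y + c)) (L-∷ʳ us v x) (L-∷ʳ us v u)

  Good-∷ʳ : ∀ {k} (us : Vec C k) {v} → Good (us ∷ʳ v) → v ≢ 0# × Good (map (L (v ∷ [])) us)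
  Good-∷ʳ []       (v≢0 , _) = v≢0 , tt
  Good-∷ʳ (u ∷ us) {v} (u∉ , g) = let v≢0 , h = Good-∷ʳ us g in v≢0 , (u∉ ∘ trans (L-∷ʳ us v u)) , h

  All-∷ʳ : ∀ {Q : C → Set} {k} (us : Vec C k) {v} → All Q (us ∷ʳ v) → All Q us × Q v
  All-∷ʳ []       (q ∷ []) = [] , q
  All-∷ʳ (u ∷ us) (q ∷ qs) = let qs′ , q′ = All-∷ʳ us qs in q ∷ qs′ , q′

  -- An additive polynomial of degree 2^d has no d + 1 independent roots. Dividing by x (x + v) for
  -- the last root v leaves remainder r x with r v = 0, so r = 0; the images of the other roots are
  -- independent roots of the quotient.
  additive-roots : ∀ {d} (cs : Vec C d) (vs : Vec C (suc d)) → Good vs → ¬ All (λ v → additive cs v ≡ 0#) vs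
  additive-roots []          (v ∷ []) (v≢0 , _) (eq ∷ []) = v≢0 eq
  additive-roots cs@(_ ∷ _) vs g zs with initLast vs
  ... | us , v , refl with divide cs v | Good-∷ʳ us g
  ...   | qs , r , eq | v≢0 , h = additive-roots qs (map (L (v ∷ [])) us) h (All.map⁺ (All.map root (proj₁ (All-∷ʳ us zs))))
    where
    r≡0 : r ≡ 0#
    r≡0 with zero-product (trans (sym (trans (cong (_+ r * v) (trans (cong (additive qs) (L-head v [])) (additive-0 qs))) (+-identityˡ _)))
              (trans (sym (eq v)) (proj₂ (All-∷ʳ us zs))))
    ... | inj₁ z = z
    ... | inj₂ z = contradiction z v≢0
    root : ∀ {u} → additive cs u ≡ 0# → additive qs (L (v ∷ []) u) ≡ 0#
    root {u} z = trans (sym (trans (cong (λ r → additive qs (u * (u + v)) + r * u) r≡0)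
      (trans (cong (additive qs (u * (u + v)) +_) (zeroˡ u)) (+-identityʳ _)))) (trans (sym (eq u)) z)

  record Monic (d : ℕ) (f : C → C) : Set where
    constructor monic
    field
      coefficients : Vec C d
      is-additive  : ∀ x → f x ≡ additive coefficients x

  monic-id : Monic 0 (λ x → x)
  monic-id = monic [] (λ _ → refl)

  monic-² : ∀ {d f} → Monic d f → Monic (suc d) (λ x → f (x ²))
  monic-² (monic cs eq) = monic (0# ∷ cs) (λ x → trans (eq (x ²)) (sym (trans (cong (_+ additive cs (x ²)) (zeroˡ x)) (+-identityˡ _))))

  monic-+ : ∀ {d f} → Monic (suc d) f → ∀ a → Monic (suc d) (λ x → a * x + f x)
  monic-+ (monic (c ∷ cs) eq) a = monic (a + c ∷ cs) (λ x → trans (cong (a * x +_) (eq x))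
    (solve 4 (λ a c x t → a :* x :+ (c :* x :+ t) := (a :+ c) :* x :+ t) refl a c x (additive cs (x ²))))

  monic-frob : ∀ {d f} → Monic d f → ∀ k → Monic (k ℕ.+ d) (λ x → f (frob k x))
  monic-frob m zero = m
  monic-frob {f = f} m (suc k) with monic-² (monic-frob m k)
  ... | monic cs eq = monic cs (λ x → trans (cong f (sym (frob-² k x))) (eq x))
    where
    frob-² : ∀ k x → frob k (x ²) ≡ frob (suc k) x
    frob-² zero    x = refl
    frob-² (suc k) x = cong _² (frob-² k x)

  -- The relative trace to the subfield of 2^l elements when n = (j + 1) l.
  trace : ℕ → ℕ → C → C
  trace l zero    x = x
  -- The factor `1#` gives exactly the shape that `monic-+` produces.
  trace l (suc j) x = 1# * x + trace l j (frob l x)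

  monic-trace : ∀ l j → Monic (j ℕ.* suc l) (trace (suc l) j)
  monic-trace l zero    = monic-id
  monic-trace l (suc j) = monic-+ (monic-frob (monic-trace l j) (suc l)) 1#

  -- Adjacent terms cancel in characteristic 2. When the exponent on the right equals n, the right
  -- side is 0 by `fermat`.
  trace-telescope : ∀ l j x → trace l j (frob l x + x) ≡ frob (suc j ℕ.* l) x + x
  trace-telescope l zero    x = cong (λ k → frob k x + x) (sym (ℕ.+-identityʳ l))
  trace-telescope l (suc j) x = begin
    1# * (frob l x + x) + trace l j (frob l (frob l x + x))
      ≡⟨ cong₂ _+_ (*-identityˡ _) (trans (cong (trace l j) (frob-+ l (frob l x) x)) (trace-telescope l j (frob l x))) ⟩
    frob l x + x + (frob (suc j ℕ.* l) (frob l x) + frob l x)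
      ≡⟨ solve 3 (λ y x z → (y :+ x) :+ (z :+ y) := z :+ x) refl (frob l x) x (frob (suc j ℕ.* l) (frob l x)) ⟩
    frob (suc j ℕ.* l) (frob l x) + x
      ≡⟨ cong (_+ x) (trans (sym (frob-∘ (suc j ℕ.* l) l x)) (cong (λ k → frob k x) (ℕ.+-comm (suc j ℕ.* l) l))) ⟩
    frob (suc (suc j) ℕ.* l) x + x ∎
    where open ≡-Reasoning

  record Basis (Q : C → Set) (k : ℕ) : Set where
    constructor basis
    field
      vectors  : Vec C k
      good     : Good vectors
      inside   : All Q vectors
      spanning : ∀ {x} → Q x → L vectors x ≡ 0#

  abstract
    -- Greedy extension inside Q. The fuel counts the vectors that may still be added before `bound`
    -- is violated.
    maximal : ∀ {Q : C → Set} → Decidable Q → ∀ d → (∀ (vs : Vec C (suc d)) → Good vs → ¬ All Q vs) →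
      ∃ λ k → k ℕ.≤ d × Basis Q k
    maximal {Q} Q? d bound = grow d [] tt [] (ℕ.+-identityʳ d)
      where
      grow : ∀ fuel {k} (vs : Vec C k) → Good vs → All Q vs → fuel ℕ.+ k ≡ d → ∃ λ k → k ℕ.≤ d × Basis Q k
      grow fuel {k} vs g qs eq with search (λ x → Q? x ×-dec ¬? (L vs x ≟ 0#))
      ... | no none = k , ℕ.≤-trans (ℕ.m≤n+m k fuel) (ℕ.≤-reflexive eq) , basis vs g qs span
        where
        span : ∀ {x} → Q x → L vs x ≡ 0#
        span {x} q with L vs x ≟ 0#
        ... | yes z = z
        ... | no ne = contradiction (x , q , ne) none
      grow zero {k} vs g qs refl | yes (x , q , ne) = contradiction (q ∷ qs) (bound (x ∷ vs) (ne , g))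
      grow (suc fuel) {k} vs g qs eq | yes (x , q , ne) = grow fuel (x ∷ vs) (ne , g) (q ∷ qs) (trans (ℕ.+-suc fuel k) eq)

    roots-basis : ∀ {d f} → Monic d f → ∃ λ k → k ℕ.≤ d × Basis (λ x → f x ≡ 0#) k
    roots-basis {d} {f} (monic cs eq) = maximal (λ x → f x ≟ 0#) d
      (λ vs g zs → additive-roots cs vs g (All.map (λ {x} z → trans (sym (eq x)) z) zs))

  Fixed : ℕ → C → Set
  Fixed l x = frob l x ≡ x

  abstract
    -- Rank-nullity for x ↦ x^(2^l) + x, whose image is killed by the relative trace.
    subfield : ∀ l j → suc j ℕ.* suc l ≡ n → Basis (Fixed (suc l)) (suc l)
    subfield l j eq with roots-basis (monic-+ (monic-frob monic-id (suc l)) 1#) | roots-basis (monic-trace l j)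
    ... | d , d≤ , basis ks g qs span | e , e≤ , basis ts _ _ span′ with d ℕ.≟ suc l
    ...   | yes refl = basis ks g (All.map (λ {x} z → sym (trans (sym (*-identityˡ x)) (+-≡0 z))) qs)
                         (λ {x} z → span (trans (cong₂ _+_ (*-identityˡ x) z) (x+x≡0 x)))
    -- A smaller kernel would make the dimensions of kernel and trace kernel add up to less than n.
    -- Then two elements outside a common kernel coset would have the same image under `ψ`.
    ...   | no d≢ = contradiction (collide coord ks d+e<n) λ (x , y , same , ne) → ne (span (kernel x y same))
      where
      ψ : C → C
      ψ x = frob (suc l) x + x
      killed : ∀ x → L ts (ψ x) ≡ 0#
      killed x = span′ (trans (trace-telescope (suc l) j x) (trans (cong (λ k → frob k x + x) eq) (≡-+0 (fermat x))))
      coord : C → Vec Bool e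
      coord x = proj₁ (coordinates ts (killed x))
      kernel : ∀ x y → coord x ≡ coord y → 1# * (x + y) + frob (suc l) (x + y) ≡ 0#
      kernel x y same = begin
        1# * (x + y) + frob (suc l) (x + y)    ≡⟨ cong₂ _+_ (*-identityˡ _) (frob-+ (suc l) x y) ⟩
        x + y + (frob (suc l) x + frob (suc l) y)
          ≡⟨ solve 4 (λ x y a b → (x :+ y) :+ (a :+ b) := (a :+ x) :+ (b :+ y)) refl x y _ _ ⟩
        ψ x + ψ y                         ≡⟨ ≡-+0 (trans (proj₂ (coordinates ts (killed x)))
                                               (trans (cong (λ c → lc c ts) same) (sym (proj₂ (coordinates ts (killed y)))))) ⟩
        0#                                ∎
        where open ≡-Reasoning
      d+e<n : d ℕ.+ e ℕ.< n
      d+e<n = subst (d ℕ.+ e ℕ.<_) eq (ℕ.+-mono-<-≤ (ℕ.≤∧≢⇒< (subst (d ℕ.≤_) (cong suc (ℕ.+-identityʳ l)) d≤) d≢) e≤)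

-- The trace in odd degree

module OddField {n : ℕ} (F : GF2^ n) (odd : n ℕ.% 2 ≡ 1) where

  open GF2^ F renaming (Carrier to C)
  open Field F

  -- Squaring would swap x and x + 1, so n squarings, an odd number, would send x to x + 1; but they
  -- fix x.
  ω-free : ∀ x → x ² + x ≢ 1#
  ω-free x eq = 0≢1 (+-cancelˡ x (trans (+-identityʳ x) (trans (sym (fermat x))
    (trans (cong (λ m → frob m x) (trans (ℕ.m≡m%n+[m/n]*n n 2) (cong (ℕ._+ n ℕ./ 2 ℕ.* 2) odd)))
      (odd-power (n ℕ./ 2))))))
    where
    step : ∀ y → y ² + y ≡ 1# → y ² ≡ y + 1#
    step y e = trans (solve 1 (λ y → y :* y := (y :* y :+ y) :+ y) refl y) (trans (cong (_+ y) e) (+-comm 1# y))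
    back : (x + 1#) ² ≡ x
    back = trans (²-+ x 1#) (trans (cong₂ _+_ (step x eq) (*-identityˡ 1#))
      (solve 1 (λ x → (x :+ con true) :+ con true := x) refl x))
    odd-power : ∀ k → frob (suc (k ℕ.* 2)) x ≡ x + 1#
    odd-power zero    = step x eq
    odd-power (suc k) = trans (cong (λ y → y ² ²) (odd-power k)) (trans (cong _² back) (step x eq))

  -- Clearing denominators gives u (u + v) = v², so t = u / v would satisfy t² + t = 1.
  ¬zeroSum-2 : ¬ ZeroSum 2
  ¬zeroSum-2 (u ∷ v ∷ [] , (u∉ , v≢0 , _) , s) = ω-free t (begin
    t ² + t
      ≡⟨ solve 3 (λ u v i → (u :* i) :* (u :* i) :+ u :* i :* con true :=
                                                    (u :* i) :* (u :* i) :+ u :* i) refl u v (v ⁻¹) ⟨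
    u * i * (u * i) + u * i * 1#              ≡⟨ cong (λ z → u * i * (u * i) + u * i * z) (⁻¹-inverse v v≢0) ⟨
    u * i * (u * i) + u * i * (v * i)
      ≡⟨ solve 3 (λ u v i → (u :* i) :* (u :* i) :+ (u :* i) :* (v :* i) :=
                                                    (u :* (u :+ v)) :* (i :* i)) refl u v i ⟩
    u * (u + v) * (i * i)                     ≡⟨ cong (_* (i * i)) product ⟩
    v * v * (i * i)
      ≡⟨ solve 2 (λ v i → (v :* v) :* (i :* i) := (v :* i) :* (v :* i)) refl v i ⟩
    v * i * (v * i)                           ≡⟨ cong₂ _*_ (⁻¹-inverse v v≢0) (⁻¹-inverse v v≢0) ⟩
    1# * 1#                                   ≡⟨ *-identityˡ 1# ⟩
    1#                                        ∎)
    where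
    open ≡-Reasoning
    i = v ⁻¹
    t = u * i
    w = u * (u + v)
    balance : i ≡ v * w ⁻¹
    balance = +-≡0 (trans (sym (cong₂ _+_ (trans (+-identityˡ _) (*-identityˡ _)) (cong (_* w ⁻¹) (*-identityˡ v)))) s)
    product : w ≡ v * v
    product = sym (begin
      v * v                    ≡⟨ *-identityʳ _ ⟨
      v * v * 1#               ≡⟨ cong (v * v *_) (⁻¹-inverse w u∉) ⟨
      v * v * (w * w ⁻¹)
        ≡⟨ solve 3 (λ v w j → (v :* v) :* (w :* j) := v :* w :* (v :* j)) refl v w (w ⁻¹) ⟩
      v * w * (v * w ⁻¹)       ≡⟨ cong (v * w *_) balance ⟨
      v * w * i                ≡⟨ solve 3 (λ v w i → (v :* w) :* i := w :* (v :* i)) refl v w i ⟩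
      w * (v * i)              ≡⟨ cong (w *_) (⁻¹-inverse v v≢0) ⟩
      w * 1#                   ≡⟨ *-identityʳ w ⟩
      w                        ∎)

  -- The map y ↦ y² + y is two-to-one and misses 1, so its image and the translate by 1 cover the field.
  abstract
    half : ∀ x → (∃ λ y → y ² + y ≡ x) ⊎ (∃ λ y → y ² + y ≡ x + 1#)
    half x with surjective ψ-injective x
      where
      -- The fibres of y² + y are the pairs y, y + 1. The member of smaller index keeps its value
      -- and the other is shifted by 1; this is injective, hence onto.
      ψ : C → C
      ψ y with index y Fin.<? index (y + 1#)
      ... | yes _ = y ² + y
      ... | no _  = y ² + y + 1#
      y≢y+1 : ∀ y → index y ≢ index (y + 1#)
      y≢y+1 y eq = 0≢1 (+-cancelˡ y (trans (+-identityʳ y) (index-injective eq)))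
      rearrange : ∀ y z → y ² + y + (z ² + z) ≡ (y + z) * (y + (z + 1#))
      rearrange = solve 2 (λ y z → (y :* y :+ y) :+ (z :* z :+ z) := (y :+ z) :* (y :+ (z :+ con true))) refl
      same-fibre : ∀ {y z} → y ² + y ≡ z ² + z → y ≡ z ⊎ y ≡ z + 1#
      same-fibre {y} {z} eq with zero-product (trans (sym (rearrange y z)) (≡-+0 eq))
      ... | inj₁ e = inj₁ (+-≡0 e)
      ... | inj₂ e = inj₂ (+-≡0 e)
      cross : ∀ {y z} → y ² + y ≢ z ² + z + 1#
      cross {y} {z} eq = ω-free (y + z) (trans
        (solve 2 (λ y z → (y :+ z) :* (y :+ z) :+ (y :+ z) := (y :* y :+ y) :+ (z :* z :+ z)) refl y z)
        (trans (cong (_+ (z ² + z)) eq) (solve 1 (λ a → (a :+ con true) :+ a := con true) refl (z ² + z))))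
      +1+1 : ∀ z → z + 1# + 1# ≡ z
      +1+1 = solve 1 (λ z → (z :+ con true) :+ con true := z) refl
      cancel+1 : ∀ {y z} → y + 1# ≡ z + 1# → y ≡ z
      cancel+1 {y} {z} eq = trans (sym (+1+1 y)) (trans (cong (_+ 1#) eq) (+1+1 z))
      ψ-injective : Inj ψ
      ψ-injective {y} {z} eq with index y Fin.<? index (y + 1#) | index z Fin.<? index (z + 1#)
      ... | yes p | yes q = decide (same-fibre eq)
        where
        decide : y ≡ z ⊎ y ≡ z + 1# → y ≡ z
        decide (inj₁ e) = e
        decide (inj₂ refl) = contradiction (subst (λ w → index (z + 1#) Fin.< index w) (+1+1 z) p) (Fin.<-asym q)
      ... | yes p | no q  = contradiction eq cross
      ... | no p  | yes q = contradiction (sym eq) cross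
      ... | no p  | no q  = decide (same-fibre (cancel+1 eq))
        where
        decide : y ≡ z ⊎ y ≡ z + 1# → y ≡ z
        decide (inj₁ e) = e
        decide (inj₂ refl) with Fin.<-cmp (index z) (index (z + 1#))
        ... | tri< lt _ _ = contradiction lt q
        ... | tri≈ _ e _  = contradiction e (y≢y+1 z)
        ... | tri> _ _ gt = contradiction (subst (λ w → index (z + 1#) Fin.< index w) (sym (+1+1 z)) gt) p
    ... | y , eq with index y Fin.<? index (y + 1#)
    ...   | yes _ = inj₁ (y , eq)
    ...   | no _  = inj₂ (y , trans (solve 1 (λ a → a := (a :+ con true) :+ con true) refl (y ² + y)) (cong (_+ 1#) eq))

    -- The absolute trace, read off from solvability of the Artin-Schreier equation: `false` exactly
    -- on the values y² + y.
    T : C → Bool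
    T x with half x
    ... | inj₁ _ = false
    ... | inj₂ _ = true

    root : C → C
    root x with half x
    ... | inj₁ (y , _) = y
    ... | inj₂ (y , _) = y

    root-spec : ∀ x → root x ² + root x ≡ x + ⟦ T x ⟧₂
    root-spec x with half x
    ... | inj₁ (y , eq) = trans eq (sym (+-identityʳ x))
    ... | inj₂ (y , eq) = eq

    T≡false : ∀ {x} y → y ² + y ≡ x → T x ≡ false
    T≡false {x} y eq with half x
    ... | inj₁ _ = refl
    ... | inj₂ (z , eq′) = contradiction (trans
      (solve 2 (λ y z → (y :+ z) :* (y :+ z) :+ (y :+ z) := (y :* y :+ y) :+ (z :* z :+ z)) refl y z)
      (trans (cong₂ _+_ eq eq′) (solve 1 (λ x → x :+ (x :+ con true) := con true) refl x))) (ω-free (y + z))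

    T≡true : ∀ {x} y → y ² + y ≡ x + 1# → T x ≡ true
    T≡true {x} y eq with half x
    ... | inj₂ _ = refl
    ... | inj₁ (z , eq′) = contradiction (trans
      (solve 2 (λ y z → (y :+ z) :* (y :+ z) :+ (y :+ z) := (y :* y :+ y) :+ (z :* z :+ z)) refl y z)
      (trans (cong₂ _+_ eq eq′) (solve 1 (λ x → (x :+ con true) :+ x := con true) refl x))) (ω-free (y + z))

    T-root : ∀ {x} → T x ≡ false → ∃ λ y → y ² + y ≡ x
    T-root {x} eq = root x , trans (root-spec x) (trans (cong (λ b → x + ⟦ b ⟧₂) eq) (+-identityʳ x))

    T-+ : ∀ x y → T (x + y) ≡ T x xor T y
    T-+ x y = decide (T x xor T y) (trans
        (solve 2 (λ a b → (a :+ b) :* (a :+ b) :+ (a :+ b) := (a :* a :+ a) :+ (b :* b :+ b)) refl (root x) (root y))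
        (trans (cong₂ _+_ (root-spec x) (root-spec y))
          (trans (solve 4 (λ x y a b → (x :+ a) :+ (y :+ b) := (x :+ y) :+ (a :+ b)) refl x y ⟦ T x ⟧₂ ⟦ T y ⟧₂)
            (cong (x + y +_) (sym (⟦⟧₂-xor (T x) (T y)))))))
      where
      decide : ∀ b → (root x + root y) ² + (root x + root y) ≡ x + y + ⟦ b ⟧₂ → T (x + y) ≡ b
      decide false eq = T≡false _ (trans eq (+-identityʳ _))
      decide true  eq = T≡true _ eq

    T-² : ∀ x → T (x ²) ≡ T x
    T-² x = decide (T x) (trans
        (solve 1 (λ r → (r :* r) :* (r :* r) :+ r :* r := (r :* r :+ r) :* (r :* r :+ r)) refl (root x))
        (trans (cong _² (root-spec x)) (trans (²-+ x _) (cong (x ² +_) (bit-² (T x))))))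
      where
      bit-² : ∀ b → ⟦ b ⟧₂ ² ≡ ⟦ b ⟧₂
      bit-² false = zeroˡ 0#
      bit-² true  = *-identityˡ 1#
      decide : ∀ b → (root x ²) ² + root x ² ≡ x ² + ⟦ b ⟧₂ → T (x ²) ≡ b
      decide false eq = T≡false _ (trans eq (+-identityʳ _))
      decide true  eq = T≡true _ eq

    T-1 : T 1# ≡ true
    T-1 = T≡true 0# (trans (+-identityʳ _) (trans (zeroˡ 0#) (sym (x+x≡0 1#))))

    T-0 : T 0# ≡ false
    T-0 = T≡false 0# (trans (+-identityʳ _) (zeroˡ 0#))

  -- Images of subspace polynomials and addition of dimensions

  -- Since v ∷ vs has image {y² + c y : y ∈ im L vs} with c = L vs v in im L vs, the coset of z
  -- modulo this image is determined by the class of z / c² modulo {y² + y} and, recursively, by that of c y.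
  coset : ∀ {k} → Vec C k → C → Vec Bool k
  coset []       z = []
  coset (v ∷ vs) z = T z′ ∷ coset vs (c * root z′)
    where
    c  = L vs v
    z′ = (c ⁻¹) ² * z

  coset-image : ∀ {k} {vs : Vec C k} → Good vs → ∀ {y z} → coset vs y ≡ coset vs z → ∃ λ x → L vs x ≡ y + z
  coset-image {vs = []} _ {y} {z} _ = y + z , refl
  coset-image {vs = v ∷ vs} (c≢0 , g) {y} {z} eq
    with coset-image g (Vec.∷-injectiveʳ eq)
  -- By induction `L vs x` is c (ry + rz). The last factor of the subspace polynomial turns this
  -- into c² times a sum of two Artin-Schreier values, where the equal trace bits cancel.
  ... | x , e = x , (begin
    L vs x * (L vs x + c)                              ≡⟨ cong (λ a → a * (a + c)) e ⟩
    (c * ry + c * rz) * (c * ry + c * rz + c)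
      ≡⟨ solve 3 (λ c a b → (c :* a :+ c :* b) :* ((c :* a :+ c :* b) :+ c) :=
           (c :* c) :* ((a :* a :+ a) :+ (b :* b :+ b))) refl c ry rz ⟩
    c ² * (ry ² + ry + (rz ² + rz))
      ≡⟨ cong (c ² *_) (cong₂ _+_ (root-spec y′) (root-spec z′)) ⟩
    c ² * (y′ + ⟦ T y′ ⟧₂ + (z′ + ⟦ T z′ ⟧₂))
      ≡⟨ cong (λ b → c ² * (y′ + ⟦ b ⟧₂ + (z′ + ⟦ T z′ ⟧₂))) (Vec.∷-injectiveˡ eq) ⟩
    c ² * (y′ + ⟦ T z′ ⟧₂ + (z′ + ⟦ T z′ ⟧₂))
      ≡⟨ solve 5 (λ c i y z t → (c :* c) :* (((i :* i) :* y :+ t) :+ ((i :* i) :* z :+ t)) :=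
           ((c :* i) :* (c :* i)) :* (y :+ z)) refl c (c ⁻¹) y z ⟦ T z′ ⟧₂ ⟩
    (c * c ⁻¹) ² * (y + z)                             ≡⟨ cong (λ a → a ² * (y + z)) (⁻¹-inverse c c≢0) ⟩
    1# ² * (y + z)                                     ≡⟨ cong (_* (y + z)) (*-identityˡ 1#) ⟩
    1# * (y + z)                                       ≡⟨ *-identityˡ _ ⟩
    y + z                                              ∎)
    where
    open ≡-Reasoning
    c  = L vs v
    y′ = (c ⁻¹) ² * y
    z′ = (c ⁻¹) ² * z
    ry = root y′
    rz = root z′

  -- The j · k bits that record the cosets of all products y u modulo im `L vs`.
  cosets : ∀ {j k} → Vec C k → Vec C j → C → Vec Bool (j ℕ.* k)
  cosets vs []       y = []
  cosets vs (u ∷ us) y = coset vs (y * u) ++ cosets vs us y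

  cosets-image : ∀ {j k} {vs : Vec C k} → Good vs → (us : Vec C j) → ∀ {y z} → cosets vs us y ≡ cosets vs us z →
    ∃ λ xs → map (L vs) xs ≡ map ((y + z) *_) us
  cosets-image g []       _  = [] , refl
  cosets-image {vs = vs} g (u ∷ us) {y} {z} eq =
    let eq₁ , eq₂ = Vec.++-injective (coset vs (y * u)) (coset vs (z * u)) eq
        x , e   = coset-image g eq₁
        xs , es = cosets-image g us eq₂
    in x ∷ xs , cong₂ _∷_ (trans e (sym (distribʳ u y z))) es

  -- Two distinct scalars share a code, so their sum multiplies `us` into im `L vs`, from where it
  -- lifts. Scaling preserves vanishing of S.
  zeroSum-+ : ∀ {j k} → ZeroSum j → ZeroSum k → j ℕ.* k ℕ.< n → ZeroSum (j ℕ.+ k)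
  zeroSum-+ (us , h , t) (vs , g , s) jk<n with collide (cosets vs us) [] jk<n
  ... | y , z , eq , y+z≢0 with cosets-image g us eq
  ...   | xs , e = zeroSum-++ {us = xs} g (subst Good (sym e) (Good-scale y+z≢0 h)) s
                     (trans (cong S e) (trans (S-scale y+z≢0 us) (trans (cong (_ *_) t) (zeroʳ _))))

-- The conic and its character sums

module CharacterSums {n : ℕ} (F : GF2^ n) (odd : n ℕ.% 2 ≡ 1) where

  open GF2^ F renaming (Carrier to C)
  open Field F
  open OddField F odd
  open IntegerSums
  open import Data.Integer using (+_)

  -- C × C as the quadratic extension F(ω), ω² = ω + 1, with its norm form N.
  V : Set
  V = C × C

  isoV : V ↔ Fin (2 ℕ.^ n ℕ.* 2 ℕ.^ n)
  isoV = ↔-sym Fin.*↔× ↔-∘ (card ×-↔ card)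

  _≟V_ : DecidableEquality V
  _≟V_ = Product.≡-dec _≟_ _≟_

  𝟘 : V
  𝟘 = 0# , 0#

  infixl 6 _⊕_
  infixl 7 _⊙_
  infix 7 _∙_
  _⊕_ _⊙_ : V → V → V
  (a , b) ⊕ (c , d) = a + c , b + d
  (a , b) ⊙ (c , d) = a * c + b * d , a * d + b * c + b * d

  N : V → C
  N (a , b) = a ² + a * b + b ²

  polar : V → V → C
  polar (a , b) (c , d) = a * d + b * c

  _∙_ : V → V → C
  (a , b) ∙ (c , d) = a * c + b * d

  ⊕-𝟘 : ∀ v → v ⊕ 𝟘 ≡ v
  ⊕-𝟘 (a , b) = cong₂ _,_ (+-identityʳ a) (+-identityʳ b)

  ⊕-cancel : ∀ u v → u ⊕ (u ⊕ v) ≡ v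
  ⊕-cancel (a , b) (c , d) = cong₂ _,_ (cancel a c) (cancel b d)
    where
    cancel : ∀ a c → a + (a + c) ≡ c
    cancel = solve 2 (λ a c → a :+ (a :+ c) := c) refl

  ⊕-≡𝟘 : ∀ {u v} → u ⊕ v ≡ 𝟘 → v ≡ u
  ⊕-≡𝟘 {u} {v} eq = trans (sym (⊕-cancel u v)) (trans (cong (u ⊕_) eq) (⊕-𝟘 u))

  ⊙-comm : ∀ u v → u ⊙ v ≡ v ⊙ u
  ⊙-comm (a , b) (c , d) = cong₂ _,_
    (solve 4 (λ a b c d → a :* c :+ b :* d := c :* a :+ d :* b) refl a b c d)
    (solve 4 (λ a b c d → a :* d :+ b :* c :+ b :* d := c :* b :+ d :* a :+ d :* b) refl a b c d)

  ⊙-⊕ : ∀ ρ u v → ρ ⊙ (u ⊕ v) ≡ ρ ⊙ u ⊕ ρ ⊙ v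
  ⊙-⊕ (a , b) (c , d) (e , f) = cong₂ _,_
    (solve 6 (λ a b c d e f → a :* (c :+ e) :+ b :* (d :+ f) := (a :* c :+ b :* d) :+ (a :* e :+ b :* f)) refl a b c d e f)
    (solve 6 (λ a b c d e f → a :* (d :+ f) :+ b :* (c :+ e) :+ b :* (d :+ f) :=
      (a :* d :+ b :* c :+ b :* d) :+ (a :* f :+ b :* e :+ b :* f)) refl a b c d e f)

  -- Multiplication by (a, b) has the symmetric matrix with rows (a, b) and (b, a + b), hence is
  -- self-adjoint for the plain dot product.
  ⊙-adjoint : ∀ ρ θ v → (ρ ⊙ θ) ∙ v ≡ θ ∙ (ρ ⊙ v)
  ⊙-adjoint (a , b) (s , t) (x , y) =
    solve 6 (λ a b s t x y → (a :* s :+ b :* t) :* x :+ (a :* t :+ b :* s :+ b :* t) :* y :=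
      s :* (a :* x :+ b :* y) :+ t :* (a :* y :+ b :* x :+ b :* y)) refl a b s t x y

  ∙-⊕ : ∀ θ u v → θ ∙ (u ⊕ v) ≡ θ ∙ u + θ ∙ v
  ∙-⊕ (s , t) (a , b) (c , d) =
    solve 6 (λ s t a b c d → s :* (a :+ c) :+ t :* (b :+ d) := (s :* a :+ t :* b) :+ (s :* c :+ t :* d)) refl s t a b c d

  ∙-comm : ∀ u v → u ∙ v ≡ v ∙ u
  ∙-comm (a , b) (c , d) = cong₂ _+_ (*-comm a c) (*-comm b d)

  N-⊙ : ∀ u v → N (u ⊙ v) ≡ N u * N v
  N-⊙ (a , b) (c , d) = solve 4 (λ a b c d →
    let x = a :* c :+ b :* d ; y = a :* d :+ b :* c :+ b :* d in
    x :* x :+ x :* y :+ y :* y := (a :* a :+ a :* b :+ b :* b) :* (c :* c :+ c :* d :+ d :* d)) refl a b c d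

  N-⊕ : ∀ u v → N (u ⊕ v) ≡ N u + N v + polar u v
  N-⊕ (a , b) (c , d) = solve 4 (λ a b c d →
    (a :+ c) :* (a :+ c) :+ (a :+ c) :* (b :+ d) :+ (b :+ d) :* (b :+ d) :=
    (a :* a :+ a :* b :+ b :* b) :+ (c :* c :+ c :* d :+ d :* d) :+ (a :* d :+ b :* c)) refl a b c d

  -- A zero with b ≠ 0 would give t = a / b with t² + t = 1.
  N-anisotropic : ∀ v → N v ≡ 0# → v ≡ 𝟘
  N-anisotropic (a , b) eq with b ≟ 0#
  ... | yes refl =
    cong (_, 0#) (²-≡0 (trans (solve 1 (λ a → a :* a := a :* a :+ a :* con false :+ con false :* con false) refl a) eq))
  ... | no b≢0 = contradiction (begin
    (a * i) ² + a * i
      ≡⟨ solve 2 (λ a i → (a :* i) :* (a :* i) :+ a :* i :=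
                                                               ((a :* i) :* (a :* i) :+ (a :* i) :* con true :+ con true :* con true) :+ con true) refl a i ⟩
    (a * i) ² + a * i * 1# + 1# ² + 1#
      ≡⟨ cong (λ z → (a * i) ² + a * i * z + z ² + 1#) (⁻¹-inverse b b≢0) ⟨
    (a * i) ² + a * i * (b * i) + (b * i) ² + 1#
      ≡⟨ solve 3 (λ a b i → ((a :* i) :* (a :* i) :+ a :* i :* (b :* i) :+ (b :* i) :* (b :* i)) :+ con true :=
                                                               (a :* a :+ a :* b :+ b :* b) :* (i :* i) :+ con true) refl a b i ⟩
    N (a , b) * (i * i) + 1#                              ≡⟨ cong (λ z → z * (i * i) + 1#) eq ⟩
    0# * (i * i) + 1#                                     ≡⟨ trans (cong (_+ 1#) (zeroˡ _)) (+-identityˡ 1#) ⟩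
    1#                                                    ∎) (ω-free (a * i))
    where
    open ≡-Reasoning
    i = b ⁻¹

  -- The Gram determinant of three vectors in the plane, divided by 2.
  gram : ∀ u v w → polar u v * polar u w * polar v w ≡
    N u * polar v w ² + N v * polar u w ² + N w * polar u v ²
  gram (a , b) (c , d) (e , f) = solve 6 (λ a b c d e f →
    let uv = a :* d :+ b :* c ; uw = a :* f :+ b :* e ; vw = c :* f :+ d :* e in
    uv :* uw :* vw := (a :* a :+ a :* b :+ b :* b) :* (vw :* vw) :+ (c :* c :+ c :* d :+ d :* d) :* (uw :* uw)
      :+ (e :* e :+ e :* f :+ f :* f) :* (uv :* uv)) refl a b c d e f

  Ω : V → Set
  Ω v = N v ≡ 1#

  -- When all four norms are 1 the right side vanishes, so the three polar values sum to 0.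
  polar-total : ∀ a v b → polar a (a ⊕ v) + polar a b + polar (a ⊕ v) b ≡ N (b ⊕ v) + N b + (N a + N (a ⊕ v))
  polar-total (a , b) (c , d) (e , f) = solve 6 (λ a b c d e f →
    (a :* (b :+ d) :+ b :* (a :+ c)) :+ (a :* f :+ b :* e) :+ ((a :+ c) :* f :+ (b :+ d) :* e) :=
    ((e :+ c) :* (e :+ c) :+ (e :+ c) :* (f :+ d) :+ (f :+ d) :* (f :+ d)) :+
    (e :* e :+ e :* f :+ f :* f) :+
    ((a :* a :+ a :* b :+ b :* b) :+ ((a :+ c) :* (a :+ c) :+ (a :+ c) :* (b :+ d) :+ (b :+ d) :* (b :+ d)))) refl a b c d e f

  -- With all norms equal to 1 the Gram identity reads p q r = (p + q + r)².
  degenerate : ∀ {p q r x y z} → x ≡ 1# → y ≡ 1# → z ≡ 1# →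
    p * q * r ≡ x * r ² + y * q ² + z * p ² → p + q + r ≡ 0# → p * q * r ≡ 0#
  degenerate {p} {q} {r} refl refl refl eq total = trans eq (trans
    (solve 3 (λ p q r → con true :* (r :* r) :+ con true :* (q :* q) :+ con true :* (p :* p) :=
      (p :+ q :+ r) :* (p :+ q :+ r)) refl p q r)
    (trans (cong _² total) (zeroˡ 0#)))

  coincide : ∀ {u w} → Ω u → Ω w → polar u w ≡ 0# → w ≡ u
  coincide {u} {w} Nu Nw eq = ⊕-≡𝟘 (N-anisotropic (u ⊕ w) (trans (N-⊕ u w)
    (trans (cong₂ _+_ (cong₂ _+_ Nu Nw) eq) (trans (+-identityʳ _) 1+1≡0))))

  -- For a, a ⊕ v, b on the conic, some polar value is 0, so two of the three points coincide; a and
  -- a ⊕ v do not.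
  sum-of-two : ∀ {v a b} → v ≢ 𝟘 → Ω a → Ω (a ⊕ v) → Ω b → Ω (b ⊕ v) → b ≡ a ⊎ b ≡ a ⊕ v
  sum-of-two {v} {a} {b} v≢𝟘 Na Na′ Nb Nb′ = decide (zero-product product)
    where
    open ≡-Reasoning
    a′ = a ⊕ v
    total : polar a a′ + polar a b + polar a′ b ≡ 0#
    total = begin
      polar a a′ + polar a b + polar a′ b      ≡⟨ polar-total a v b ⟩
      N (b ⊕ v) + N b + (N a + N a′)           ≡⟨ cong₂ _+_ (cong₂ _+_ Nb′ Nb) (cong₂ _+_ Na Na′) ⟩
      1# + 1# + (1# + 1#)                      ≡⟨ x+x≡0 _ ⟩
      0#                                       ∎
    product : polar a a′ * polar a b * polar a′ b ≡ 0#
    product = degenerate {polar a a′} {polar a b} {polar a′ b} {N a} {N a′} {N b} Na Na′ Nb (gram a a′ b) total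
    decide : polar a a′ * polar a b ≡ 0# ⊎ polar a′ b ≡ 0# → b ≡ a ⊎ b ≡ a ⊕ v
    decide (inj₂ z) = inj₂ (coincide {a ⊕ v} {b} Na′ Nb z)
    decide (inj₁ z) with zero-product z
    ... | inj₂ z′ = inj₁ (coincide {a} {b} Na Nb z′)
    ... | inj₁ z′ = contradiction (trans (sym (⊕-cancel a v))
      (trans (cong (a ⊕_) (coincide {a} {a ⊕ v} Na Na′ z′)) (cong₂ _,_ (x+x≡0 _) (x+x≡0 _)))) v≢𝟘

  ⊙-injectiveʳ : ∀ {ρ} → ρ ≢ 𝟘 → Inj (ρ ⊙_)
  ⊙-injectiveʳ {ρ} ρ≢𝟘 {u} {v} eq = decide (zero-product (trans (sym (N-⊙ ρ (v ⊕ u))) (trans (cong N difference) N-𝟘)))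
    where
    N-𝟘 : N 𝟘 ≡ 0#
    N-𝟘 = solve 0 (con false :* con false :+ con false :* con false :+ con false :* con false := con false) refl
    difference : ρ ⊙ (v ⊕ u) ≡ 𝟘
    difference = trans (⊙-⊕ ρ v u) (trans (cong (ρ ⊙ v ⊕_) eq) (cong₂ _,_ (x+x≡0 _) (x+x≡0 _)))
    decide : N ρ ≡ 0# ⊎ N (v ⊕ u) ≡ 0# → u ≡ v
    decide (inj₁ z) = contradiction (N-anisotropic ρ z) ρ≢𝟘
    decide (inj₂ z) = ⊕-≡𝟘 (N-anisotropic (v ⊕ u) z)

  ⊙-injectiveˡ : ∀ {θ} → θ ≢ 𝟘 → Inj (_⊙ θ)
  ⊙-injectiveˡ {θ} θ≢𝟘 {u} {v} eq = ⊙-injectiveʳ θ≢𝟘 (trans (⊙-comm θ u) (trans eq (⊙-comm v θ)))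

  Ω⇒≢𝟘 : ∀ {ρ} → Ω ρ → ρ ≢ 𝟘
  Ω⇒≢𝟘 Nρ refl = 0≢1 (trans (solve 0 (con false := con false :* con false :+ con false :* con false :+ con false :* con false) refl) Nρ)

  sign : Bool → ℤ
  sign false = 1ℤ
  sign true  = -1ℤ

  sign-xor : ∀ a b → sign (a xor b) ≡ sign a ℤ.* sign b
  sign-xor false b     = sym (ℤ.*-identityˡ _)
  sign-xor true  false = refl
  sign-xor true  true  = refl

  χ : C → ℤ
  χ x = sign (T x)

  χ-+ : ∀ x y → χ (x + y) ≡ χ x ℤ.* χ y
  χ-+ x y = trans (cong sign (T-+ x y)) (sign-xor (T x) (T y))

  χ-² : ∀ x → χ x ℤ.* χ x ≡ 1ℤ
  χ-² x with T x
  ... | false = refl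
  ... | true  = refl

  module ℤV = ℤSum isoV

  -- Translating by some `θ₁` with θ₁ ∙ v = 1 negates the sum, because 1 has trace 1.
  orthogonal : ∀ {v} → v ≢ 𝟘 → ℤV.∑ (λ θ → χ (θ ∙ v)) ≡ 0ℤ
  orthogonal {v} v≢𝟘 = vanish (begin
    total                                            ≡⟨ ℤV.∑-reindex shift-injective (λ θ → χ (θ ∙ v)) ⟨
    ℤV.∑ (λ θ → χ ((θ₁ ⊕ θ) ∙ v))                     ≡⟨ ℤV.∑-cong flip ⟩
    ℤV.∑ (λ θ → -1ℤ ℤ.* χ (θ ∙ v))                    ≡⟨ ℤV.∑-* -1ℤ (λ θ → χ (θ ∙ v)) ⟩
    -1ℤ ℤ.* total                                    ∎)
    where
    open ≡-Reasoning
    total = ℤV.∑ (λ θ → χ (θ ∙ v))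
    witness : ∃ λ θ → θ ∙ v ≡ 1#
    witness with proj₁ v ≟ 0# | proj₂ v ≟ 0#
    ... | no x≢0   | _        = (proj₁ v ⁻¹ , 0#) , trans (cong₂ _+_ (⁻¹-inverseˡ x≢0) (zeroˡ _)) (+-identityʳ 1#)
    ... | yes _    | no y≢0   = (0# , proj₂ v ⁻¹) , trans (cong₂ _+_ (zeroˡ _) (⁻¹-inverseˡ y≢0)) (+-identityˡ 1#)
    ... | yes x≡0  | yes y≡0  = contradiction (cong₂ _,_ x≡0 y≡0) v≢𝟘
    θ₁ = proj₁ witness
    shift-injective : Inj (θ₁ ⊕_)
    shift-injective {θ} {θ′} eq = trans (sym (⊕-cancel θ₁ θ)) (trans (cong (θ₁ ⊕_) eq) (⊕-cancel θ₁ θ′))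
    flip : ∀ θ → χ ((θ₁ ⊕ θ) ∙ v) ≡ -1ℤ ℤ.* χ (θ ∙ v)
    flip θ = trans (cong χ (trans (∙-comm (θ₁ ⊕ θ) v) (trans (∙-⊕ v θ₁ θ) (cong₂ _+_ (∙-comm v θ₁) (∙-comm v θ)))))
      (trans (χ-+ (θ₁ ∙ v) (θ ∙ v)) (cong (ℤ._* χ (θ ∙ v)) (trans (cong χ (proj₂ witness)) (cong sign T-1))))
    vanish : ∀ {i} → i ≡ -1ℤ ℤ.* i → i ≡ 0ℤ
    vanish {+ zero}    _ = refl
    vanish {+ (suc m)} ()
    vanish { ℤ.-[1+ m ] } ()

  pairing : V → V → ℤ
  pairing θ v = χ (θ ∙ v)

  pairing-⊕ : ∀ θ u v → pairing θ (u ⊕ v) ≡ pairing θ u ℤ.* pairing θ v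
  pairing-⊕ θ u v = trans (cong χ (∙-⊕ θ u v)) (χ-+ (θ ∙ u) (θ ∙ v))

  pairing-² : ∀ θ v → pairing θ v ℤ.* pairing θ v ≡ 1ℤ
  pairing-² θ v = χ-² (θ ∙ v)

  adjoint : ∀ ρ θ v → pairing (ρ ⊙ θ) v ≡ pairing θ (ρ ⊙ v)
  adjoint ρ θ v = cong χ (⊙-adjoint ρ θ v)

  Ω? : ∀ v → Dec (Ω v)
  Ω? v = N v ≟ 1#

  Ω-closed : ∀ {ρ} → Ω ρ → ∀ {v} → Ω v → Ω (ρ ⊙ v)
  Ω-closed {ρ} Nρ {v} Nv = trans (N-⊙ ρ v) (trans (cong₂ _*_ Nρ Nv) (*-identityˡ 1#))

  Ω-closed⁻ : ∀ {ρ} → Ω ρ → ∀ {v} → Ω (ρ ⊙ v) → Ω v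
  Ω-closed⁻ {ρ} Nρ {v} Nρv =
    trans (sym (*-identityˡ (N v))) (trans (cong (_* N v) (sym Nρ)) (trans (sym (N-⊙ ρ v)) Nρv))

  Ω-injective : ∀ {ρ} → Ω ρ → Inj (ρ ⊙_)
  Ω-injective {ρ} Nρ = ⊙-injectiveʳ (Ω⇒≢𝟘 {ρ} Nρ)

  open FourthMoment isoV _≟V_ 𝟘 _⊕_ _⊙_ pairing Ω Ω? ⊕-𝟘 ⊕-cancel pairing-⊕ pairing-² orthogonal adjoint
    Ω-closed Ω-closed⁻ Ω-injective ⊙-injectiveˡ sum-of-two
    using (1[_]; 1[]-≥0; 1[]-yes; 1[]-no; ∑-indicator; ind; W; K; fourth-moment)

  -- The rational parametrisation x ↦ (1, x²) / (x² + x + 1) of the conic is injective: the quotient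
  -- of the coordinates is x², and squaring is injective.
  W-≥ : + (2 ℕ.^ n) ℤ.≤ W
  W-≥ =
    subst (ℤ._≤ W) (trans (sum-cong-≗ (λ i → 1[]-yes (Ω? _) (trans (cong N (V.element-index _)) (param-Ω (element i))))) (sum-ones (2 ℕ.^ n)))
    (sum-injective-≤ (V.index ∘ param ∘ element) (λ eq → element-injective (param-injective (V.index-injective eq))) (ind ∘ V.element)
      (λ i → 1[]-≥0 (Ω? (V.element i))))
    where
    open import Algebra.Properties.CommutativeMonoid.Sum ℤ.+-0-commutativeMonoid using (sum-cong-≗)
    module V = Finite isoV
    p : C → C
    p x = x ² + x + 1#
    p≢0 : ∀ x → p x ≢ 0#
    p≢0 x eq = ω-free x (+-≡0 eq)
    param : C → V
    param x = p x ⁻¹ , x ² * p x ⁻¹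
    param-Ω : ∀ x → Ω (param x)
    param-Ω x = trans (solve 2 (λ x i → i :* i :+ i :* ((x :* x) :* i) :+ ((x :* x) :* i) :* ((x :* x) :* i) :=
        ((x :* x :+ x :+ con true) :* i) :* ((x :* x :+ x :+ con true) :* i)) refl x (p x ⁻¹))
      (trans (cong _² (⁻¹-inverse (p x) (p≢0 x))) (*-identityˡ 1#))
    param-injective : Inj param
    param-injective {x} {y} eq = ²-injective (*-cancelˡ (⁻¹-≢0 (p≢0 x)) (trans (*-comm _ _)
      (trans (cong proj₂ eq) (trans (cong (y ² *_) (sym (cong proj₁ eq))) (*-comm _ _)))))

  -- Here w = W, k = |K θ| and m = 2ⁿ. If d k > w, then w⁴ ≤ d⁴ k⁴; the moment inequality and m ≤ w
  -- allow m² w² to be cancelled, leaving w ≤ 3 d⁴ < m ≤ w.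
  moment-bound : ∀ {w k m d} → 0 ℕ.< m → m ℕ.≤ w → 3 ℕ.* (d ℕ.* d ℕ.* (d ℕ.* d)) ℕ.< m →
    w ℕ.* (k ℕ.* k ℕ.* (k ℕ.* k)) ℕ.≤ m ℕ.* m ℕ.* (3 ℕ.* (w ℕ.* w)) → d ℕ.* k ℕ.≤ w
  moment-bound {w} {k} {m} {d} 0<m m≤w 3d⁴<m moment with (d ℕ.* k) ℕ.≤? w
  ... | yes p = p
  ... | no ¬p = contradiction 3d⁴<m (ℕ.≤⇒≯ (ℕ.≤-trans m≤w w≤3d⁴))
    where
    open ℕ.≤-Reasoning
    w≤dk : w ℕ.≤ d ℕ.* k
    w≤dk = ℕ.<⇒≤ (ℕ.≰⇒> ¬p)
    e = m ℕ.* m ℕ.* (w ℕ.* w)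
    d⁴ = d ℕ.* d ℕ.* (d ℕ.* d)
    instance
      e≢0 : ℕ.NonZero e
      e≢0 = ℕ.>-nonZero (ℕ.*-mono-< {0} {m ℕ.* m} {0} {w ℕ.* w} (ℕ.*-mono-< 0<m 0<m)
        (ℕ.*-mono-< (ℕ.<-≤-trans 0<m m≤w) (ℕ.<-≤-trans 0<m m≤w)))
    w≤3d⁴ : w ℕ.≤ 3 ℕ.* (d ℕ.* d ℕ.* (d ℕ.* d))
    w≤3d⁴ = ℕ.*-cancelˡ-≤ e (begin
      m ℕ.* m ℕ.* (w ℕ.* w) ℕ.* w
        ≤⟨ ℕ.*-monoˡ-≤ w (ℕ.*-monoˡ-≤ (w ℕ.* w) (ℕ.*-mono-≤ m≤w m≤w)) ⟩
      w ℕ.* w ℕ.* (w ℕ.* w) ℕ.* w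
        ≤⟨ ℕ.*-monoˡ-≤ w (ℕ.*-mono-≤ (ℕ.*-mono-≤ w≤dk w≤dk) (ℕ.*-mono-≤ w≤dk w≤dk)) ⟩
      d ℕ.* k ℕ.* (d ℕ.* k) ℕ.* (d ℕ.* k ℕ.* (d ℕ.* k)) ℕ.* w
        ≡⟨ cong (ℕ._* w) (trans (cong₂ ℕ._*_ (ℕ.[m*n]*[o*p]≡[m*o]*[n*p] d k d k) (ℕ.[m*n]*[o*p]≡[m*o]*[n*p] d k d k))
             (ℕ.[m*n]*[o*p]≡[m*o]*[n*p] (d ℕ.* d) (k ℕ.* k) (d ℕ.* d) (k ℕ.* k))) ⟩
      d⁴ ℕ.* (k ℕ.* k ℕ.* (k ℕ.* k)) ℕ.* w
        ≡⟨ trans (ℕ.*-assoc d⁴ _ w) (cong (d⁴ ℕ.*_) (ℕ.*-comm _ w)) ⟩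
      d⁴ ℕ.* (w ℕ.* (k ℕ.* k ℕ.* (k ℕ.* k)))
        ≤⟨ ℕ.*-monoʳ-≤ d⁴ moment ⟩
      d⁴ ℕ.* (m ℕ.* m ℕ.* (3 ℕ.* (w ℕ.* w)))
        ≡⟨ regroup d⁴ (m ℕ.* m) (w ℕ.* w) ⟩
      e ℕ.* (3 ℕ.* d⁴) ∎)
      where
      regroup : ∀ d m w → d ℕ.* (m ℕ.* (3 ℕ.* w)) ≡ m ℕ.* w ℕ.* (3 ℕ.* d)
      regroup = ℕS.solve-∀

  i*i≡∣i∣*∣i∣ : ∀ i → i ℤ.* i ≡ + (∣ i ∣ ℕ.* ∣ i ∣)
  i*i≡∣i∣*∣i∣ (+ m)        = sym (ℤ.pos-* m m)
  i*i≡∣i∣*∣i∣ ℤ.-[1+ m ] = refl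

  0≤W : 0ℤ ℤ.≤ W
  0≤W = ℤ.≤-trans (+≤+ z≤n) W-≥

  K-≥ : ∀ d → 3 ℕ.* (d ℕ.* d ℕ.* (d ℕ.* d)) ℕ.< 2 ℕ.^ n → ∀ {θ} → θ ≢ 𝟘 → ℤ.- W ℤ.≤ + d ℤ.* K θ
  K-≥ d 3d⁴<2ⁿ {θ} θ≢𝟘 = begin
    ℤ.- W                    ≤⟨ ℤ.neg-mono-≤ (subst₂ ℤ._≤_ (ℤ.pos-* d ∣ K θ ∣) W≡ (+≤+ dk≤w)) ⟩
    ℤ.- (+ d ℤ.* + ∣ K θ ∣)   ≡⟨ ℤ.neg-distribʳ-* (+ d) (+ ∣ K θ ∣) ⟩
    + d ℤ.* ℤ.- (+ ∣ K θ ∣)   ≤⟨ ℤ.*-monoˡ-≤-nonNeg (+ d) (-∣i∣≤i (K θ)) ⟩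
    + d ℤ.* K θ              ∎
    where
    open ℤ.≤-Reasoning
    W≡ : + ∣ W ∣ ≡ W
    W≡ = ℤ.0≤i⇒+∣i∣≡i 0≤W
    -∣i∣≤i : ∀ i → ℤ.- (+ ∣ i ∣) ℤ.≤ i
    -∣i∣≤i (+ m)        = ℤ.≤-trans (ℤ.neg-mono-≤ {+ 0} {+ m} (+≤+ z≤n)) (+≤+ z≤n)
    -∣i∣≤i ℤ.-[1+ m ] = ℤ.≤-refl
    moment : ∣ W ∣ ℕ.* (∣ K θ ∣ ℕ.* ∣ K θ ∣ ℕ.* (∣ K θ ∣ ℕ.* ∣ K θ ∣)) ℕ.≤ 2 ℕ.^ n ℕ.* 2 ℕ.^ n ℕ.* (3 ℕ.* (∣ W ∣ ℕ.* ∣ W ∣))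
    moment = ℤ.drop‿+≤+ (subst₂ ℤ._≤_
      (trans (cong₂ ℤ._*_ (sym W≡) (trans (cong₂ ℤ._*_ (i*i≡∣i∣*∣i∣ (K θ)) (i*i≡∣i∣*∣i∣ (K θ))) (sym (ℤ.pos-* (∣ K θ ∣ ℕ.* ∣ K θ ∣) _))))
        (sym (ℤ.pos-* ∣ W ∣ _)))
      (trans (cong (+ (2 ℕ.^ n ℕ.* 2 ℕ.^ n) ℤ.*_) (trans (cong (+ 3 ℤ.*_) (i*i≡∣i∣*∣i∣ W)) (sym (ℤ.pos-* 3 (∣ W ∣ ℕ.* ∣ W ∣)))))
        (sym (ℤ.pos-* (2 ℕ.^ n ℕ.* 2 ℕ.^ n) _)))
      (fourth-moment θ≢𝟘))
    dk≤w : d ℕ.* ∣ K θ ∣ ℕ.≤ ∣ W ∣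
    dk≤w = moment-bound {∣ W ∣} {∣ K θ ∣} {2 ℕ.^ n} {d} (ℕ.m^n>0 2 n)
      (ℤ.drop‿+≤+ (subst (+ (2 ℕ.^ n) ℤ.≤_) (sym W≡) W-≥)) 3d⁴<2ⁿ moment

  -- Points of the conic under trace conditions

  sumℤ : ∀ k → (Vec Bool k → ℤ) → ℤ
  sumℤ zero    g = g []
  sumℤ (suc k) g = sumℤ k (g ∘ (false ∷_)) ℤ.+ sumℤ k (g ∘ (true ∷_))

  sumℤ-cong : ∀ k {f g} → (∀ c → f c ≡ g c) → sumℤ k f ≡ sumℤ k g
  sumℤ-cong zero    eq = eq []
  sumℤ-cong (suc k) eq = cong₂ ℤ._+_ (sumℤ-cong k (eq ∘ (false ∷_))) (sumℤ-cong k (eq ∘ (true ∷_)))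

  sumℤ-* : ∀ k a f → sumℤ k (λ c → a ℤ.* f c) ≡ a ℤ.* sumℤ k f
  sumℤ-* zero    a f = refl
  sumℤ-* (suc k) a f =
    trans (cong₂ ℤ._+_ (sumℤ-* k a (f ∘ (false ∷_))) (sumℤ-* k a (f ∘ (true ∷_)))) (sym (ℤ.*-distribˡ-+ a _ _))

  ∑-sumℤ : ∀ k (f : Vec Bool k → V → ℤ) → ℤV.∑ (λ v → sumℤ k (λ c → f c v)) ≡ sumℤ k (λ c → ℤV.∑ (f c))
  ∑-sumℤ zero    f = refl
  ∑-sumℤ (suc k) f = trans (ℤV.∑-∙ (λ v → sumℤ k (λ c → f (false ∷ c) v)) (λ v → sumℤ k (λ c → f (true ∷ c) v)))
    (cong₂ ℤ._+_ (∑-sumℤ k (f ∘ (false ∷_))) (∑-sumℤ k (f ∘ (true ∷_))))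

  sumℤ-≥ : ∀ k {b} (g : Vec Bool k → ℤ) → (∀ c → b ℤ.≤ g c) → + (2 ℕ.^ k) ℤ.* b ℤ.≤ sumℤ k g
  sumℤ-≥ zero    {b} g le = subst (ℤ._≤ g []) (sym (ℤ.*-identityˡ b)) (le [])
  sumℤ-≥ (suc k) {b} g le = subst (ℤ._≤ sumℤ (suc k) g)
    (trans (twice (+ (2 ℕ.^ k)) b) (cong (ℤ._* b) (sym (ℤ.pos-* 2 (2 ℕ.^ k)))))
    (ℤ.+-mono-≤ (sumℤ-≥ k (g ∘ (false ∷_)) (le ∘ (false ∷_))) (sumℤ-≥ k (g ∘ (true ∷_)) (le ∘ (true ∷_))))
    where
    twice : ∀ p b → p ℤ.* b ℤ.+ p ℤ.* b ≡ + 2 ℤ.* p ℤ.* b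
    twice = ℤS.solve-∀

  sumℤ-≥′ : ∀ k {a b} (g : Vec Bool k → ℤ) → a ℤ.≤ g (replicate k false) → (∀ {c} → c ≢ replicate k false → b ℤ.≤ g c) →
    a ℤ.+ (+ (2 ℕ.^ k) ℤ.- 1ℤ) ℤ.* b ℤ.≤ sumℤ k g
  sumℤ-≥′ zero    {a} g a≤ _  = subst (ℤ._≤ g []) (sym (ℤ.+-identityʳ a)) a≤
  sumℤ-≥′ (suc k) {a} {b} g a≤ b≤ = subst (ℤ._≤ sumℤ (suc k) g)
    (trans (regroup a b (+ (2 ℕ.^ k))) (cong (λ p → a ℤ.+ (p ℤ.- 1ℤ) ℤ.* b) (sym (ℤ.pos-* 2 (2 ℕ.^ k)))))
    (ℤ.+-mono-≤ (sumℤ-≥′ k (g ∘ (false ∷_)) a≤ (λ ne → b≤ (λ eq → ne (Vec.∷-injectiveʳ eq))))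
      (sumℤ-≥ k (g ∘ (true ∷_)) (λ c → b≤ {true ∷ c} (λ ()))))
    where
    regroup : ∀ a b p → a ℤ.+ (p ℤ.- 1ℤ) ℤ.* b ℤ.+ p ℤ.* b ≡ a ℤ.+ (+ 2 ℤ.* p ℤ.- 1ℤ) ℤ.* b
    regroup = ℤS.solve-∀

  -- 2^b times the indicator that T (β x) vanishes for all β in βs.
  filter : ∀ {b} → Vec C b → C → ℤ
  filter []       x = 1ℤ
  filter (β ∷ βs) x = (1ℤ ℤ.+ χ (β * x)) ℤ.* filter βs x

  Kills : ∀ {b} → C → Vec C b → Set
  Kills x = All (λ β → T (β * x) ≡ false)

  kills? : ∀ {b} x (βs : Vec C b) → Dec (Kills x βs)
  kills? x = all? (λ β → T (β * x) Bool.≟ false)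

  filter-≥0 : ∀ {b} (βs : Vec C b) x → 0ℤ ℤ.≤ filter βs x
  filter-≥0 []       x = +≤+ z≤n
  filter-≥0 (β ∷ βs) x with T (β * x)
  ... | false = 0≤* {+ 2} (+≤+ z≤n) (filter-≥0 βs x)
  ... | true  = ℤ.≤-refl

  filter-≤ : ∀ {b} (βs : Vec C b) x → filter βs x ℤ.≤ + (2 ℕ.^ b)
  filter-≤ [] x = ℤ.≤-refl
  filter-≤ {suc b} (β ∷ βs) x with T (β * x)
  ... | false = subst (+ 2 ℤ.* filter βs x ℤ.≤_) (sym (ℤ.pos-* 2 (2 ℕ.^ b))) (ℤ.*-monoˡ-≤-nonNeg (+ 2) (filter-≤ βs x))
  ... | true  = +≤+ z≤n

  filter-0 : ∀ {b} (βs : Vec C b) x → ¬ Kills x βs → filter βs x ≡ 0ℤ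
  filter-0 []       x ¬k = contradiction [] ¬k
  filter-0 (β ∷ βs) x ¬k with T (β * x) in eq
  ... | false = trans (cong (+ 2 ℤ.*_) (filter-0 βs x (λ k → ¬k (eq ∷ k)))) refl
  ... | true  = refl

  -- Multiplying out ∏ (1 + χ (β x)) gives one term per subset of `βs`, a product of characters that
  -- is χ at the subset sum.
  filter-expand : ∀ {b} (βs : Vec C b) x → filter βs x ≡ sumℤ b (λ c → χ (lc c βs * x))
  filter-expand []       x = sym (trans (cong χ (zeroˡ x)) (cong sign T-0))
  filter-expand {suc b} (β ∷ βs) x = begin
    (1ℤ ℤ.+ χ (β * x)) ℤ.* filter βs x           ≡⟨ ℤ.*-distribʳ-+ (filter βs x) 1ℤ (χ (β * x)) ⟩
    1ℤ ℤ.* filter βs x ℤ.+ χ (β * x) ℤ.* filter βs x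
      ≡⟨ cong₂ ℤ._+_ (trans (ℤ.*-identityˡ (filter βs x)) (filter-expand βs x))
           (trans (cong (ℤ._*_ (χ (β * x))) (filter-expand βs x)) (sym (sumℤ-* b (χ (β * x)) f))) ⟩
    sumℤ b f ℤ.+ sumℤ b (λ c → χ (β * x) ℤ.* f c)
      ≡⟨ cong (ℤ._+_ (sumℤ b f)) (sumℤ-cong b (λ c →
           trans (sym (χ-+ (β * x) (lc c βs * x))) (cong χ (sym (distribʳ x β (lc c βs)))))) ⟩
    sumℤ b f ℤ.+ sumℤ b (λ c → χ ((β + lc c βs) * x)) ∎
    where
    open ≡-Reasoning
    f : Vec Bool b → ℤ
    f c = χ (lc c βs * x)

  lc-replicate : ∀ {b} (βs : Vec C b) → lc (replicate b false) βs ≡ 0#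
  lc-replicate []       = refl
  lc-replicate (β ∷ βs) = lc-replicate βs

  K-𝟘 : K 𝟘 ≡ W
  K-𝟘 = ℤV.∑-cong {λ v → ind v ℤ.* χ (𝟘 ∙ v)} {ind} (λ v → trans
    (cong (ℤ._*_ (ind v)) (trans (cong χ (trans (cong₂ _+_ (zeroˡ (proj₁ v)) (zeroˡ (proj₂ v))) (+-identityʳ 0#))) (cong sign T-0)))
    (ℤ.*-identityʳ (ind v)))

  module _ {b} (βs : Vec C b) where

    filtered : ℤV.∑ (λ v → ind v ℤ.* (filter βs (proj₁ v) ℤ.* filter βs (proj₂ v))) ≡
      sumℤ b (λ c → sumℤ b (λ d → K (lc c βs , lc d βs)))
    filtered = begin
      ℤV.∑ (λ v → ind v ℤ.* (filter βs (proj₁ v) ℤ.* filter βs (proj₂ v)))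
        ≡⟨ ℤV.∑-cong expand ⟩
      ℤV.∑ (λ v → sumℤ b (λ c → sumℤ b (λ d → ind v ℤ.* χ ((lc c βs , lc d βs) ∙ v))))
        ≡⟨ ∑-sumℤ b (λ c v → sumℤ b (λ d → ind v ℤ.* χ ((lc c βs , lc d βs) ∙ v))) ⟩
      sumℤ b (λ c → ℤV.∑ (λ v → sumℤ b (λ d → ind v ℤ.* χ ((lc c βs , lc d βs) ∙ v))))
        ≡⟨ sumℤ-cong b (λ c → ∑-sumℤ b (λ d v → ind v ℤ.* χ ((lc c βs , lc d βs) ∙ v))) ⟩
      sumℤ b (λ c → sumℤ b (λ d → K (lc c βs , lc d βs))) ∎
      where
      open ≡-Reasoning
      expand : ∀ v → ind v ℤ.* (filter βs (proj₁ v) ℤ.* filter βs (proj₂ v)) ≡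
        sumℤ b (λ c → sumℤ b (λ d → ind v ℤ.* χ ((lc c βs , lc d βs) ∙ v)))
      expand v@(x , y) = begin
        ind v ℤ.* (filter βs x ℤ.* filter βs y)
          ≡⟨ cong (ind v ℤ.*_) (trans (cong₂ ℤ._*_ (filter-expand βs x) refl)
               (ℤ.*-comm (sumℤ b (λ c → χ (lc c βs * x))) (filter βs y))) ⟩
        ind v ℤ.* (filter βs y ℤ.* sumℤ b (λ c → χ (lc c βs * x)))
          ≡⟨ cong (ind v ℤ.*_) (sym (sumℤ-* b (filter βs y) (λ c → χ (lc c βs * x)))) ⟩
        ind v ℤ.* sumℤ b (λ c → filter βs y ℤ.* χ (lc c βs * x))
          ≡⟨ sym (sumℤ-* b (ind v) (λ c → filter βs y ℤ.* χ (lc c βs * x))) ⟩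
        sumℤ b (λ c → ind v ℤ.* (filter βs y ℤ.* χ (lc c βs * x)))
          ≡⟨ sumℤ-cong b inner ⟩
        sumℤ b (λ c → sumℤ b (λ d → ind v ℤ.* χ ((lc c βs , lc d βs) ∙ v))) ∎
        where
        inner : ∀ c → ind v ℤ.* (filter βs y ℤ.* χ (lc c βs * x)) ≡ sumℤ b (λ d → ind v ℤ.* χ ((lc c βs , lc d βs) ∙ v))
        inner c = begin
          ind v ℤ.* (filter βs y ℤ.* χ (lc c βs * x))
            ≡⟨ cong (ind v ℤ.*_) (trans (ℤ.*-comm (filter βs y) (χ (lc c βs * x)))
                 (trans (cong (χ (lc c βs * x) ℤ.*_) (filter-expand βs y))
                   (sym (sumℤ-* b (χ (lc c βs * x)) (λ d → χ (lc d βs * y)))))) ⟩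
          ind v ℤ.* sumℤ b (λ d → χ (lc c βs * x) ℤ.* χ (lc d βs * y))
            ≡⟨ sym (sumℤ-* b (ind v) (λ d → χ (lc c βs * x) ℤ.* χ (lc d βs * y))) ⟩
          sumℤ b (λ d → ind v ℤ.* (χ (lc c βs * x) ℤ.* χ (lc d βs * y)))
            ≡⟨ sumℤ-cong b (λ d → cong (ind v ℤ.*_) (sym (χ-+ (lc c βs * x) (lc d βs * y)))) ⟩
          sumℤ b (λ d → ind v ℤ.* χ ((lc c βs , lc d βs) ∙ v)) ∎

    D : ℕ
    D = 2 ℕ.^ b ℕ.* 2 ℕ.^ b

    -- Of the D = 4^b terms D K, the trivial one is D W and the other D - 1 are at least -W each,
    -- which leaves at least W.
    filtered-≥ : Good βs → 3 ℕ.* (D ℕ.* D ℕ.* (D ℕ.* D)) ℕ.< 2 ℕ.^ n →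
      W ℤ.≤ + D ℤ.* sumℤ b (λ c → sumℤ b (λ d → K (lc c βs , lc d βs)))
    filtered-≥ g small = subst₂ ℤ._≤_ (trans
      (cong (λ q → q ℤ.* W ℤ.+ (p ℤ.- 1ℤ) ℤ.* ℤ.- W ℤ.+ (p ℤ.- 1ℤ) ℤ.* (p ℤ.* ℤ.- W)) (ℤ.pos-* (2 ℕ.^ b) (2 ℕ.^ b))) (total p W))
      (trans (sumℤ-cong b (λ c → sumℤ-* b (+ D) (λ d → K (lc c βs , lc d βs)))) (sumℤ-* b (+ D) (λ c → sumℤ b (λ d → K (lc c βs , lc d βs)))))
      (sumℤ-≥′ b (λ c → sumℤ b (λ d → + D ℤ.* K (lc c βs , lc d βs)))
        (sumℤ-≥′ b (λ d → + D ℤ.* K (lc (replicate b false) βs , lc d βs))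
          (ℤ.≤-reflexive (sym (cong (+ D ℤ.*_) (trans (cong K (cong₂ _,_ (lc-replicate βs) (lc-replicate βs))) K-𝟘))))
          (λ {d} ne → K-≥ D small (λ eq → ne (good⇒indep g d (cong proj₂ eq)))))
        (λ {c} ne → sumℤ-≥ b (λ d → + D ℤ.* K (lc c βs , lc d βs))
          (λ d → K-≥ D small (λ eq → ne (good⇒indep g c (cong proj₁ eq))))))
      where
      p = + (2 ℕ.^ b)
      total : ∀ p w → p ℤ.* p ℤ.* w ℤ.+ (p ℤ.- 1ℤ) ℤ.* ℤ.- w ℤ.+ (p ℤ.- 1ℤ) ℤ.* (p ℤ.* ℤ.- w) ≡ w
      total = ℤS.solve-∀

    Solution : V → Set
    Solution v@(x , y) = Ω v × (x ≢ 0# × y ≢ 0# × x ≢ y) × Kills x βs × Kills y βs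

    solution? : ∀ v → Dec (Solution v)
    solution? v@(x , y) = Ω? v ×-dec (¬? (x ≟ 0#) ×-dec ¬? (y ≟ 0#) ×-dec ¬? (x ≟ y)) ×-dec kills? x βs ×-dec kills? y βs

    -- (1,0), (0,1) and (1,1) are the only points of the conic Ω with x y (x + y) = 0.
    solution : Good βs → 3 ℕ.* (D ℕ.* D ℕ.* (D ℕ.* D)) ℕ.< 2 ℕ.^ n → ∃ Solution
    solution g small with Finite.search isoV solution?
    ... | yes s = s
    ... | no none =
      -- Without a solution only the three trivial points can carry weight, at most D each, so 2ⁿ ≤
      -- W ≤ 3 D², against 3 D⁴ < 2ⁿ.
      contradiction (ℤ.drop‿+≤+ (subst (+ (2 ℕ.^ n) ℤ.≤_) (sym (ℤ.pos-* D (D ℕ.* 3))) (ℤ.≤-trans W-≥ (ℤ.≤-trans (filtered-≥ g small)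
        (subst₂ ℤ._≤_ (cong (+ D ℤ.*_) filtered) (cong (+ D ℤ.*_) (sym (ℤ.pos-* D 3))) (ℤ.*-monoˡ-≤-nonNeg (+ D) few))))))
        (ℕ.<⇒≱ (ℕ.≤-<-trans D*3*D≤ small))
      where
      e₁ e₂ e₃ : V
      e₁ = 1# , 0#
      e₂ = 0# , 1#
      e₃ = 1# , 1#
      trivial : V → ℤ
      trivial v = 1[ v ≟V e₁ ] ℤ.+ (1[ v ≟V e₂ ] ℤ.+ 1[ v ≟V e₃ ])
      trivial-≥0 : ∀ v → 0ℤ ℤ.≤ trivial v
      trivial-≥0 v = ℤ.+-mono-≤ (1[]-≥0 (v ≟V e₁)) (ℤ.+-mono-≤ (1[]-≥0 (v ≟V e₂)) (1[]-≥0 (v ≟V e₃)))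
      unit : ∀ {x} → x ² ≡ 1# → x ≡ 1#
      unit eq = ²-injective (trans eq (sym (*-identityˡ 1#)))
      trivial-≥1 : ∀ {x y} → Ω (x , y) → Dec (x ≡ 0#) → Dec (y ≡ 0#) → Dec (x ≡ y) →
        ¬ (x ≢ 0# × y ≢ 0# × x ≢ y) → 1ℤ ℤ.≤ trivial (x , y)
      trivial-≥1 _ (no p) (no q) (no r) ¬nt = contradiction (p , q , r) ¬nt
      trivial-≥1 {y = y} Nv (yes refl) _ _ _ = ℤ.+-mono-≤ (1[]-≥0 ((0# , y) ≟V e₁))
        (ℤ.+-mono-≤ (ℤ.≤-reflexive (sym (1[]-yes ((0# , y) ≟V e₂) (cong (0# ,_) (unit
          (trans (solve 1 (λ y → y :* y := con false :* con false :+ con false :* y :+ y :* y) refl y) Nv))))))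
          (1[]-≥0 ((0# , y) ≟V e₃)))
      trivial-≥1 {x} Nv (no _) (yes refl) _ _ = ℤ.+-mono-≤ (ℤ.≤-reflexive (sym (1[]-yes ((x , 0#) ≟V e₁)
          (cong (_, 0#) (unit (trans (solve 1 (λ x → x :* x := x :* x :+ x :* con false :+ con false :* con false) refl x) Nv))))))
        (ℤ.+-mono-≤ (1[]-≥0 ((x , 0#) ≟V e₂)) (1[]-≥0 ((x , 0#) ≟V e₃)))
      trivial-≥1 {x} Nv (no _) (no _) (yes refl) _ =
        ℤ.+-mono-≤ (1[]-≥0 ((x , x) ≟V e₁)) (ℤ.+-mono-≤ (1[]-≥0 ((x , x) ≟V e₂))
        (ℤ.≤-reflexive (sym (1[]-yes ((x , x) ≟V e₃) (cong₂ _,_ x≡1 x≡1)))))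
        where
        x≡1 : x ≡ 1#
        x≡1 = unit (trans (solve 1 (λ x → x :* x := x :* x :+ x :* x :+ x :* x) refl x) Nv)
      indicator-≤ : ∀ {A : Set} (d : Dec A) {i j} → 0ℤ ℤ.≤ j → (A → i ℤ.≤ j) → 1[ d ] ℤ.* i ℤ.≤ j
      indicator-≤ (yes p) {i} _ le = subst (ℤ._≤ _) (sym (ℤ.*-identityˡ i)) (le p)
      indicator-≤ (no _)  0≤j _  = 0≤j
      0≤D*trivial : ∀ v → 0ℤ ℤ.≤ + D ℤ.* trivial v
      0≤D*trivial v = 0≤* {+ D} (+≤+ z≤n) (trivial-≥0 v)
      survive : ∀ x y → Ω (x , y) → Dec (Kills x βs) → Dec (Kills y βs) →
        filter βs x ℤ.* filter βs y ℤ.≤ + D ℤ.* trivial (x , y)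
      survive x y Nv (no ¬k) _ = subst (ℤ._≤ + D ℤ.* trivial (x , y)) (sym (cong (ℤ._* filter βs y) (filter-0 βs x ¬k)))
        (0≤D*trivial (x , y))
      survive x y Nv (yes _) (no ¬k) = subst (ℤ._≤ + D ℤ.* trivial (x , y))
        (sym (trans (cong (ℤ._*_ (filter βs x)) (filter-0 βs y ¬k)) (ℤ.*-zeroʳ (filter βs x))))
        (0≤D*trivial (x , y))
      survive x y Nv (yes k) (yes k′) = begin
        filter βs x ℤ.* filter βs y            ≤⟨ *-monoˡ (filter-≥0 βs x) (filter-≤ βs y) ⟩
        filter βs x ℤ.* + (2 ℕ.^ b)            ≤⟨ ℤ.*-monoʳ-≤-nonNeg (+ (2 ℕ.^ b)) (filter-≤ βs x) ⟩
        + (2 ℕ.^ b) ℤ.* + (2 ℕ.^ b)            ≡⟨ ℤ.pos-* (2 ℕ.^ b) (2 ℕ.^ b) ⟨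
        + D                                   ≡⟨ ℤ.*-identityʳ (+ D) ⟨
        + D ℤ.* 1ℤ                            ≤⟨ ℤ.*-monoˡ-≤-nonNeg (+ D)
          (trivial-≥1 Nv (x ≟ 0#) (y ≟ 0#) (x ≟ y) (λ nt → none ((x , y) , Nv , nt , k , k′))) ⟩
        + D ℤ.* trivial (x , y)               ∎
        where open ℤ.≤-Reasoning
      bound : ∀ v → ind v ℤ.* (filter βs (proj₁ v) ℤ.* filter βs (proj₂ v)) ℤ.≤ + D ℤ.* trivial v
      bound v@(x , y) = indicator-≤ (Ω? v) (0≤D*trivial v) (λ Nv → survive x y Nv (kills? x βs) (kills? y βs))
      few : ℤV.∑ (λ v → ind v ℤ.* (filter βs (proj₁ v) ℤ.* filter βs (proj₂ v))) ℤ.≤ + D ℤ.* + 3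
      few = ℤ.≤-trans (ℤV.∑-mono bound) (ℤ.≤-reflexive (trans (ℤV.∑-* (+ D) trivial) (cong (+ D ℤ.*_)
        (trans (ℤV.∑-∙ (λ v → 1[ v ≟V e₁ ]) (λ v → 1[ v ≟V e₂ ] ℤ.+ 1[ v ≟V e₃ ]))
          (cong₂ ℤ._+_ (∑-indicator e₁) (trans (ℤV.∑-∙ (λ v → 1[ v ≟V e₂ ]) (λ v → 1[ v ≟V e₃ ]))
            (cong₂ ℤ._+_ (∑-indicator e₂) (∑-indicator e₃))))))))
      D*3*D≤ : D ℕ.* (D ℕ.* 3) ℕ.≤ 3 ℕ.* (D ℕ.* D ℕ.* (D ℕ.* D))
      D*3*D≤ = begin
        D ℕ.* (D ℕ.* 3)                     ≡⟨ trans (sym (ℕ.*-assoc D D 3)) (ℕ.*-comm (D ℕ.* D) 3) ⟩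
        3 ℕ.* (D ℕ.* D)                     ≤⟨ ℕ.*-monoʳ-≤ 3 (ℕ.m≤m*n (D ℕ.* D) (D ℕ.* D)) ⟩
        3 ℕ.* (D ℕ.* D ℕ.* (D ℕ.* D))       ∎
        where
        open ℕ.≤-Reasoning
        instance
          D²≢0 : ℕ.NonZero (D ℕ.* D)
          D²≢0 = ℕ.>-nonZero (ℕ.*-mono-< {0} {D} {0} {D} 0<D 0<D)
            where
            0<D : 0 ℕ.< D
            0<D = ℕ.*-mono-< {0} {2 ℕ.^ b} {0} {2 ℕ.^ b} (ℕ.m^n>0 2 b) (ℕ.m^n>0 2 b)

-- Lifting a space over a norm-one plane

module Dimensions {n : ℕ} (F : GF2^ n) (odd : n ℕ.% 2 ≡ 1) where

  open GF2^ F renaming (Carrier to C)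
  open Field F
  open OddField F odd
  open CharacterSums F odd using (D; solution)
  open Algebra.Properties.Semiring.Exp (CommutativeRing.semiring commutativeRing) using (_^_)
  open Solver using (_:^_)

  -- For A = ⟨a₁, a₂⟩ the norm condition says S A = 1 / P A. If T (β aᵢ) = 0 then q² β² lies in im (L A),
  -- where q = P A, so a space B of such β with S B = 1 lifts to E ⊇ A with S E = 1 / q + q (1 / q²) = 0.
  module Plane {a₁ a₂ : C} (a₁≢0 : a₁ ≢ 0#) (a₂≢0 : a₂ ≢ 0#) (a₁≢a₂ : a₁ ≢ a₂)
    (norm : a₁ ² + a₁ * a₂ + a₂ ² ≡ 1#) where

    A : Vec C 2
    A = a₂ ∷ a₁ ∷ []

    c : C
    c = a₂ * (a₂ + a₁)

    c≢0 : c ≢ 0#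
    c≢0 = *-≢0 a₂≢0 (+-≢0 (a₁≢a₂ ∘ sym))

    good : Good A
    good = c≢0 , a₁≢0 , tt

    q : C
    q = P A

    q≡ : q ≡ a₁ * c
    q≡ = cong (_* c) (*-identityˡ a₁)

    q≢0 : q ≢ 0#
    q≢0 = P-≢0 good

    S-A : S A ≡ q ⁻¹
    S-A = begin
      0# + 1# * a₁ ⁻¹ + 1# * a₁ * c ⁻¹
        ≡⟨ cong₂ _+_ (trans (+-identityˡ _) (*-identityˡ _)) (cong (_* c ⁻¹) (*-identityˡ a₁)) ⟩
      i + a₁ * j
        ≡⟨ solve 3 (λ a i j → i :+ a :* j := i :* con true :+ con true :* (a :* j)) refl a₁ i j ⟩
      i * 1# + 1# * (a₁ * j)
        ≡⟨ cong₂ (λ x y → i * x + y * (a₁ * j)) (⁻¹-inverse c c≢0) (⁻¹-inverse a₁ a₁≢0) ⟨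
      i * (c * j) + a₁ * i * (a₁ * j)
        ≡⟨ solve 4 (λ a b i j → i :* ((b :* (b :+ a)) :* j) :+ a :* i :* (a :* j) :=
                                                     (a :* a :+ a :* b :+ b :* b) :* (i :* j)) refl a₁ a₂ i j ⟩
      (a₁ ² + a₁ * a₂ + a₂ ²) * (i * j)         ≡⟨ trans (cong (_* (i * j)) norm) (*-identityˡ _) ⟩
      i * j                                     ≡⟨ ⁻¹-distrib-* a₁ c ⟨
      (a₁ * c) ⁻¹                               ≡⟨ cong _⁻¹ q≡ ⟨
      q ⁻¹                                      ∎
      where
      open ≡-Reasoning
      i = a₁ ⁻¹
      j = c ⁻¹

    preimage : ∀ {β} → T (β * a₁) ≡ false → T (β * a₂) ≡ false → ∃ λ x → L A x ≡ q ² * β ²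
    -- `L A` is a composite of two Artin-Schreier maps up to scaling, inverted from the outside: `η`
    -- exists by t₁, then `ξ` solves an equation whose trace condition reduces to t₂.
    preimage {β} t₁ t₂ with T-root {(β * a₁) ²} (trans (T-² _) t₁)
    ... | η , η-spec with T-root {(ρ ² + ρ) * η} T-ρη
      where
      ρ = a₂ * a₁ ⁻¹
      ρa₁ : ρ * a₁ ≡ a₂
      ρa₁ = trans (*-assoc _ _ _) (trans (cong (a₂ *_) (⁻¹-inverseˡ a₁≢0)) (*-identityʳ a₂))
      T-ρη : T ((ρ ² + ρ) * η) ≡ false
      T-ρη = begin
        T ((ρ ² + ρ) * η)                 ≡⟨ cong T (distribʳ η (ρ ²) ρ) ⟩
        T (ρ ² * η + ρ * η)               ≡⟨ T-+ (ρ ² * η) (ρ * η) ⟩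
        T (ρ ² * η) xor T (ρ * η)         ≡⟨ cong (T (ρ ² * η) xor_) (T-² (ρ * η)) ⟨
        T (ρ ² * η) xor T ((ρ * η) ²)     ≡⟨ T-+ (ρ ² * η) ((ρ * η) ²) ⟨
        T (ρ ² * η + (ρ * η) ²)
          ≡⟨ cong T (solve 2 (λ r e → (r :* r) :* e :+ (r :* e) :* (r :* e) := (r :* r) :* (e :* e :+ e)) refl ρ η) ⟩
        T (ρ ² * (η ² + η))               ≡⟨ cong (λ z → T (ρ ² * z)) η-spec ⟩
        T (ρ ² * (β * a₁) ²)
          ≡⟨ cong T (solve 3 (λ r b a → (r :* r) :* ((b :* a) :* (b :* a)) := (b :* (r :* a)) :* (b :* (r :* a))) refl ρ β a₁) ⟩
        T ((β * (ρ * a₁)) ²)              ≡⟨ T-² _ ⟩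
        T (β * (ρ * a₁))                  ≡⟨ cong (λ z → T (β * z)) ρa₁ ⟩
        T (β * a₂)                        ≡⟨ t₂ ⟩
        false                             ∎
        where open ≡-Reasoning
    ... | ξ , ξ-spec = a₁ * ξ , (begin
      y * (y + c)                                     ≡⟨ cong (λ z → z * (z + c)) y≡ ⟩
      c * η * (c * η + c)
        ≡⟨ solve 2 (λ c e → (c :* e) :* (c :* e :+ c) := (c :* c) :* (e :* e :+ e)) refl c η ⟩
      c ² * (η ² + η)                                 ≡⟨ cong (c ² *_) η-spec ⟩
      c ² * (β * a₁) ²
        ≡⟨ solve 3 (λ c b a → (c :* c) :* ((b :* a) :* (b :* a)) := ((a :* c) :* (a :* c)) :* (b :* b)) refl c β a₁ ⟩
      (a₁ * c) ² * β ²                                ≡⟨ cong (λ z → z ² * β ²) q≡ ⟨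
      q ² * β ²                                       ∎)
      where
      open ≡-Reasoning
      ρ = a₂ * a₁ ⁻¹
      y = L (a₁ ∷ []) (a₁ * ξ)
      ρa₁ : ρ * a₁ ≡ a₂
      ρa₁ = trans (*-assoc _ _ _) (trans (cong (a₂ *_) (⁻¹-inverseˡ a₁≢0)) (*-identityʳ a₂))
      y≡ : y ≡ c * η
      y≡ = begin
        a₁ * ξ * (a₁ * ξ + a₁)
          ≡⟨ solve 2 (λ a x → (a :* x) :* (a :* x :+ a) := (a :* a) :* (x :* x :+ x)) refl a₁ ξ ⟩
        a₁ ² * (ξ ² + ξ)                   ≡⟨ cong (a₁ ² *_) ξ-spec ⟩
        a₁ ² * ((ρ ² + ρ) * η)
          ≡⟨ solve 3 (λ a r e → (a :* a) :* ((r :* r :+ r) :* e) := ((r :* a) :* (r :* a :+ a)) :* e) refl a₁ ρ η ⟩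
        ρ * a₁ * (ρ * a₁ + a₁) * η         ≡⟨ cong (λ z → z * (z + a₁) * η) ρa₁ ⟩
        c * η                              ∎

    preimages : ∀ {b} {βs : Vec C b} → All (λ β → T (β * a₁) ≡ false) βs → All (λ β → T (β * a₂) ≡ false) βs →
      ∃ λ xs → map (L A) xs ≡ map (q ² *_) (map _² βs)
    preimages []         []         = [] , refl
    preimages (t₁ ∷ ts₁) (t₂ ∷ ts₂) =
      let x , e   = preimage t₁ t₂
          xs , es = preimages ts₁ ts₂
      in x ∷ xs , cong₂ _∷_ e es

    plane-zeroSum : ∀ {b} {βs : Vec C b} → Good βs → S βs ≡ 1# →
      All (λ β → T (β * a₁) ≡ false) βs → All (λ β → T (β * a₂) ≡ false) βs → ZeroSum (b ℕ.+ 2)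
    plane-zeroSum {βs = βs} g s ts₁ ts₂ with preimages ts₁ ts₂
    ... | xs , e = xs ++ A , Good-++ xs good (subst Good (sym e) (Good-scale q²≢0 (Good-² g))) , (begin
      S (xs ++ A)                                       ≡⟨ S-++ xs A ⟩
      S A + q * S (map (L A) xs)                        ≡⟨ cong (λ z → S A + q * S z) e ⟩
      S A + q * S (map (q ² *_) (map _² βs))
        ≡⟨ cong (λ z → S A + q * z) (S-scale q²≢0 (map _² βs)) ⟩
      S A + q * ((q ²) ⁻¹ * S (map _² βs))
        ≡⟨ cong₂ (λ z w → S A + q * (z * w)) (⁻¹-distrib-* q q) (trans (S-² βs) (trans (cong _² s) (*-identityˡ 1#))) ⟩
      S A + q * (q ⁻¹ * q ⁻¹ * 1#)
        ≡⟨ cong₂ _+_ S-A (trans (solve 2 (λ q i → q :* (i :* i :* con true) := (q :* i) :* i) refl q (q ⁻¹))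
                                                             (trans (cong (_* q ⁻¹) (⁻¹-inverse q q≢0)) (*-identityˡ _))) ⟩
      q ⁻¹ + q ⁻¹                                       ≡⟨ x+x≡0 _ ⟩
      0#                                                ∎)
      where
      open ≡-Reasoning
      q²≢0 : q ² ≢ 0#
      q²≢0 = *-≢0 q≢0 q≢0

  normalise : ∀ {b} {vs : Vec C b} → Good vs → S vs ≢ 0# → ∃ λ βs → Good {b} βs × S βs ≡ 1#
  normalise {vs = vs} g s≢0 = map (S vs *_) vs , Good-scale s≢0 g , trans (S-scale s≢0 vs) (⁻¹-inverseˡ s≢0)

  -- At most one value of the last basis vector, modulo the others, makes the sum vanish.
  nonzeroSum : ∀ b → suc b ℕ.< n → ∃ λ (vs : Vec C (suc b)) → Good vs × S vs ≢ 0#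
  nonzeroSum b b<n with complement {vs = []} tt b (ℕ.≤-trans (ℕ.≤-reflexive (ℕ.+-identityʳ b)) (ℕ.<⇒≤ (ℕ.<⇒≤ b<n)))
  ... | vs′ , g′ = go (ℕ.+-identityʳ b) (vs′ ++ []) g′
    where
    go : ∀ {m} → m ≡ b → (vs : Vec C m) → Good vs → ∃ λ (vs : Vec C (suc b)) → Good vs × S vs ≢ 0#
    go refl vs g with extend vs (ℕ.<⇒≤ b<n)
    ... | v , v∉ with S (v ∷ vs) ≟ 0#
    ...   | no s≢0 = v ∷ vs , (v∉ , g) , s≢0
    ...   | yes s≡0 with extend (v ∷ vs) b<n
    ...     | w , w∉ = w ∷ vs , (w∉vs , g) , λ s′≡0 → w∉ (trans (cong (L vs w *_) (≡-+0 (same s′≡0))) (zeroʳ _))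
      where
      w∉vs : L vs w ≢ 0#
      w∉vs eq = w∉ (L-tail v vs eq)
      same : S (w ∷ vs) ≡ 0# → L vs w ≡ L vs v
      same s′≡0 = ⁻¹-injective w∉vs v∉ (*-cancelˡ (P-≢0 g) (+-cancelˡ (S vs) (trans s′≡0 (sym s≡0))))
        where
        ⁻¹-injective : ∀ {x y} → x ≢ 0# → y ≢ 0# → x ⁻¹ ≡ y ⁻¹ → x ≡ y
        ⁻¹-injective {x} {y} x≢0 y≢0 eq =
          trans (sym (⁻¹-unique (trans (*-comm _ _) (trans (cong (x *_) (sym eq)) (⁻¹-inverse x x≢0)))))
          (⁻¹-unique (⁻¹-inverseˡ y≢0))

  -- Shifting by spaces over the subfield

  module _ (l : ℕ) where

    Fixed-* : ∀ {x y} → Fixed l x → Fixed l y → Fixed l (x * y)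
    Fixed-* {x} {y} p q = trans (frob-* l x y) (cong₂ _*_ p q)

    Fixed-⁻¹ : ∀ {x} → Fixed l x → Fixed l (x ⁻¹)
    Fixed-⁻¹ {x} p = trans (frob-⁻¹ l x) (cong _⁻¹ p)

    Fixed-lc : ∀ {k} {vs : Vec C k} → All (Fixed l) vs → ∀ c → Fixed l (lc c vs)
    Fixed-lc []       []          = frob-0 l
    Fixed-lc (p ∷ ps) (true ∷ c)  = trans (frob-+ l _ _) (cong₂ _+_ p (Fixed-lc ps c))
    Fixed-lc (p ∷ ps) (false ∷ c) = Fixed-lc ps c

  lc-map : ∀ {k j} (ws : Vec C j) y (us : Vec C k) c → lc c (map (L ws) (map (y *_) us)) ≡ L ws (y * lc c us)
  lc-map ws y []       []          = sym (trans (cong (L ws) (zeroʳ y)) (L-0 ws))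
  lc-map ws y (u ∷ us) (true ∷ c)  = trans (cong (L ws (y * u) +_) (lc-map ws y us c))
    (trans (sym (L-+ ws (y * u) (y * lc c us))) (cong (L ws) (sym (distribˡ y u (lc c us)))))
  lc-map ws y (u ∷ us) (false ∷ c) = lc-map ws y us c

  fixed-nontrivial : ∀ {l k} → Basis (Fixed l) (suc (suc k)) → ∃ λ a → Fixed l a × a ≢ 0# × a ≢ 1#
  fixed-nontrivial (basis (x ∷ y ∷ zs) (x∉ , y∉ , _) (p ∷ q ∷ _) _) with x ≟ 1#
  ... | no x≢1 = x , p , (λ { refl → x∉ (L-0 (y ∷ zs)) }) , x≢1
  ... | yes refl = y , q , (λ { refl → y∉ (L-0 zs) }) , λ { refl → x∉ (L-head y zs) }

  module Shift (l j : ℕ) (n≡ : suc j ℕ.* suc (suc l) ≡ n) {r} {vs : Vec C r} (g : Good vs) where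

    q : ℕ
    q = suc (suc l)

    open Basis (subfield (suc l) j n≡) renaming (vectors to κ; good to κ-good; inside to κ-fixed; spanning to κ-span)

    record SubfieldSpace (d : ℕ) : Set where
      constructor space
      field
        vectors  : Vec C (d ℕ.* q)
        good     : Good vectors
        stable   : ∀ {a} → Fixed q a → Stable a vectors
        preimage : ∃ λ us → map (L vs) us ≡ vectors

    -- im (L vs) contains an F_{2^q}-subspace of each dimension d ≤ n / q - r.
    subfieldSpace : ∀ d → d ℕ.+ r ℕ.≤ suc j → SubfieldSpace d
    subfieldSpace zero    _  = space [] tt (λ {a} _ x z → trans (cong (a *_) z) (zeroʳ a)) ([] , refl)
    subfieldSpace (suc d) le with subfieldSpace d (ℕ.<⇒≤ le)
    -- A scalar y outside the span of `ws` for which y times the subfield lies in im `L vs`: the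
    -- conditions cost d q + q r < n dimensions.
    ... | space ws h st (us , us-image) with collide (cosets vs κ) ws size
      where
      size : d ℕ.* q ℕ.+ q ℕ.* r ℕ.< n
      size = subst₂ ℕ._<_ (trans (ℕ.*-distribʳ-+ q d r) (cong (d ℕ.* q ℕ.+_) (ℕ.*-comm r q))) n≡ (ℕ.*-monoˡ-< q le)
    ... | x , x′ , same , y∉ with cosets-image g κ same
    ...   | xs , xs-image = space (map (y *_) κ ++ ws) (Good-++ (map (y *_) κ) h (indep⇒good independent)) stable
              (xs ++ us , trans (Vec.map-++ (L vs) xs us) (cong₂ _++_ xs-image us-image))
      where
      y = x + x′
      new = map (L ws) (map (y *_) κ)
      -- A relation puts y f into the span of `ws` for some f in the subfield; if f ≠ 0, stability
      -- under 1 / f puts y there too.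
      independent : LinIndep F new
      independent c eq with lc c κ ≟ 0#
      ... | yes z = good⇒indep κ-good c z
      ... | no ne =
        contradiction (trans (cong (L ws) (sym (trans (cong (lc c κ ⁻¹ *_) (*-comm y _)) (⁻¹-*-cancel y ne))))
                      (st (Fixed-⁻¹ q (Fixed-lc q κ-fixed c)) (y * lc c κ) (trans (sym (lc-map ws y κ c)) eq))) y∉
      -- Write z as w + y k with w in the span of `ws` and k in the subfield. Then a z = a w + y (a
      -- k), and a k is again in the subfield.
      stable : ∀ {a} → Fixed q a → Stable a (map (y *_) κ ++ ws)
      stable {a} p z eq with coordinates new (trans (sym (L-++ (map (y *_) κ) ws z)) eq)
      ... | c , e with coordinates κ (κ-span (Fixed-* q p (Fixed-lc q κ-fixed c)))
      ...   | c′ , e′ = trans (L-++ (map (y *_) κ) ws (a * z)) (trans (cong (L new) (begin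
        L ws (a * z)                   ≡⟨ +-≡0 (trans (sym (L-+ ws (a * z) (y * (a * k)))) (trans (cong (L ws)
                                            (solve 4 (λ a z y k → a :* z :+ y :* (a :* k) := a :* (z :+ y :* k)) refl a z y k))
                                            (st p (z + y * k) (trans (L-+ ws z (y * k)) (≡-+0 (trans e (lc-map ws y κ c))))))) ⟩
        L ws (y * (a * k))             ≡⟨ cong (λ b → L ws (y * b)) e′ ⟩
        L ws (y * lc c′ κ)             ≡⟨ lc-map ws y κ c′ ⟨
        lc c′ new                      ∎)) (L-lincomb c′ new))
        where
        open ≡-Reasoning
        k = lc c κ

    -- The added image space is stable under a subfield scalar other than 0 and 1, so its sum of
    -- inverses vanishes.
    zeroSum-shift : S vs ≡ 0# → ∀ d → d ℕ.+ r ℕ.≤ suc j → ZeroSum (d ℕ.* q ℕ.+ r)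
    zeroSum-shift s d le with subfieldSpace d le | fixed-nontrivial {suc (suc l)} (subfield (suc l) j n≡)
    ... | space ws h st (us , us-image) | a , p , a≢0 , a≢1 =
      zeroSum-++ {us = us} g (subst Good (sym us-image) h) s
        (trans (cong S us-image) (stable⇒S≡0 h a≢0 a≢1 (st p) (st (Fixed-⁻¹ q p))))

  -- Dimension 5 from explicit elements when n = 21

  -- (a³ + a + 1) ((a + 1)³ + (a + 1) + 1) a (a + 1) = a⁸ + a
  cubic-root : Basis (Fixed 3) 3 → ∃ λ a → a * a ² + a + 1# ≡ 0#
  cubic-root B with fixed-nontrivial {3} B
  ... | a , a⁸≡a , a≢0 , a≢1 = decide (zero-product (*-cancelˡ (*-≢0 a≢0 (+-≢0 a≢1)) (trans factor (sym (zeroʳ _)))))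
    where
    p : C → C
    p x = x * x ² + x + 1#
    factor : a * (a + 1#) * (p a * p (a + 1#)) ≡ 0#
    factor = trans (solve 1 (λ a → let b = a :+ con true in
        (a :* (a :+ con true)) :* ((a :* (a :* a) :+ a :+ con true) :* (b :* (b :* b) :+ b :+ con true)) :=
        (((a :* a) :* (a :* a)) :* ((a :* a) :* (a :* a))) :+ a) refl a) (≡-+0 a⁸≡a)
    decide : p a ≡ 0# ⊎ p (a + 1#) ≡ 0# → ∃ λ a → p a ≡ 0#
    decide (inj₁ z) = a , z
    decide (inj₂ z) = a + 1# , z

  -- (φ³ + φ + 1) (φ⁴ + φ² + φ + 1) = φ⁷ + 1 for the Frobenius φ.
  φ⁴+φ²+φ+1 : Vec C 4
  φ⁴+φ²+φ+1 = 1# ∷ 1# ∷ 1# ∷ 0# ∷ []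

  septic-root : Basis (Fixed 7) 7 → ∃ λ b → b ≢ 0# × frob 3 b ≡ b ² + b
  septic-root (basis (_ ∷ _ ∷ ks) (_ , _ , g) (_ ∷ _ ∷ ps) _) with search (λ y → (frob 7 y ≟ y) ×-dec ¬? (additive φ⁴+φ²+φ+1 y ≟ 0#))
  -- Dropping two basis vectors leaves five, one more than an additive polynomial of degree 2⁴ can
  -- have as independent roots.
  ... | no none = contradiction (All.map (λ {y} p → vanish y p) ps) (additive-roots φ⁴+φ²+φ+1 ks g)
    where
    vanish : ∀ y → Fixed 7 y → additive φ⁴+φ²+φ+1 y ≡ 0#
    vanish y p with additive φ⁴+φ²+φ+1 y ≟ 0#
    ... | yes z = z
    ... | no ne = contradiction (y , p , ne) none
  ... | yes (y , p , ne) = b , ne , (begin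
      frob 3 b                                       ≡⟨ cong (frob 3) b≡ ⟩
      frob 3 (y + frob 1 y + frob 2 y + frob 4 y)    ≡⟨ split 3 ⟩
      frob 3 y + frob 4 y + frob 5 y + frob 7 y      ≡⟨ cong (frob 3 y + frob 4 y + frob 5 y +_) p ⟩
      frob 3 y + frob 4 y + frob 5 y + y
        ≡⟨ solve 6 (λ y₀ y₁ y₂ y₃ y₄ y₅ → y₃ :+ y₄ :+ y₅ :+ y₀ := (y₁ :+ y₂ :+ y₃ :+ y₅) :+ (y₀ :+ y₁ :+ y₂ :+ y₄))
             refl y (frob 1 y) (frob 2 y) (frob 3 y) (frob 4 y) (frob 5 y) ⟩
      frob 1 y + frob 2 y + frob 3 y + frob 5 y + (y + frob 1 y + frob 2 y + frob 4 y)
        ≡⟨ cong₂ _+_ (sym (split 1)) refl ⟩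
      (y + frob 1 y + frob 2 y + frob 4 y) ² + (y + frob 1 y + frob 2 y + frob 4 y)
        ≡⟨ cong (λ z → z ² + z) b≡ ⟨
      b ² + b                                        ∎)
    where
    open ≡-Reasoning
    b = additive φ⁴+φ²+φ+1 y
    b≡ : b ≡ y + frob 1 y + frob 2 y + frob 4 y
    b≡ = solve 5 (λ y y₁ y₂ y₃ y₄ → con true :* y :+ (con true :* y₁ :+ (con true :* y₂ :+ (con false :* y₃ :+ y₄))) :=
      y :+ y₁ :+ y₂ :+ y₄) refl y (frob 1 y) (frob 2 y) (frob 3 y) (frob 4 y)
    split : ∀ k → frob k (y + frob 1 y + frob 2 y + frob 4 y) ≡ frob k y + frob k (frob 1 y) + frob k (frob 2 y) + frob k (frob 4 y)
    split k =
      trans (frob-+ k _ _) (cong (_+ frob k (frob 4 y)) (trans (frob-+ k _ _) (cong (_+ frob k (frob 2 y)) (frob-+ k _ _))))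

  -- Frobenius invariance gives T (b a) = T (b⁸ a⁸) = T (b² a) + T (b a).
  T-vanish : ∀ a b → frob 3 a ≡ a → frob 3 b ≡ b ² + b → T (b ² * a) ≡ false
  T-vanish a b a⁸≡a b⁸≡ = cancel _ (T (b * a)) (begin
    T (b ² * a) xor T (b * a)       ≡⟨ T-+ (b ² * a) (b * a) ⟨
    T (b ² * a + b * a)             ≡⟨ cong T (distribʳ a (b ²) b) ⟨
    T ((b ² + b) * a)               ≡⟨ cong₂ (λ x y → T (x * y)) b⁸≡ a⁸≡a ⟨
    T (frob 3 b * frob 3 a)         ≡⟨ cong T (frob-* 3 b a) ⟨
    T (frob 3 (b * a))
      ≡⟨ trans (T-² (frob 2 (b * a))) (trans (T-² (frob 1 (b * a))) (T-² (b * a))) ⟩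
    T (b * a)                       ∎)
    where
    open ≡-Reasoning
    cancel : ∀ s t → s xor t ≡ t → s ≡ false
    cancel false t     _ = refl
    cancel true  false ()
    cancel true  true  ()

  T-vanish³ : ∀ a b → frob 3 a ≡ a → frob 3 b ≡ b ² + b → All (λ β → T (β * a) ≡ false) (b ² ² ∷ b ² ∷ b ∷ [])
  T-vanish³ a b a⁸≡a b⁸≡ = T-vanish a (b ²) a⁸≡a (b⁸≡² b b⁸≡) ∷ T-vanish a b a⁸≡a b⁸≡ ∷ low ∷ []
    where
    open ≡-Reasoning
    b⁸≡² : ∀ b → frob 3 b ≡ b ² + b → frob 3 (b ²) ≡ (b ²) ² + b ²
    b⁸≡² b eq = trans (cong _² eq) (²-+ (b ²) b)
    -- Here b = b⁸ + b², and `T-vanish` covers both b⁸ a and b² a.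
    low : T (b * a) ≡ false
    low = begin
      T (b * a)                        ≡⟨ cong (_xor T (b * a)) (T-vanish a b a⁸≡a b⁸≡) ⟨
      T (b ² * a) xor T (b * a)        ≡⟨ T-+ (b ² * a) (b * a) ⟨
      T (b ² * a + b * a)              ≡⟨ cong T (distribʳ a (b ²) b) ⟨
      T ((b ² + b) * a)                ≡⟨ cong (λ z → T (z * a)) b⁸≡ ⟨
      T (frob 3 b * a)                 ≡⟨ T-vanish a (b ² ²) a⁸≡a (b⁸≡² (b ²) (b⁸≡² b b⁸≡)) ⟩
      false                            ∎

  module Trinomial {b : C} (b≢0 : b ≢ 0#) (b⁸≡ : frob 3 b ≡ b ² + b) where

    B : Vec C 3
    B = b ² ² ∷ b ² ∷ b ∷ []

    c₁ c₂ : C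
    c₁ = L (b ∷ []) (b ²)
    c₂ = L (b ² ∷ b ∷ []) (b ² ²)

    -- b P B reduces to b modulo b⁸ + b² + b.
    P≡1 : b * c₁ * c₂ ≡ 1#
    P≡1 = *-cancelˡ b≢0 (trans (solve 1 (λ b →
        let c = (b :* b) :* (b :* b :+ b)
            d = (b :* b) :* (b :* b)
            y = d :* (d :+ b)
        in b :* (b :* c :* (y :* (y :+ c))) := b :* con true :+ (d :* d :+ (b :* b :+ b)) :*
           (con true :+ b :+ b :^ 2 :+ b :^ 3 :+ b :^ 4 :+ b :^ 5 :+ b :^ 6 :+ b :^ 8 :+ b :^ 10 :+ b :^ 13 :+ b :^ 14)) refl b)
      (trans (cong (λ z → b * 1# + z * (1# + b + b ^ 2 + b ^ 3 + b ^ 4 + b ^ 5 + b ^ 6 + b ^ 8 + b ^ 10 + b ^ 13 + b ^ 14)) (≡-+0 b⁸≡))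
        (trans (cong (b * 1# +_) (zeroˡ _)) (+-identityʳ _))))

    -- Given `P≡1`, the inverses in S B are complementary products, so the left side is S B. The
    -- long factor in the identity is the quotient on division by b⁸ + b² + b.
    N≡1 : c₁ * c₂ + b * (b * c₂) + b * c₁ * (b * c₁) ≡ 1#
    N≡1 = *-cancelˡ b≢0 (trans (solve 1 (λ b →
        let c = (b :* b) :* (b :* b :+ b)
            d = (b :* b) :* (b :* b)
            y = d :* (d :+ b)
            e = y :* (y :+ c)
        in b :* (c :* e :+ b :* (b :* e) :+ b :* c :* (b :* c)) := b :* con true :+ (d :* d :+ (b :* b :+ b)) :*
           (con true :+ b :+ b :^ 2 :+ b :^ 3 :+ b :^ 4 :+ b :^ 5 :+ b :^ 6 :+ b :^ 9 :+ b :^ 11 :+ b :^ 12 :+ b :^ 13)) refl b)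
      (trans (cong (λ z → b * 1# + z * (1# + b + b ^ 2 + b ^ 3 + b ^ 4 + b ^ 5 + b ^ 6 + b ^ 9 + b ^ 11 + b ^ 12 + b ^ 13)) (≡-+0 b⁸≡))
        (trans (cong (b * 1# +_) (zeroˡ _)) (+-identityʳ _))))

    good : Good B
    good = (λ z → 0≢1 (trans (sym (trans (cong (b * c₁ *_) z) (zeroʳ _))) P≡1)) ,
           (λ z → 0≢1 (trans (sym (trans (cong (λ c → b * c * c₂) z) (trans (cong (_* c₂) (zeroʳ b)) (zeroˡ c₂)))) P≡1)) ,
           b≢0 , tt

    S≡1 : S B ≡ 1#
    S≡1 = begin
      0# + 1# * b ⁻¹ + 1# * b * c₁ ⁻¹ + 1# * b * c₁ * c₂ ⁻¹
        ≡⟨ cong₂ _+_ (cong₂ (λ x y → 0# + 1# * x + 1# * b * y)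
             (⁻¹-unique (trans (sym (*-assoc b c₁ c₂)) P≡1))
             (⁻¹-unique (trans (solve 3 (λ b c d → c :* (b :* d) := b :* c :* d) refl b c₁ c₂) P≡1)))
           (cong (1# * b * c₁ *_) (⁻¹-unique (trans (*-comm c₂ (b * c₁)) P≡1))) ⟩
      0# + 1# * (c₁ * c₂) + 1# * b * (b * c₂) + 1# * b * c₁ * (b * c₁)
        ≡⟨ solve 3 (λ b c d → con false :+ con true :* (c :* d) :+ con true :* b :* (b :* d) :+ con true :* b :* c :* (b :* c) :=
             c :* d :+ b :* (b :* d) :+ b :* c :* (b :* c)) refl b c₁ c₂ ⟩
      c₁ * c₂ + b * (b * c₂) + b * c₁ * (b * c₁)
        ≡⟨ N≡1 ⟩
      1# ∎
      where open ≡-Reasoning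

  -- The plane is spanned by a and a² with a³ = a + 1, for which a² + a³ + a⁴ = 1; the space is
  -- spanned by b, b², b⁴ with b⁸ = b² + b.
  zeroSum-5 : Basis (Fixed 3) 3 → Basis (Fixed 7) 7 → ZeroSum 5
  zeroSum-5 B₃ B₇ with cubic-root B₃ | septic-root B₇
  ... | a , a³ | b , b≢0 , b⁸≡ = Plane.plane-zeroSum a≢0 (*-≢0 a≢0 a≢0) a≢a² norm
      (Trinomial.good b≢0 b⁸≡) (Trinomial.S≡1 b≢0 b⁸≡) (T-vanish³ a b a⁸≡a b⁸≡) (T-vanish³ (a ²) b (cong _² a⁸≡a) b⁸≡)
    where
    reduce : ∀ {x} q → x ≡ q * (a * a ² + a + 1#) → x ≡ 0#
    reduce q eq = trans eq (trans (cong (q *_) a³) (zeroʳ q))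
    a≢0 : a ≢ 0#
    a≢0 refl = 0≢1 (trans (sym a³) (solve 0 (con false :* (con false :* con false) :+ con false :+ con true := con true) refl))
    a≢a² : a ≢ a ²
    a≢a² eq = 0≢1 (trans (sym (reduce 1# refl)) (trans (*-identityˡ _) (trans
      (cong (λ z → z + a + 1#) (trans (cong (a *_) (sym eq)) (sym eq)))
      (solve 1 (λ a → a :+ a :+ con true := con true) refl a))))
    norm : a ² + a * a ² + (a ²) ² ≡ 1#
    norm = +-≡0 (reduce (a + 1#) (solve 1 (λ a → (a :* a :+ a :* (a :* a) :+ (a :* a) :* (a :* a)) :+ con true :=
      (a :+ con true) :* (a :* (a :* a) :+ a :+ con true)) refl a))
    a⁸≡a : frob 3 a ≡ a
    a⁸≡a = +-≡0 (reduce (a * (a + 1#) * ((a + 1#) * (a + 1#) ² + (a + 1#) + 1#)) (solve 1 (λ a → let b = a :+ con true in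
        ((a :* a) :* (a :* a)) :* ((a :* a) :* (a :* a)) :+ a :=
        (a :* b :* (b :* (b :* b) :+ b :+ con true)) :* (a :* (a :* a) :+ a :+ con true)) refl a))

  -- The size condition gives 3 · d⁴ < 2ⁿ for d = 4^(b+1), the number of characters summed in `solution`.
  zeroSum-conic : ∀ b → 8 ℕ.* suc b ℕ.+ 2 ℕ.≤ n → ZeroSum (suc b ℕ.+ 2)
  zeroSum-conic b le with nonzeroSum b b<n
    where
    b<n : suc b ℕ.< n
    b<n = ℕ.≤-trans (ℕ.≤-trans (ℕ.≤-reflexive (sym (ℕ.+-comm (suc b) 1)))
      (ℕ.+-mono-≤ (ℕ.m≤n*m (suc b) 8) (s≤s {0} {1} z≤n))) le
  ... | vs , g , s≢0 with normalise g s≢0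
  ...   | βs , h , s≡1 with solution βs h small
    where
    small : 3 ℕ.* (D βs ℕ.* D βs ℕ.* (D βs ℕ.* D βs)) ℕ.< 2 ℕ.^ n
    small = begin-strict
      3 ℕ.* (D βs ℕ.* D βs ℕ.* (D βs ℕ.* D βs))   ≡⟨ cong (3 ℕ.*_) powers ⟩
      3 ℕ.* 2 ℕ.^ (8 ℕ.* suc b)
        <⟨ ℕ.*-monoˡ-< (2 ℕ.^ (8 ℕ.* suc b)) {{ℕ.m^n≢0 2 (8 ℕ.* suc b)}} (ℕ.n<1+n 3) ⟩
      4 ℕ.* 2 ℕ.^ (8 ℕ.* suc b)                   ≡⟨ ℕ.*-comm 4 (2 ℕ.^ (8 ℕ.* suc b)) ⟩
      2 ℕ.^ (8 ℕ.* suc b) ℕ.* 2 ℕ.^ 2             ≡⟨ ℕ.^-distribˡ-+-* 2 (8 ℕ.* suc b) 2 ⟨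
      2 ℕ.^ (8 ℕ.* suc b ℕ.+ 2)                   ≤⟨ ℕ.^-monoʳ-≤ 2 le ⟩
      2 ℕ.^ n                                     ∎
      where
      open ℕ.≤-Reasoning
      square : ∀ m → 2 ℕ.^ m ℕ.* 2 ℕ.^ m ≡ 2 ℕ.^ (m ℕ.+ m)
      square m = sym (ℕ.^-distribˡ-+-* 2 m m)
      powers : D βs ℕ.* D βs ℕ.* (D βs ℕ.* D βs) ≡ 2 ℕ.^ (8 ℕ.* suc b)
      powers = trans (cong (λ d → d ℕ.* d ℕ.* (d ℕ.* d)) (square (suc b)))
        (trans (cong (λ d → d ℕ.* d) (square (suc b ℕ.+ suc b)))
          (trans (square (suc b ℕ.+ suc b ℕ.+ (suc b ℕ.+ suc b))) (cong (2 ℕ.^_) (eightfold (suc b)))))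
        where
        eightfold : ∀ b → b ℕ.+ b ℕ.+ (b ℕ.+ b) ℕ.+ (b ℕ.+ b ℕ.+ (b ℕ.+ b)) ≡ 8 ℕ.* b
        eightfold = ℕS.solve-∀
  ...     | (a₁ , a₂) , norm , (a₁≢0 , a₂≢0 , a₁≢a₂) , kills₁ , kills₂ =
    Plane.plane-zeroSum a₁≢0 a₂≢0 a₁≢a₂ norm h s≡1 kills₁ kills₂

  -- The full range of dimensions

  sumFree : ∀ {k} → ¬ ZeroSum k → SumFree F k (finv F)
  sumFree none a vs li eq with L vs a ≟ 0#
  ... | yes z = none (vs , indep⇒good li , trans (sym (affineSum-inside (indep⇒good li) z)) eq)
  ... | no ne = *-≢0 (P-≢0 (indep⇒good li)) (⁻¹-≢0 ne) (trans (sym (affineSum-outside vs a ne)) eq)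

  ¬sumFree : ∀ {k} → ZeroSum k → ¬ SumFree F k (finv F)
  ¬sumFree (vs , g , s) sf = sf 0# vs (good⇒indep g) (trans (affineSum-inside g (L-0 vs)) s)

  InK⇒range : 3 ℕ.≤ n → ∀ k → InK F k → 3 ℕ.≤ k × k ℕ.≤ n ℕ.∸ 3
  InK⇒range 3≤n k (1≤k , k≤n-1 , ¬sf) = lower k 1≤k ¬sf , upper (n ℕ.∸ k) (ℕ.m∸n+n≡m k≤n)
    where
    k≤n : k ℕ.≤ n
    k≤n = ℕ.≤-trans k≤n-1 (ℕ.m∸n≤m n 1)
    lower : ∀ k → 1 ℕ.≤ k → ¬ SumFree F k (finv F) → 3 ℕ.≤ k
    lower 1 _ ¬sf = contradiction (sumFree ¬zeroSum-1) ¬sf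
    lower 2 _ ¬sf = contradiction (sumFree ¬zeroSum-2) ¬sf
    lower (suc (suc (suc k))) _ _ = s≤s (s≤s (s≤s z≤n))
    upper : ∀ d → d ℕ.+ k ≡ n → k ℕ.≤ n ℕ.∸ 3
    upper 0 eq =
      contradiction (subst (λ m → m ℕ.≤ n ℕ.∸ 1) eq k≤n-1) (ℕ.<⇒≱ (ℕ.∸-monoʳ-< (s≤s z≤n) (ℕ.≤-trans (s≤s z≤n) 3≤n)))
    upper 1 eq = contradiction (sumFree (¬zeroSum-1 ∘ dual (ℕ.<⇒≤ 3≤n) 1 eq)) ¬sf
    upper 2 eq = contradiction (sumFree (¬zeroSum-2 ∘ dual (ℕ.<⇒≤ 3≤n) 2 eq)) ¬sf
    upper (suc (suc (suc d))) eq = subst (λ m → k ℕ.≤ m ℕ.∸ 3) eq (ℕ.m≤n+m k d)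

  module Range (l j : ℕ) (n≡ : suc j ℕ.* suc (suc l) ≡ n) (21≤n : 21 ℕ.≤ n)
    (bound : 2 ℕ.* (suc l ℕ.* (suc (suc l) ℕ.+ 2)) ℕ.≤ n ℕ.+ 1) (five : ZeroSum 5) where

    private
      -- The divisor of n is p = s + 1, so s is the largest residue modulo p.
      s = suc l

    3s<n : 3 ℕ.* s ℕ.< n
    3s<n = ℕ.≤-pred (begin
      2 ℕ.+ 3 ℕ.* s                                              ≤⟨ ℕ.m≤m+n _ _ ⟩
      -- The added term is what remains of 2 s (s + 3) after 2 + 3 s, for s = l + 1.
      2 ℕ.+ 3 ℕ.* s ℕ.+ (3 ℕ.+ 7 ℕ.* l ℕ.+ 2 ℕ.* (l ℕ.* l))       ≡⟨ expand l ⟩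
      2 ℕ.* (s ℕ.* (suc s ℕ.+ 2))                                ≤⟨ bound ⟩
      n ℕ.+ 1                                                    ≡⟨ ℕ.+-comm n 1 ⟩
      suc n                                                      ∎)
      where
      open ℕ.≤-Reasoning
      expand : ∀ l → 2 ℕ.+ 3 ℕ.* suc l ℕ.+ (3 ℕ.+ 7 ℕ.* l ℕ.+ 2 ℕ.* (l ℕ.* l)) ≡ 2 ℕ.* (suc l ℕ.* (suc (suc l) ℕ.+ 2))
      expand = ℕS.solve-∀

    -- Dimensions 3 to s + 3 meet every residue class modulo s + 1. From dimension 6 on, a space of
    -- dimension 3 is added to one of dimension at most s, which `3s<n` permits.
    small : ∀ r → r ℕ.≤ s → ZeroSum (r ℕ.+ 3)
    small 0 _ = zeroSum-conic 0 (ℕ.≤-trans (ℕ.m≤m+n 10 11) 21≤n)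
    small 1 _ = zeroSum-conic 1 (ℕ.≤-trans (ℕ.m≤m+n 18 3) 21≤n)
    small 2 _ = five
    small (suc (suc (suc r))) le = zeroSum-+ (small 0 z≤n) (small r (ℕ.≤-trans (ℕ.m≤n+m r 3) le))
      (ℕ.≤-<-trans (ℕ.*-monoʳ-≤ 3 (ℕ.≤-trans (ℕ.≤-reflexive (ℕ.+-comm r 3)) le)) 3s<n)

    -- With p = s + 1 and k = d p + r + 3, the size hypothesis gives (d + r + 3) p = k + (p - 1) (r
    -- + 3) ≤ n / 2 + (n + 1) / 2 < n + p. Everything is doubled to avoid halves.
    fits : ∀ {r d} → r ℕ.≤ s → 2 ℕ.* (d ℕ.* suc s ℕ.+ (r ℕ.+ 3)) ℕ.≤ n → d ℕ.+ (r ℕ.+ 3) ℕ.≤ suc j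
    fits {r} {d} r≤s 2k≤n with (d ℕ.+ (r ℕ.+ 3)) ℕ.≤? suc j
    ... | yes p = p
    ... | no ¬p = contradiction 2k≤n (ℕ.<⇒≱ (ℕ.+-cancelʳ-< (n ℕ.+ 1) n (2 ℕ.* k) (begin-strict
      n ℕ.+ (n ℕ.+ 1)                                        <⟨ ℕ.m<m+n _ (s≤s z≤n) ⟩
      n ℕ.+ (n ℕ.+ 1) ℕ.+ (1 ℕ.+ 2 ℕ.* s)                      ≡⟨ regroup n s ⟩
      2 ℕ.* (suc s ℕ.+ n)                                    ≡⟨ cong (λ m → 2 ℕ.* (suc s ℕ.+ m)) n≡ ⟨
      2 ℕ.* (suc (suc j) ℕ.* suc s)
        ≤⟨ ℕ.*-monoʳ-≤ 2 (ℕ.*-monoˡ-≤ (suc s) (ℕ.≰⇒> ¬p)) ⟩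
      2 ℕ.* ((d ℕ.+ (r ℕ.+ 3)) ℕ.* suc s)                     ≡⟨ regroup′ d (r ℕ.+ 3) s ⟩
      2 ℕ.* k ℕ.+ 2 ℕ.* (s ℕ.* (r ℕ.+ 3))
        ≤⟨ ℕ.+-monoʳ-≤ (2 ℕ.* k) (ℕ.*-monoʳ-≤ 2 (ℕ.*-monoʳ-≤ s (ℕ.+-monoˡ-≤ 3 r≤s))) ⟩
      2 ℕ.* k ℕ.+ 2 ℕ.* (s ℕ.* (s ℕ.+ 3))
        ≡⟨ cong (λ t → 2 ℕ.* k ℕ.+ 2 ℕ.* (s ℕ.* t)) (ℕ.+-suc s 2) ⟩
      2 ℕ.* k ℕ.+ 2 ℕ.* (s ℕ.* (suc s ℕ.+ 2))                 ≤⟨ ℕ.+-monoʳ-≤ (2 ℕ.* k) bound ⟩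
      2 ℕ.* k ℕ.+ (n ℕ.+ 1)                                  ∎)))
      where
      open ℕ.≤-Reasoning
      k = d ℕ.* suc s ℕ.+ (r ℕ.+ 3)
      regroup : ∀ n s → n ℕ.+ (n ℕ.+ 1) ℕ.+ (1 ℕ.+ 2 ℕ.* s) ≡ 2 ℕ.* (suc s ℕ.+ n)
      regroup = ℕS.solve-∀
      regroup′ : ∀ d r s → 2 ℕ.* ((d ℕ.+ r) ℕ.* suc s) ≡ 2 ℕ.* (d ℕ.* suc s ℕ.+ r) ℕ.+ 2 ℕ.* (s ℕ.* r)
      regroup′ = ℕS.solve-∀

    -- Division of k - 3 by s + 1: the remainder selects the starting space and the quotient is the
    -- subfield dimension to be added.
    middle : ∀ k → 3 ℕ.≤ k → 2 ℕ.* k ℕ.≤ n → ZeroSum k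
    middle k 3≤k 2k≤n with small r r≤s
      where
      r = (k ℕ.∸ 3) ℕ.% suc s
      r≤s : r ℕ.≤ s
      r≤s = ℕ.≤-pred (ℕ.m%n<n (k ℕ.∸ 3) (suc s))
    ... | vs , g , z = subst ZeroSum k≡ (Shift.zeroSum-shift l j n≡ g z d
        (fits {r} {d} (ℕ.≤-pred (ℕ.m%n<n (k ℕ.∸ 3) (suc s))) (subst (λ k → 2 ℕ.* k ℕ.≤ n) (sym k≡) 2k≤n)))
      where
      r = (k ℕ.∸ 3) ℕ.% suc s
      d = (k ℕ.∸ 3) ℕ./ suc s
      k≡ : d ℕ.* suc s ℕ.+ (r ℕ.+ 3) ≡ k
      k≡ = trans (sym (ℕ.+-assoc (d ℕ.* suc s) r 3)) (trans (cong (ℕ._+ 3) (trans (ℕ.+-comm (d ℕ.* suc s) r)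
        (sym (ℕ.m≡m%n+[m/n]*n (k ℕ.∸ 3) (suc s))))) (ℕ.m∸n+n≡m 3≤k))

    all : ∀ k → 3 ℕ.≤ k → k ℕ.≤ n ℕ.∸ 3 → ZeroSum k
    all k 3≤k k≤n-3 with 2 ℕ.* k ℕ.≤? n
    ... | yes p = middle k 3≤k p
    ... | no ¬p = dual (ℕ.≤-trans (ℕ.m≤m+n 2 19) 21≤n) k (trans (ℕ.+-comm k e) e+k≡n) (middle e 3≤e 2e≤n)
      where
      e = n ℕ.∸ k
      k≤n : k ℕ.≤ n
      k≤n = ℕ.≤-trans k≤n-3 (ℕ.m∸n≤m n 3)
      e+k≡n : e ℕ.+ k ≡ n
      e+k≡n = ℕ.m∸n+n≡m k≤n
      3≤e : 3 ℕ.≤ e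
      3≤e = ℕ.≤-trans (ℕ.≤-reflexive (sym (ℕ.m∸[m∸n]≡n (ℕ.≤-trans (ℕ.m≤m+n 3 18) 21≤n)))) (ℕ.∸-monoʳ-≤ n k≤n-3)
      2e≤n : 2 ℕ.* e ℕ.≤ n
      2e≤n = ℕ.+-cancelʳ-≤ (2 ℕ.* k) (2 ℕ.* e) n (ℕ.≤-trans (ℕ.≤-reflexive (trans (sym (ℕ.*-distribˡ-+ 2 e k))
        (trans (cong (2 ℕ.*_) e+k≡n) (cong (n ℕ.+_) (ℕ.+-identityʳ n))))) (ℕ.+-monoʳ-≤ n (ℕ.<⇒≤ (ℕ.≰⇒> ¬p))))

    range⇒InK : ∀ k → 3 ℕ.≤ k × k ℕ.≤ n ℕ.∸ 3 → InK F k
    range⇒InK k (3≤k , k≤n-3) =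
      ℕ.≤-trans (s≤s z≤n) 3≤k , ℕ.≤-trans k≤n-3 (ℕ.∸-monoʳ-≤ n (s≤s z≤n)) , ¬sumFree (all k 3≤k k≤n-3)

  five : n ≡ 21 ⊎ 26 ℕ.≤ n → ZeroSum 5
  five (inj₁ n≡21) = zeroSum-5 (subfield 2 6 (sym n≡21)) (subfield 6 2 (sym n≡21))
  five (inj₂ 26≤n) = zeroSum-conic 2 26≤n

open import Defs
open import Data.Nat using (ℕ; _+_; _*_; _∸_; _≤_; _%_)
open import Data.Nat.Divisibility using (_∣_)
open import Data.Nat.Primality using (Prime)
open import Data.Product using (_×_)
open import Function.Bundles using (_⇔_)
open import Relation.Binary.PropositionalEquality using (_≡_)

-- Consequences of the size hypothesis and the theorem

-- The odd multiples of 3 from 19 on are 21, 27 and larger ones, so 26 separates 21 from the rest.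
multiple-of-3 : ∀ m → 20 ≤ m * 3 + 1 → (m * 3) % 2 ≡ 1 → m * 3 ≡ 21 ⊎ 26 ≤ m * 3
multiple-of-3 0 le _ = contradiction le (from-no (20 ℕ.≤? 1))
multiple-of-3 1 le _ = contradiction le (from-no (20 ℕ.≤? 4))
multiple-of-3 2 le _ = contradiction le (from-no (20 ℕ.≤? 7))
multiple-of-3 3 le _ = contradiction le (from-no (20 ℕ.≤? 10))
multiple-of-3 4 le _ = contradiction le (from-no (20 ℕ.≤? 13))
multiple-of-3 5 le _ = contradiction le (from-no (20 ℕ.≤? 16))
multiple-of-3 6 le _ = contradiction le (from-no (20 ℕ.≤? 19))
multiple-of-3 7 _  _ = inj₁ refl
multiple-of-3 8 _  ()
multiple-of-3 (suc (suc (suc (suc (suc (suc (suc (suc (suc m))))))))) _ _ = inj₂ (ℕ.m≤m+n 26 (suc (m * 3)))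

-- Divisor 2 contradicts oddness, and divisor 3 gives 20 ≤ n + 1. A divisor of at least 4 gives 2 ·
-- 3 · 6 = 36 ≤ n + 1, well above 26.
admissible : ∀ {n} l q → n ≡ q * suc (suc l) → n % 2 ≡ 1 → 2 * (suc l * (suc (suc l) + 2)) ≤ n + 1 → n ≡ 21 ⊎ 26 ≤ n
admissible 0 q refl odd _ = contradiction (trans (sym odd) (ℕ.m*n%n≡0 q 2)) λ()
admissible 1 q refl odd bound = multiple-of-3 q bound odd
admissible {n} (suc (suc l)) q eq odd bound = inj₂ (ℕ.≤-trans (ℕ.m≤m+n 26 9) (ℕ.+-cancelʳ-≤ 1 35 n
  (ℕ.≤-trans (ℕ.*-monoʳ-≤ 2 (ℕ.*-mono-≤ {3} {suc (suc (suc l))} {6} (ℕ.m≤m+n 3 l) (ℕ.≤-trans (ℕ.m≤m+n 6 l) (ℕ.≤-reflexive (expand l))))) bound)))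
  where
  expand : ∀ l → 6 + l ≡ suc (suc (suc (suc l))) + 2
  expand = ℕS.solve-∀

theorem3p6 : (n : ℕ) → 3 ≤ n → n % 2 ≡ 1 →
    (l : ℕ) → Prime l → l ∣ n → (∀ p → Prime p → p ∣ n → l ≤ p) →
    2 * ((l ∸ 1) * (l + 2)) ≤ n + 1 →
    (F : GF2^ n) → (k : ℕ) → InK F k ⇔ ((3 ≤ k) × (k ≤ n ∸ 3))
theorem3p6 n 3≤n odd 0 l-prime _ _ _ F k = contradiction l-prime ¬prime[0]
theorem3p6 n 3≤n odd 1 l-prime _ _ _ F k = contradiction l-prime ¬prime[1]
theorem3p6 n 3≤n odd (suc (suc l)) _ (divides 0 eq) _ _ F k = contradiction (subst (3 ≤_) eq 3≤n) λ()
theorem3p6 n 3≤n odd (suc (suc l)) _ (divides (suc j) eq) _ bound F k =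
  mk⇔ (Dimensions.InK⇒range F odd 3≤n k) (Dimensions.Range.range⇒InK F odd l j (sym eq) (at-least size) bound (Dimensions.five F odd size) k)
  where
  size : n ≡ 21 ⊎ 26 ≤ n
  size = admissible l (suc j) eq odd bound
  at-least : n ≡ 21 ⊎ 26 ≤ n → 21 ≤ n
  at-least (inj₁ n≡21) = ℕ.≤-reflexive (sym n≡21)
  at-least (inj₂ 26≤n) = ℕ.≤-trans (ℕ.m≤m+n 21 5) 26≤n
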